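{- Let $\Phi$ be an affine root system of rank $3$ with Weyl group $W$, and let $\overline{\Phi}$ be its set of rays with involution $\ast$ given by negation. Then there is a unique oriented matroid root system structure on $\Phi$; that is, there is exactly one closure operator $d$ on $\overline{\Phi}$ such that $(\overline{\Phi},\ast,d)$ is an oriented matroid root system for $W$.
   Context: **Root systems.** Let $V$ be a finite-dimensional real vector space with a symmetric bilinear form $(\cdot,\cdot)$, and let $\Pi\subset V$ be a finite set (the simple roots) which is positively independent (a linear combination of $\Pi$ with nonnegative coefficients is $0$ only if all coefficients are $0$), with $(\alpha,\alpha)>0$ for $\alpha\in\Pi$, and with $\frac{(\alpha,\beta)}{\sqrt{(\alpha,\alpha)(\beta,\beta)}}\in\{ -\cos(\pi/m): m\in\mathbb{Z}_{\ge2}\}\cup(-\infty,-1]$ for distinct $\alpha,\beta\in\Pi$. Let $s_\alpha(v)=v-2\frac{(v,\alpha)}{(\alpha,\alpha)}\alpha$, $S=\{s_\alpha:\alpha\in\Pi\}$, $W=\langle S\rangle$ (then $(W,S)$ is a Coxeter system), $\Phi=W\Pi$ (a root system with base $\Pi$), $\Phi^+=\Phi\cap\operatorname{cone}(\Pi)$, so $\Phi=\Phi^+\sqcup-\Phi^+$. The rank of $\Phi$ is $|\Pi|=|S|$. The root system is affine if $(W,S)$ is irreducible and the form restricted to the span of $\Pi$ is positive semidefinite with one-dimensional radical; in rank $3$ this means $W$ is of type $\widetilde{A}_2$, $\widetilde{C}_2$ or $\widetilde{G}_2$. Here $\operatorname{cone}(A)$ is the set of finite nonnegative real linear combinations of elements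 of $A$ (so $\operatorname{cone}(\varnothing)=\{0\}$). **Reduction.** $\overline{\Phi}$ is the quotient of $\Phi$ identifying roots that are positive scalar multiples of each other (i.e. the set of rays spanned by roots); $\overline{\alpha}$ is the class of $\alpha$, $\overline{\Phi}^+$ is the image of $\Phi^+$, the involution $\ast$ on $\overline{\Phi}$ is $\overline{\alpha}\mapsto\overline{ -\alpha}$, and $W$ acts on $\overline{\Phi}$. For $X\subseteq\overline{\Phi}$, $\operatorname{cone}_\Phi(X)$ is the set of elements of $\overline{\Phi}$ whose representatives lie in the cone generated by representatives of $X$. **Oriented matroids.** An oriented matroid is a triple $(E,\ast,\mathrm{cx})$ where $E$ is a (possibly infinite) set, $\ast:E\to E$ is a fixed-point-free involution, and $\mathrm{cx}$ is a closure operator on subsets of $E$ such that for all $X\subseteq E$ and $x,y\in E$: (1) $\mathrm{cx}(X)^\ast=\mathrm{cx}(X^\ast)$; (2) if $x\in\mathrm{cx}(X\cup\{x^\ast\})$ then $x\in\mathrm{cx}(X)$; (3) if $x\in\mathrm{cx}(X\cup\{y^\ast\})$ and $x\notin\mathrm{cx}(X)$ then $y\in\mathrm{cx}((X\setminus\{y\})\cup\{x^\ast\})$; (4) if $x\in\mathrm{cx}(X)$ then $x\in\mathrm{cx}(Y)$ for some finite $Y\subseteq X$. It is reduced if $\mathrm{cx}(\varnothing)=\varnothing$ and $\mathrm{cx}(\{x\})=\{x\}$ for all $x\in E$. **Oriented matroid root systems.** An oriented matroid root system (OMRS) for $W$ is a reduced oriented matroid $(\overline{\Phi},\ast,d)$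 such that: (i) $d(wX)=w\,d(X)$ for all $X\subseteq\overline{\Phi}$, $w\in W$; (ii) $d(\overline{\Phi}^+)=\overline{\Phi}^+$; (iii) if $X\subseteq\overline{\Phi}$ has linear span of dimension at most $2$, then $d(X)=\operatorname{cone}_\Phi(X)$. -}

module Defs where

open import Algebra.Bundles using (CommutativeRing)
open import Algebra.Module.Bundles using (Module)
open import Data.Empty using (⊥-elim)
open import Data.Fin.Base using (Fin)
open import Data.List.Base using (List; []; _∷_; _++_; foldr)
open import Data.List.Relation.Unary.Any as Any using (Any)
open import Data.Nat.Base as ℕ using (ℕ)
open import Data.Product.Base using (_×_; _,_; proj₁; proj₂; ∃; ∃-syntax; ∃₂)
open import Data.Sum.Base using (_⊎_; inj₁; inj₂)
open import Data.Vec.Functional using (Vector)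
open import Function.Base using (_∘_)
open import Function.Definitions using (Injective)
open import Level using (0ℓ; suc)
open import Relation.Binary.Bundles using (Setoid)
open import Relation.Binary.Core using (Rel)
open import Relation.Binary.Definitions using (_Respects_)
open import Relation.Binary.PropositionalEquality as ≡ using (_≡_; _≢_)
open import Relation.Binary.Structures using (IsTotalOrder)
import Relation.Binary.Construct.NonStrictToStrict as Strict
import Relation.Binary.Reasoning.Setoid as SetoidReasoning
open import Relation.Nullary.Negation using (¬_)
open import Relation.Unary using (Pred; Satisfiable; ∁; U)

-- The real numbers, given by their axioms as a Dedekind complete ordered
-- field, which determine them up to isomorphism.  The value 0# ⁻¹ is
-- unspecified.
record CompleteOrderedField : Set₁ where
  infix  8 _⁻¹
  infixl 7 _/_
  infix  4 _≤_
  field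
    commutativeRing : CommutativeRing 0ℓ 0ℓ
  open CommutativeRing commutativeRing public
  field
    _⁻¹          : Carrier → Carrier
    ⁻¹-cong      : ∀ {x y} → x ≈ y → x ⁻¹ ≈ y ⁻¹
    ⁻¹-inverse   : ∀ {x} → ¬ (x ≈ 0#) → x * x ⁻¹ ≈ 1#
    0≉1          : ¬ (0# ≈ 1#)
    _≤_          : Rel Carrier 0ℓ
    isTotalOrder : IsTotalOrder _≈_ _≤_
    +-monoˡ-≤    : ∀ {x y} z → x ≤ y → x + z ≤ y + z
    *-nonNeg     : ∀ {x y} → 0# ≤ x → 0# ≤ y → 0# ≤ x * y

  IsUpperBound : Pred Carrier 0ℓ → Pred Carrier 0ℓ
  IsUpperBound P u = ∀ x → P x → x ≤ u

  field
    supremum : (P : Pred Carrier 0ℓ) → Satisfiable P → ∃ (IsUpperBound P) →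
               ∃[ s ] (IsUpperBound P s × (∀ u → IsUpperBound P u → s ≤ u))

  open IsTotalOrder isTotalOrder public
    using (antisym; total; ≤-respʳ-≈; ≤-respˡ-≈)
    renaming (refl to ≤-refl; reflexive to ≤-reflexive; trans to ≤-trans)
  open Strict _≈_ _≤_ public using (_<_)
  open import Algebra.Definitions.RawMonoid +-rawMonoid public
    using () renaming (_×_ to _×ℕ_)

  2# : Carrier
  2# = 1# + 1#

  _/_ : Carrier → Carrier → Carrier
  x / y = x * y ⁻¹

-- Apostol's axioms for sine and cosine (Calculus I, §2.5).  In a complete
-- ordered field exactly one triple (π , sin , cos) satisfies them.
record Trigonometry (K : CompleteOrderedField) : Set where
  open CompleteOrderedField K
  field
    π            : Carrier
    sin cos      : Carrier → Carrier
    sin-cong     : ∀ {x y} → x ≈ y → sin x ≈ sin y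
    cos-cong     : ∀ {x y} → x ≈ y → cos x ≈ cos y
    0<π          : 0# < π
    cos-0        : cos 0# ≈ 1#
    sin-π/2      : sin (π / 2#) ≈ 1#
    cos-π        : cos π ≈ - 1#
    cos-‿-       : ∀ x y → cos (y - x) ≈ cos y * cos x + sin y * sin x
    0<cos        : ∀ {x} → 0# < x → x < π / 2# → 0# < cos x
    cos<sin/x    : ∀ {x} → 0# < x → x < π / 2# → cos x < sin x / x
    sin/x<1/cos  : ∀ {x} → 0# < x → x < π / 2# → sin x / x < 1# / cos x

module OrderedFieldProperties (K : CompleteOrderedField) where
  open CompleteOrderedField K
  open import Algebra.Properties.Ring ring
    using (-‿distribʳ-*; -‿distribˡ-*; -‿involutive)
  open SetoidReasoning setoid

  0≤-neg : ∀ {x} → x ≤ 0# → 0# ≤ - x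
  0≤-neg {x} x≤0 =
    ≤-respʳ-≈ (+-identityˡ (- x)) (≤-respˡ-≈ (-‿inverseʳ x) (+-monoˡ-≤ (- x) x≤0))

  0≤1 : 0# ≤ 1#
  0≤1 with total 0# 1#
  ... | inj₁ 0≤1 = 0≤1
  ... | inj₂ 1≤0 = ≤-respʳ-≈ eq (*-nonNeg (0≤-neg 1≤0) (0≤-neg 1≤0))
    where
    eq : (- 1#) * (- 1#) ≈ 1#
    eq = begin
      (- 1#) * (- 1#)  ≈⟨ -‿distribˡ-* 1# (- 1#) ⟨
      - (1# * (- 1#))  ≈⟨ -‿cong (*-identityˡ (- 1#)) ⟩
      - (- 1#)         ≈⟨ -‿involutive 1# ⟩
      1#               ∎

  0<1 : 0# < 1#
  0<1 = 0≤1 , 0≉1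

  0≰-1 : ¬ (0# ≤ - 1#)
  0≰-1 0≤-1 = 0≉1 (antisym 0≤1
    (≤-respʳ-≈ (-‿inverseˡ 1#) (≤-respˡ-≈ (+-identityˡ 1#) (+-monoˡ-≤ 1# 0≤-1))))

  *-positive : ∀ {x y} → 0# < x → 0# < y → 0# < x * y
  *-positive {x} {y} (0≤x , 0≉x) (0≤y , 0≉y) = *-nonNeg 0≤x 0≤y , λ 0≈xy → 0≉y (begin
    0#              ≈⟨ zeroʳ (x ⁻¹) ⟨
    x ⁻¹ * 0#       ≈⟨ *-congˡ 0≈xy ⟩
    x ⁻¹ * (x * y)  ≈⟨ *-assoc (x ⁻¹) x y ⟨
    x ⁻¹ * x * y    ≈⟨ *-congʳ (trans (*-comm (x ⁻¹) x) (⁻¹-inverse (0≉x ∘ sym))) ⟩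
    1# * y          ≈⟨ *-identityˡ y ⟩
    y               ∎)

  ⁻¹-positive : ∀ {x} → 0# < x → 0# < x ⁻¹
  ⁻¹-positive {x} (0≤x , 0≉x) = 0≤x⁻¹ (total 0# (x ⁻¹)) , λ 0≈x⁻¹ →
    0≉1 (trans (sym (zeroʳ x)) (trans (*-congˡ 0≈x⁻¹) xx⁻¹≈1))
    where
    xx⁻¹≈1 : x * x ⁻¹ ≈ 1#
    xx⁻¹≈1 = ⁻¹-inverse (0≉x ∘ sym)

    0≤x⁻¹ : 0# ≤ x ⁻¹ ⊎ x ⁻¹ ≤ 0# → 0# ≤ x ⁻¹
    0≤x⁻¹ (inj₁ p) = p
    0≤x⁻¹ (inj₂ p) = ⊥-elim (0≰-1 (≤-respʳ-≈
      (trans (sym (-‿distribʳ-* x (x ⁻¹))) (-‿cong xx⁻¹≈1))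
      (*-nonNeg 0≤x (0≤-neg p))))

module LinearAlgebra (K : CompleteOrderedField)
                     (V : Module (CompleteOrderedField.commutativeRing K) 0ℓ 0ℓ) where
  open CompleteOrderedField K
  open Module V
  open import Algebra.Definitions.RawMonoid +ᴹ-rawMonoid using (sum)

  linComb : ∀ {n} → Vector Carrier n → Vector Carrierᴹ n → Carrierᴹ
  linComb c v = sum (λ i → c i *ₗ v i)

  Span : Pred Carrierᴹ 0ℓ → Pred Carrierᴹ 0ℓ
  Span P v = ∃[ n ] ∃₂ λ (c : Vector Carrier n) (a : Vector Carrierᴹ n) →
    (∀ i → P (a i)) × v ≈ᴹ linComb c a

  Cone : Pred Carrierᴹ 0ℓ → Pred Carrierᴹ 0ℓ
  Cone P v = ∃[ n ] ∃₂ λ (c : Vector Carrier n) (a : Vector Carrierᴹ n) →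
    (∀ i → 0# ≤ c i) × (∀ i → P (a i)) × v ≈ᴹ linComb c a

  LinearlyIndependent : ∀ {n} → Pred (Vector Carrierᴹ n) 0ℓ
  LinearlyIndependent v = ∀ c → linComb c v ≈ᴹ 0ᴹ → ∀ i → c i ≈ 0#

  PositivelyIndependent : ∀ {n} → Pred (Vector Carrierᴹ n) 0ℓ
  PositivelyIndependent v =
    ∀ c → (∀ i → 0# ≤ c i) → linComb c v ≈ᴹ 0ᴹ → ∀ i → c i ≈ 0#

  -- Meaningful for linear subspaces only.
  HasDimension : ℕ → Pred (Pred Carrierᴹ 0ℓ) 0ℓ
  HasDimension n P = ∃ λ (b : Vector Carrierᴹ n) →
    (∀ i → P (b i)) × LinearlyIndependent b × (∀ v → P v → ∃[ c ] v ≈ᴹ linComb c b)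

module Subsets (E : Setoid 0ℓ 0ℓ) where
  open Setoid E

  -- Subsets of the quotient of the carrier by _≈_.
  record Subset : Set₁ where
    field
      Mem  : Pred Carrier 0ℓ
      resp : Mem Respects _≈_
  open Subset public

  infix  4 _∈_ _∉_ _⊆_ _≐_
  infixr 6 _∪_
  infixl 6 _∖_

  _∈_ _∉_ : Carrier → Subset → Set
  x ∈ X = Mem X x
  x ∉ X = ¬ (x ∈ X)

  _⊆_ _≐_ : Subset → Subset → Set
  X ⊆ Y = ∀ {x} → x ∈ X → x ∈ Y
  X ≐ Y = X ⊆ Y × Y ⊆ X

  saturate : Pred Carrier 0ℓ → Subset
  saturate P = record
    { Mem  = λ x → ∃[ y ] (P y × x ≈ y)
    ; resp = λ { x≈x′ (y , Py , x≈y) → y , Py , trans (sym x≈x′) x≈y }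
    }

  image : (Carrier → Carrier) → Subset → Subset
  image f X = saturate (λ y → ∃[ x ] (x ∈ X × y ≈ f x))

  fromList : List Carrier → Subset
  fromList xs = record
    { Mem  = λ x → Any (x ≈_) xs
    ; resp = λ x≈y → Any.map (trans (sym x≈y))
    }

  ∅ : Subset
  ∅ = fromList []

  ⁅_⁆ : Carrier → Subset
  ⁅ x ⁆ = fromList (x ∷ [])

  _∪_ : Subset → Subset → Subset
  X ∪ Y = record
    { Mem  = λ x → x ∈ X ⊎ x ∈ Y
    ; resp = λ { x≈y (inj₁ p) → inj₁ (resp X x≈y p)
               ; x≈y (inj₂ p) → inj₂ (resp Y x≈y p) }
    }

  _∖_ : Subset → Subset → Subset
  X ∖ Y = record
    { Mem  = λ x → x ∈ X × x ∉ Y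
    ; resp = λ { x≈y (p , q) → resp X x≈y p , λ r → q (resp Y (sym x≈y) r) }
    }

  Operator : Set₁
  Operator = Subset → Subset

  infix 4 _≗_
  _≗_ : Operator → Operator → Set₁
  c ≗ d = ∀ X → c X ≐ d X

  record IsClosureOperator (cx : Operator) : Set₁ where
    field
      extensive  : ∀ X → X ⊆ cx X
      monotone   : ∀ {X Y} → X ⊆ Y → cx X ⊆ cx Y
      idempotent : ∀ X → cx (cx X) ≐ cx X

  record IsOrientedMatroid (_* : Carrier → Carrier) (cx : Operator) : Set₁ where
    field
      *-cong            : ∀ {x y} → x ≈ y → x * ≈ y *
      *-involutive      : ∀ x → (x *) * ≈ x
      *-fixedPointFree  : ∀ x → ¬ (x * ≈ x)
      isClosureOperator : IsClosureOperator cx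
      cx-*        : ∀ X → image _* (cx X) ≐ cx (image _* X)
      cx-opposite : ∀ X x → x ∈ cx (X ∪ ⁅ x * ⁆) → x ∈ cx X
      cx-exchange : ∀ X x y → x ∈ cx (X ∪ ⁅ y * ⁆) → x ∉ cx X →
                    y ∈ cx ((X ∖ ⁅ y ⁆) ∪ ⁅ x * ⁆)
      cx-finitary : ∀ X x → x ∈ cx X → ∃[ ys ] (fromList ys ⊆ X × x ∈ cx (fromList ys))

  record IsReduced (cx : Operator) : Set₁ where
    field
      cx-∅ : cx ∅ ≐ ∅
      cx-⁅⁆ : ∀ x → cx ⁅ x ⁆ ≐ ⁅ x ⁆

module _ {K : CompleteOrderedField} (T : Trigonometry K)
         (V : Module (CompleteOrderedField.commutativeRing K) 0ℓ 0ℓ) where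
  open CompleteOrderedField K
  open Trigonometry T
  open Module V
  open LinearAlgebra K V

  record RootSystem (rank : ℕ) : Set where
    field
      finiteDimensional : ∃[ n ] HasDimension n U

      ⟪_,_⟫     : Carrierᴹ → Carrierᴹ → Carrier
      ⟪⟫-cong   : ∀ {u u′ v v′} → u ≈ᴹ u′ → v ≈ᴹ v′ → ⟪ u , v ⟫ ≈ ⟪ u′ , v′ ⟫
      ⟪⟫-sym    : ∀ u v → ⟪ u , v ⟫ ≈ ⟪ v , u ⟫
      ⟪⟫-+ˡ     : ∀ u v w → ⟪ u +ᴹ v , w ⟫ ≈ ⟪ u , w ⟫ + ⟪ v , w ⟫
      ⟪⟫-*ˡ     : ∀ c u v → ⟪ c *ₗ u , v ⟫ ≈ c * ⟪ u , v ⟫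

      α                     : Vector Carrierᴹ rank
      α-injective           : Injective _≡_ _≈ᴹ_ α
      positivelyIndependent : PositivelyIndependent α
      α-positive            : ∀ i → 0# < ⟪ α i , α i ⟫
      -- r is the square root of (α , α)(β , β).
      α-angles              : ∀ i j → i ≢ j →
        ∃[ r ] (0# ≤ r × r * r ≈ ⟪ α i , α i ⟫ * ⟪ α j , α j ⟫ ×
               ((∃[ m ] (2 ℕ.≤ m × ⟪ α i , α j ⟫ / r ≈ - cos (π / (m ×ℕ 1#))))
                ⊎ ⟪ α i , α j ⟫ / r ≤ - 1#))

    Π : Pred Carrierᴹ 0ℓ
    Π v = ∃[ i ] v ≈ᴹ α i

    s : Fin rank → Carrierᴹ → Carrierᴹ
    s i v = v +ᴹ -ᴹ ((2# * ⟪ v , α i ⟫ / ⟪ α i , α i ⟫) *ₗ α i)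

    -- Every s i is an involution, so W consists of the maps act w.
    Word : Set
    Word = List (Fin rank)

    act : Word → Carrierᴹ → Carrierᴹ
    act w v = foldr s v w

    IsRoot : Pred Carrierᴹ 0ℓ
    IsRoot v = ∃₂ λ w i → v ≈ᴹ act w (α i)

module _ {K : CompleteOrderedField} {T : Trigonometry K}
         {V : Module (CompleteOrderedField.commutativeRing K) 0ℓ 0ℓ}
         {rank : ℕ} (Φ : RootSystem T V rank) where
  open CompleteOrderedField K
  open Module V
  open LinearAlgebra K V
  open RootSystem Φ

  -- (W , S) has no decomposition S = S₁ ⊔ S₂ into nonempty commuting parts.
  Irreducible : Set₁
  Irreducible = (P : Pred (Fin rank) 0ℓ) → Satisfiable P → Satisfiable (∁ P) →
    ∃₂ λ i j → P i × ¬ P j × ¬ (∀ v → s i (s j v) ≈ᴹ s j (s i v))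

  PositiveSemidefinite : Set
  PositiveSemidefinite = ∀ v → Span Π v → 0# ≤ ⟪ v , v ⟫

  Radical : Pred Carrierᴹ 0ℓ
  Radical v = Span Π v × (∀ u → Span Π u → ⟪ v , u ⟫ ≈ 0#)

  record Affine : Set₁ where
    field
      irreducible          : Irreducible
      positiveSemidefinite : PositiveSemidefinite
      radicalDimension     : HasDimension 1 Radical

  private
    module F where
      open OrderedFieldProperties K public
      open import Algebra.Properties.Ring ring public using (-1*x≈-x)
      open import Algebra.Module.Properties V public using (inverseʳ-uniqueᴹ)
      open import Algebra.Properties.AbelianGroup +ᴹ-abelianGroup public
        using () renaming (⁻¹-∙-comm to -ᴹ-+ᴹ-comm)
    open SetoidReasoning ≈ᴹ-setoid

    neg≈ : ∀ v → -ᴹ v ≈ᴹ (- 1#) *ₗ v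
    neg≈ v = ≈ᴹ-sym (F.inverseʳ-uniqueᴹ v ((- 1#) *ₗ v) (begin
      v +ᴹ (- 1#) *ₗ v         ≈⟨ +ᴹ-congʳ (*ₗ-identityˡ v) ⟨
      1# *ₗ v +ᴹ (- 1#) *ₗ v   ≈⟨ *ₗ-distribʳ v 1# (- 1#) ⟨
      (1# + (- 1#)) *ₗ v       ≈⟨ *ₗ-congʳ (-‿inverseʳ 1#) ⟩
      0# *ₗ v                  ≈⟨ *ₗ-zeroˡ v ⟩
      0ᴹ                       ∎))

    neg-* : ∀ c v → -ᴹ (c *ₗ v) ≈ᴹ c *ₗ (-ᴹ v)
    neg-* c v = begin
      -ᴹ (c *ₗ v)          ≈⟨ neg≈ (c *ₗ v) ⟩
      (- 1#) *ₗ (c *ₗ v)   ≈⟨ *ₗ-assoc (- 1#) c v ⟨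
      ((- 1#) * c) *ₗ v    ≈⟨ *ₗ-congʳ (*-comm (- 1#) c) ⟩
      (c * (- 1#)) *ₗ v    ≈⟨ *ₗ-assoc c (- 1#) v ⟩
      c *ₗ ((- 1#) *ₗ v)   ≈⟨ *ₗ-congˡ (neg≈ v) ⟨
      c *ₗ (-ᴹ v)          ∎

    s-cong : ∀ i {u v} → u ≈ᴹ v → s i u ≈ᴹ s i v
    s-cong i u≈v = +ᴹ-cong u≈v
      (-ᴹ‿cong (*ₗ-congʳ (*-congʳ (*-congˡ (⟪⟫-cong u≈v ≈ᴹ-refl)))))

    s-scale : ∀ i c v → s i (c *ₗ v) ≈ᴹ c *ₗ s i v
    s-scale i c v = begin
      c *ₗ v +ᴹ -ᴹ ((2# * ⟪ c *ₗ v , α i ⟫ / N) *ₗ α i)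
        ≈⟨ +ᴹ-congˡ (-ᴹ‿cong (*ₗ-congʳ coeff)) ⟩
      c *ₗ v +ᴹ -ᴹ ((c * (2# * ⟪ v , α i ⟫ / N)) *ₗ α i)
        ≈⟨ +ᴹ-congˡ (-ᴹ‿cong (*ₗ-assoc c _ (α i))) ⟩
      c *ₗ v +ᴹ -ᴹ (c *ₗ ((2# * ⟪ v , α i ⟫ / N) *ₗ α i))
        ≈⟨ +ᴹ-congˡ (neg-* c _) ⟩
      c *ₗ v +ᴹ c *ₗ (-ᴹ ((2# * ⟪ v , α i ⟫ / N) *ₗ α i))
        ≈⟨ *ₗ-distribˡ c v _ ⟨
      c *ₗ s i v ∎
      where
      N = ⟪ α i , α i ⟫
      coeff : 2# * ⟪ c *ₗ v , α i ⟫ / N ≈ c * (2# * ⟪ v , α i ⟫ / N)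
      coeff = trans (*-congʳ (trans (*-congˡ (⟪⟫-*ˡ c v (α i)))
        (trans (sym (*-assoc 2# c _)) (trans (*-congʳ (*-comm 2# c)) (*-assoc c 2# _)))))
        (*-assoc c _ (N ⁻¹))

    s-simple : ∀ i → s i (α i) ≈ᴹ -ᴹ (α i)
    s-simple i = begin
      α i +ᴹ -ᴹ ((2# * N / N) *ₗ α i)     ≈⟨ +ᴹ-congˡ (-ᴹ‿cong (*ₗ-congʳ coeff)) ⟩
      α i +ᴹ -ᴹ ((1# + 1#) *ₗ α i)        ≈⟨ +ᴹ-congˡ (-ᴹ‿cong (*ₗ-distribʳ (α i) 1# 1#)) ⟩
      α i +ᴹ -ᴹ (1# *ₗ α i +ᴹ 1# *ₗ α i)  ≈⟨ +ᴹ-congˡ (-ᴹ‿cong (+ᴹ-cong (*ₗ-identityˡ _) (*ₗ-identityˡ _))) ⟩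
      α i +ᴹ -ᴹ (α i +ᴹ α i)              ≈⟨ +ᴹ-congˡ (F.-ᴹ-+ᴹ-comm (α i) (α i)) ⟨
      α i +ᴹ (-ᴹ (α i) +ᴹ -ᴹ (α i))       ≈⟨ +ᴹ-assoc _ _ _ ⟨
      (α i +ᴹ -ᴹ (α i)) +ᴹ -ᴹ (α i)       ≈⟨ +ᴹ-congʳ (-ᴹ‿inverseʳ (α i)) ⟩
      0ᴹ +ᴹ -ᴹ (α i)                      ≈⟨ +ᴹ-identityˡ _ ⟩
      -ᴹ (α i)                            ∎
      where
      N = ⟪ α i , α i ⟫
      coeff : 2# * N / N ≈ 2#
      coeff = trans (*-assoc 2# N _)
        (trans (*-congˡ (⁻¹-inverse (proj₂ (α-positive i) ∘ sym))) (*-identityʳ 2#))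

    act-cong : ∀ w {u v} → u ≈ᴹ v → act w u ≈ᴹ act w v
    act-cong []      u≈v = u≈v
    act-cong (i ∷ w) u≈v = s-cong i (act-cong w u≈v)

    act-scale : ∀ w c v → act w (c *ₗ v) ≈ᴹ c *ₗ act w v
    act-scale []      c v = ≈ᴹ-refl
    act-scale (i ∷ w) c v = ≈ᴹ-trans (s-cong i (act-scale w c v)) (s-scale i c _)

    act-neg : ∀ w v → act w (-ᴹ v) ≈ᴹ -ᴹ (act w v)
    act-neg w v = ≈ᴹ-trans (act-cong w (neg≈ v))
      (≈ᴹ-trans (act-scale w (- 1#) v) (≈ᴹ-sym (neg≈ _)))

    act-++ : ∀ w w′ v → act (w ++ w′) v ≡ act w (act w′ v)
    act-++ []      w′ v = ≡.refl
    act-++ (i ∷ w) w′ v = ≡.cong (s i) (act-++ w w′ v)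

  record Root : Set where
    constructor _,ʳ_
    field
      vec    : Carrierᴹ
      isRoot : IsRoot vec
  open Root

  neg : Root → Root
  neg (v ,ʳ (w , i , v≈wα)) = (-ᴹ v) ,ʳ (w ++ (i ∷ []) , i , (begin
    -ᴹ v                       ≈⟨ -ᴹ‿cong v≈wα ⟩
    -ᴹ (act w (α i))           ≈⟨ act-neg w (α i) ⟨
    act w (-ᴹ (α i))           ≈⟨ act-cong w (s-simple i) ⟨
    act w (s i (α i))          ≡⟨ act-++ w (i ∷ []) (α i) ⟨
    act (w ++ (i ∷ [])) (α i)  ∎))

  infixr 8 _·_
  _·_ : Word → Root → Root
  w · (v ,ʳ (w′ , i , v≈w′α)) = act w v ,ʳ (w ++ w′ , i , (begin
    act w v               ≈⟨ act-cong w v≈w′α ⟩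
    act w (act w′ (α i))  ≡⟨ act-++ w w′ (α i) ⟨
    act (w ++ w′) (α i)   ∎))

  infix 4 _∼_
  _∼_ : Rel Root 0ℓ
  x ∼ y = ∃[ c ] (0# < c × vec x ≈ᴹ c *ₗ vec y)

  -- The quotient of Φ by positive proportionality.
  Φ̄ : Setoid 0ℓ 0ℓ
  Φ̄ = record
    { Carrier = Root
    ; _≈_     = _∼_
    ; isEquivalence = record
      { refl  = λ {x} → 1# , F.0<1 , ≈ᴹ-sym (*ₗ-identityˡ (vec x))
      ; sym   = λ { {x} {y} (c , 0<c , x≈cy) → c ⁻¹ , F.⁻¹-positive 0<c , (begin
          vec y                   ≈⟨ *ₗ-identityˡ (vec y) ⟨
          1# *ₗ vec y             ≈⟨ *ₗ-congʳ (trans (*-comm (c ⁻¹) c) (⁻¹-inverse (proj₂ 0<c ∘ sym))) ⟨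
          (c ⁻¹ * c) *ₗ vec y     ≈⟨ *ₗ-assoc (c ⁻¹) c (vec y) ⟩
          c ⁻¹ *ₗ (c *ₗ vec y)    ≈⟨ *ₗ-congˡ x≈cy ⟨
          c ⁻¹ *ₗ vec x           ∎) }
      ; trans = λ { {x} {y} {z} (c , 0<c , x≈cy) (d , 0<d , y≈dz) →
          c * d , F.*-positive 0<c 0<d , (begin
          vec x                ≈⟨ x≈cy ⟩
          c *ₗ vec y           ≈⟨ *ₗ-congˡ y≈dz ⟩
          c *ₗ (d *ₗ vec z)    ≈⟨ *ₗ-assoc c d (vec z) ⟨
          (c * d) *ₗ vec z     ∎) }
      }
    }

  open Subsets Φ̄

  -- The image in Φ̄ of Φ ∩ P.
  rays : Pred Carrierᴹ 0ℓ → Subset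
  rays P = saturate (P ∘ vec)

  representatives : Subset → Pred Carrierᴹ 0ℓ
  representatives X v = ∃[ x ] (x ∈ X × v ≈ᴹ vec x)

  Φ̄⁺ : Subset
  Φ̄⁺ = rays (Cone Π)

  coneΦ : Subset → Subset
  coneΦ X = rays (Cone (representatives X))

  record IsOMRS (d : Operator) : Set₁ where
    field
      isOrientedMatroid : IsOrientedMatroid neg d
      isReduced         : IsReduced d
      equivariant       : ∀ w X → d (image (w ·_) X) ≐ image (w ·_) (d X)
      d-Φ̄⁺              : d Φ̄⁺ ≐ Φ̄⁺
      d-planar          : ∀ X k → k ℕ.≤ 2 → HasDimension k (Span (representatives X)) →
                          d X ≐ coneΦ X

{-# OPTIONS --safe #-}

-- Conical closure is an oriented matroid root system structure on every root system,
-- so the point is uniqueness, for which planarity and the oriented matroid axioms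
-- suffice.  Up to positive scalars the roots are the half-planes bounded by the lines
-- of the affine arrangement of type Ã₂, C̃₂ or G̃₂.  Contract an oriented matroid root
-- system at ± α: this gives rank two, where a configuration is a cyclic order.  The
-- lines crossing the line of α in neighbouring points can be joined by concurrent or
-- parallel triples of lines, so planarity forces their order along α to be the
-- geometric one.  Hence an element y of the cone over a, b, c lies in the closures of
-- ± a, b, c and of a, ± b, c, and since b, c, y are independent it lies in the closure
-- of a, b, c.  Conversely, if c had a negative coefficient in y, then c would lie in
-- the closure of ± a, ± b, - y, and y would lie in the plane of a and b.  Carathéodory's
-- theorem, which follows from the exchange axiom, reduces arbitrary generating sets to
-- triples.
module Submission where

open import Algebra.Bundles using (CommutativeMonoid)
open import Algebra.Module.Bundles using (Module)
import Algebra.Properties.CommutativeMonoid.Sum as Sum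
import Algebra.Properties.CommutativeSemigroup as CommutativeSemigroupProperties
import Algebra.Properties.Ring as RingProperties
import Algebra.Properties.Semiring.Mult.TCOptimised as Mult
import Algebra.Solver.Ring as RingSolver
open import Algebra.Solver.Ring.AlmostCommutativeRing
  using (fromCommutativeRing; _-Raw-AlmostCommutative⟶_)
open import Axiom.ExcludedMiddle using (ExcludedMiddle)
open import Data.Empty using (⊥; ⊥-elim)
open import Data.Fin using (#_)
open import Data.Fin.Base using (Fin; zero; suc; toℕ)
open import Data.Fin.Permutation using (permutation)
import Data.Fin.Properties as FinP
open import Data.Fin.Properties using (all?; any?)
open import Data.Integer.Base as Int using (ℤ; +_; -[1+_]; 0ℤ; 1ℤ; _⊖_)
open import Data.Integer.DivMod using (_/ℕ_; _%ℕ_; a≡a%ℕn+[a/ℕn]*n; n%ℕd<d)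
import Data.Integer.Properties as ℤP
open import Data.Integer.Tactic.RingSolver using (solve-∀)
open import Data.List.Base using (List; []; _∷_; _++_; map; length; reverse)
import Data.List.Membership.Propositional as ListMem
open import Data.List.Membership.Propositional.Properties using (∈-++⁻; ∈-++⁺ˡ; ∈-++⁺ʳ; ∈-map⁺)
import Data.List.Properties as ListP
open import Data.List.Relation.Binary.Pointwise.Base using (Pointwise; []; _∷_)
open import Data.List.Relation.Unary.Any using (here; there)
open import Data.List.Relation.Unary.Any.Properties using (¬Any[])
open import Data.Maybe.Base using (Maybe; just; nothing)
open import Data.Nat.Base as ℕ using (ℕ; suc; zero)
import Data.Nat.Properties as ℕP
open import Data.Product using (∃!)
open import Data.Product.Base using (_×_; _,_; proj₁; proj₂; ∃; ∃-syntax; ∃₂)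
open import Data.Product.Properties using (≡-dec)
open import Data.Sum.Base using (_⊎_; inj₁; inj₂; [_,_]′)
open import Data.Vec.Base using (Vec; []; _∷_; lookup)
open import Data.Vec.Functional as Vector using (Vector)
open import Function.Base using (_∘_; id)
open import Level using (0ℓ)
open import Relation.Binary.Bundles using (Setoid)
open import Relation.Binary.Definitions using (tri<; tri≈; tri>)
open import Relation.Binary.PropositionalEquality as ≡ using (_≡_; _≢_)
import Relation.Binary.Reasoning.Setoid as SetoidReasoning
open import Relation.Nullary.Decidable
  using (Dec; yes; no; True; toWitness; _×-dec_; _⊎-dec_; _→-dec_; ¬?)
open import Relation.Nullary.Negation.Core using (¬_)
open import Relation.Unary using (Pred)

-- The obstacle is arithmetic. Two lines β and γ that cross the line of α meet on a parallel of α,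
-- and this parallel is the line of a root only if its height is an integer, that is, if the
-- determinant ω of the directions of β and γ divides τ. Roots are therefore coded as an integral
-- direction with an integral height. Modulo ± α a line may be sheared by multiples of α without
-- moving its crossing point, and in the three types two lines of different levels over α can be
-- sheared until ω is a unit; this makes neighbouring crossings comparable. Lines of equal level
-- become parallel, and moving a line parallel to itself needs a separate argument when neither its
-- sum nor its difference with α is a direction. Integral heights are possible because only rays
-- count: the simple roots are rescaled so that every direction occurs at every integral height. To
-- find the scales, cosines are evaluated only for m = 2 and m = 3. For m ≥ 4, infinite bonds
-- included, the bound 2 c² ≥ 1 is used, and the vanishing of the Gram determinant leads from there
-- to the exact Cartan integers.

module Combinatorics where
  open ≡ using (refl; sym; trans; cong; cong₂; subst)
  open ListMem using (_∈_)

  -- L ⊢ p says that p lies in the closure of the finite set L.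
  record Entailment (P : Set) (neg : P → P) : Set₁ where
    infix 4 _⊢_
    field
      _⊢_      : List P → P → Set
      ⊢-∈      : ∀ {L p} → p ∈ L → L ⊢ p
      ⊢-cut    : ∀ {L M p} → (∀ {q} → q ∈ M → L ⊢ q) → M ⊢ p → L ⊢ p
      ⊢-neg    : ∀ {L p} → L ⊢ p → map neg L ⊢ neg p
      ⊢-opp    : ∀ {L p} → neg p ∷ L ⊢ p → L ⊢ p
      -- The list `Q` stands for `L` without `y`: deletion from a list is replaced by the
      -- requirement that `Q` contain every member of `L` other than `y`.
      ⊢-exch   : ∀ {L Q x y} → (∀ {q} → q ∈ L → q ≡ y ⊎ q ∈ Q) →
                 neg y ∷ L ⊢ x → ¬ (L ⊢ x) → neg x ∷ Q ⊢ y
      neg-invo : ∀ p → neg (neg p) ≡ p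
      -- Exchange arguments split on membership in a closure; excluded middle will supply this
      -- field.
      ⊢-dec    : ∀ L p → Dec (L ⊢ p)

    ⊢-mono : ∀ {L M p} → (∀ {q} → q ∈ M → q ∈ L) → M ⊢ p → L ⊢ p
    ⊢-mono M⊆L = ⊢-cut (⊢-∈ ∘ M⊆L)

    ⊢-exchange : ∀ {L x y} → y ∷ L ⊢ x → ¬ (L ⊢ x) → neg x ∷ L ⊢ neg y
    ⊢-exchange {L} {x} {y} y∷L⊢x =
      ⊢-exch inj₂ (subst (λ z → z ∷ L ⊢ x) (sym (neg-invo y)) y∷L⊢x)

    swap : ∀ {x y : P} {L q} → q ∈ x ∷ y ∷ L → q ∈ y ∷ x ∷ L
    swap (here p)           = there (here p)
    swap (there (here p))   = here p
    swap (there (there p))  = there (there p)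

    under : ∀ {x : P} {L M} → (∀ {q} → q ∈ L → q ∈ M) → ∀ {q} → q ∈ x ∷ L → q ∈ x ∷ M
    under f (here p)  = here p
    under f (there p) = there (f p)

    -- If `n ∷ L` does not yield `x`, exchanging `neg n` against `x` gives `neg x ∷ L ⊢ n`. Either
    -- `L` alone yields `n`, which can then be cut out, or a second exchange, of `neg x` against
    -- `n`, gives `neg n ∷ L ⊢ x`.
    ⊢-line : ∀ {L n x} → n ∷ neg n ∷ L ⊢ x → n ∷ L ⊢ x ⊎ neg n ∷ L ⊢ x
    ⊢-line {L} {n} {x} h with ⊢-dec (n ∷ L) x
    ... | yes p = inj₁ p
    ... | no ¬p = inj₂ (via (⊢-dec L n))
      where
      x*∷L⊢n : neg x ∷ L ⊢ n
      x*∷L⊢n = ⊢-exch (λ { (here q≡n) → inj₁ q≡n ; (there q∈L) → inj₂ q∈L })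
                      (⊢-mono swap h) ¬p

      via : Dec (L ⊢ n) → neg n ∷ L ⊢ x
      via (yes L⊢n) = ⊢-cut
        (λ { (here refl) → ⊢-mono there L⊢n ; (there q) → ⊢-∈ q }) h
      via (no ¬L⊢n) = subst (neg n ∷ L ⊢_) (neg-invo x) (⊢-exchange x*∷L⊢n ¬L⊢n)

    Signed : P → P → Set
    Signed m m′ = m′ ≡ m ⊎ m′ ≡ neg m

    private
      rotate : ∀ (x : P) L M {q} → q ∈ (x ∷ L) ++ M → q ∈ L ++ x ∷ M
      rotate x L M (here refl) = ∈-++⁺ʳ L (here refl)
      rotate x L M (there q) with ∈-++⁻ L q
      ... | inj₁ q∈L = ∈-++⁺ˡ q∈L
      ... | inj₂ q∈M = ∈-++⁺ʳ L (there q∈M)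

      unrotate : ∀ (x : P) L M {q} → q ∈ L ++ x ∷ M → q ∈ (x ∷ L) ++ M
      unrotate x L M q with ∈-++⁻ L q
      ... | inj₁ q∈L         = there (∈-++⁺ˡ q∈L)
      ... | inj₂ (here refl) = here refl
      ... | inj₂ (there q∈M) = there (∈-++⁺ʳ L q∈M)

    -- Carathéodory's exchange step: one of a ∷ M is superfluous.  An m which occurs in
    -- M′ with the sign - is first adjoined with both signs; if x then needs - m,
    -- exchanging m for - x in Q ++ a ∷ m ∷ M shows that m is superfluous.
    drop : ∀ Q {M M′ a x} → Pointwise Signed M M′ →
           Q ++ M′ ⊢ a → Q ++ a ∷ M ⊢ x →
           ∃[ L ] (length L ≡ length M × (∀ {q} → q ∈ L → q ∈ a ∷ M) × Q ++ L ⊢ x)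
    drop Q {a = a} [] Q⊢a Qa⊢x = [] , refl , (λ ()) ,
      ⊢-cut (λ q → [ ⊢-∈ ∘ ∈-++⁺ˡ , (λ { (here refl) → Q⊢a }) ]′ (∈-++⁻ Q q)) Qa⊢x
    drop Q {m ∷ M} {_ ∷ M′} {a} {x} (inj₁ refl ∷ s) h₁ h₂
      with drop (m ∷ Q) s (⊢-mono (unrotate m Q M′) h₁)
                (⊢-mono (unrotate m Q (a ∷ M) ∘ lift) h₂)
      where
      lift : ∀ {q} → q ∈ Q ++ a ∷ m ∷ M → q ∈ Q ++ m ∷ a ∷ M
      lift q with ∈-++⁻ Q q
      ... | inj₁ q∈Q = ∈-++⁺ˡ q∈Q
      ... | inj₂ q∈  = ∈-++⁺ʳ Q (swap q∈)
    ... | L , len , L⊆ , h = m ∷ L , cong suc len ,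
      (λ { (here p) → there (here p) ; (there q) → under there (L⊆ q) }) ,
      ⊢-mono (rotate m Q L) h
    drop Q {m ∷ M} {_ ∷ M′} {a} {x} (inj₂ refl ∷ s) h₁ h₂
      with drop (m ∷ neg m ∷ Q) s
                (⊢-mono (there ∘ unrotate (neg m) Q M′) h₁)
                (⊢-mono (λ q → [ there ∘ there ∘ ∈-++⁺ˡ
                               , (λ { (here p)          → there (there (∈-++⁺ʳ Q (here p)))
                                    ; (there (here p))  → here p
                                    ; (there (there q)) → there (there (∈-++⁺ʳ Q (there q))) })
                               ]′ (∈-++⁻ Q q)) h₂)
    ... | L , len , L⊆ , h with ⊢-line h
    ...   | inj₁ h′ = m ∷ L , cong suc len ,
      (λ { (here p) → there (here p) ; (there q) → under there (L⊆ q) }) ,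
      ⊢-mono (rotate m Q L) h′
    ...   | inj₂ h′ with ⊢-dec (Q ++ a ∷ M) x
    ...     | yes Q++aM⊢x = a ∷ M , refl , under there , Q++aM⊢x
    ...     | no ¬Q++aM⊢x = ⊥-elim (¬Q++aM⊢x (⊢-opp (⊢-cut
      (λ { (here refl) → ⊢-exchange (⊢-mono toFront h₂) ¬Q++aM⊢x
         ; (there q) → ⊢-mono there (⊢-∈ (inner q)) }) h′)))
      where
      toFront : ∀ {q} → q ∈ Q ++ a ∷ m ∷ M → q ∈ m ∷ Q ++ a ∷ M
      toFront q with ∈-++⁻ Q q
      ... | inj₁ q∈Q                = there (∈-++⁺ˡ q∈Q)
      ... | inj₂ (here p)           = there (∈-++⁺ʳ Q (here p))
      ... | inj₂ (there (here p))   = here p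
      ... | inj₂ (there (there q′)) = there (∈-++⁺ʳ Q (there q′))

      inner : ∀ {q} → q ∈ Q ++ L → q ∈ Q ++ a ∷ M
      inner q with ∈-++⁻ Q q
      ... | inj₁ q∈Q = ∈-++⁺ˡ q∈Q
      ... | inj₂ q∈L = ∈-++⁺ʳ Q (L⊆ q∈L)

  module _ {P : Set} {neg : P → P} (𝓔 : Entailment P neg) (α : P) where
    open Entailment 𝓔

    private
      3↦1 : ∀ {a b c : P} {L q} → q ∈ a ∷ b ∷ c ∷ L → q ∈ c ∷ a ∷ b ∷ L
      3↦1 (here p)                   = there (here p)
      3↦1 (there (here p))           = there (there (here p))
      3↦1 (there (there (here p)))   = here p
      3↦1 (there (there (there p)))  = there (there (there p))

      1↦3 : ∀ {a b c : P} {L q} → q ∈ c ∷ a ∷ b ∷ L → q ∈ a ∷ b ∷ c ∷ L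
      1↦3 = 3↦1 ∘ 3↦1

    -- The elements ± α stay in the ground set as loops, so no quotient of `P` is formed. Each axiom
    -- is the original one up to a permutation of the two additional generators; under negation they
    -- change places.
    contraction : Entailment P neg
    contraction = record
      { _⊢_      = λ L p → α ∷ neg α ∷ L ⊢ p
      ; ⊢-∈      = ⊢-∈ ∘ there ∘ there
      ; ⊢-cut    = λ f → ⊢-cut λ
        { (here p)           → ⊢-∈ (here p)
        ; (there (here p))   → ⊢-∈ (there (here p))
        ; (there (there q))  → f q }
      ; ⊢-neg    = λ {L} {p} h → ⊢-mono
        (λ { (here r)          → there (here r)
           ; (there (here r))  → here (trans r (neg-invo α))
           ; (there (there q)) → there (there q) }) (⊢-neg h)
      ; ⊢-opp    = λ h → ⊢-opp (⊢-mono 3↦1 h)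
      ; ⊢-exch   = λ {L} {Q} f h ¬h → ⊢-mono 1↦3 (⊢-exch
        (λ { (here p)          → inj₂ (here p)
           ; (there (here p))  → inj₂ (there (here p))
           ; (there (there q)) → [ inj₁ , inj₂ ∘ there ∘ there ]′ (f q) })
        (⊢-mono 3↦1 h) ¬h)
      ; neg-invo = neg-invo
      ; ⊢-dec    = λ L p → ⊢-dec (α ∷ neg α ∷ L) p
      }

  -- Signs and parity of integers.

  module Sign where
    open Int using (_<_; _≤_; _+_; _*_; _-_; -_)

    0<-neg : ∀ {x y} → x ≡ - y → y < 0ℤ → 0ℤ < x
    0<-neg refl y<0 = ℤP.neg-mono-< y<0

    0<-cong : ∀ {x y} → x ≡ y → 0ℤ < y → 0ℤ < x
    0<-cong refl p = p

    pos≢0 : ∀ {x} → 0ℤ < x → x ≢ 0ℤ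
    pos≢0 p refl = ℤP.<-irrefl refl p

    ¬0<×0≤- : ∀ {x y} → 0ℤ < x → 0ℤ ≤ y → y ≢ - x
    ¬0<×0≤- p q refl = ℤP.<⇒≱ (ℤP.neg-mono-< p) q

    0≤-+ : ∀ {x y} → 0ℤ ≤ x → 0ℤ ≤ y → 0ℤ ≤ x + y
    0≤-+ = ℤP.+-mono-≤

    0≤-* : ∀ {x y} → 0ℤ ≤ x → 0ℤ ≤ y → 0ℤ ≤ x * y
    0≤-* {x} {y} 0≤x 0≤y =
      subst (_≤ x * y) (ℤP.*-zeroʳ x) (ℤP.*-monoˡ-≤-nonNeg x ⦃ Int.nonNegative 0≤x ⦄ 0≤y)

    0<-* : ∀ {x y} → 0ℤ < x → 0ℤ < y → 0ℤ < x * y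
    0<-* {x} {y} 0<x 0<y =
      subst (_< x * y) (ℤP.*-zeroʳ x) (ℤP.*-monoˡ-<-pos x ⦃ Int.positive 0<x ⦄ 0<y)

    0≤-cancel : ∀ {x y} → 0ℤ < x → 0ℤ ≤ x * y → 0ℤ ≤ y
    0≤-cancel {x} {y} 0<x 0≤xy =
      ℤP.*-cancelˡ-≤-pos 0ℤ y x ⦃ Int.positive 0<x ⦄ (subst (_≤ x * y) (sym (ℤP.*-zeroʳ x)) 0≤xy)

    0<-cancel : ∀ {x y} → 0ℤ < x → 0ℤ < x * y → 0ℤ < y
    0<-cancel {x} {y} 0<x 0<xy =
      ℤP.*-cancelˡ-<-nonNeg x ⦃ Int.nonNegative (ℤP.<⇒≤ 0<x) ⦄ (subst (_< x * y) (sym (ℤP.*-zeroʳ x)) 0<xy)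

    0≤-neg : ∀ {x} → x ≤ 0ℤ → 0ℤ ≤ - x
    0≤-neg = ℤP.neg-mono-≤

    pos-pred : ∀ {x} → 0ℤ < x → 0ℤ ≤ x - 1ℤ
    pos-pred p = ℤP.i≤j⇒0≤j-i (ℤP.i<j⇒suc[i]≤j p)

    0≤-split : ∀ {x} → 0ℤ ≤ x → x ≡ 0ℤ ⊎ 0ℤ < x
    0≤-split {x} p with ℤP.<-cmp 0ℤ x
    ... | tri< q _ _ = inj₂ q
    ... | tri≈ _ q _ = inj₁ (sym q)
    ... | tri> _ _ q = ⊥-elim (ℤP.<⇒≱ q p)

    square-pos : ∀ {x} → x ≢ 0ℤ → 0ℤ < x * x
    square-pos {+ ℕ.zero}   x≢0 = ⊥-elim (x≢0 refl)
    square-pos {+ ℕ.suc n}  _   = Int.+<+ (ℕ.s≤s ℕ.z≤n)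
    square-pos { -[1+ n ]}  _   = Int.+<+ (ℕ.s≤s ℕ.z≤n)

    square-nonneg : ∀ x → 0ℤ ≤ x * x
    square-nonneg (+ ℕ.zero)  = ℤP.≤-refl
    square-nonneg (+ ℕ.suc n) = Int.+≤+ ℕ.z≤n
    square-nonneg -[1+ n ]    = Int.+≤+ ℕ.z≤n

    sum-of-squares : ∀ x y z → (x ≡ 0ℤ × y ≡ 0ℤ × z ≡ 0ℤ) ⊎ 0ℤ < x * x + y * y + z * z
    sum-of-squares x y z with x ℤP.≟ 0ℤ | y ℤP.≟ 0ℤ | z ℤP.≟ 0ℤ
    ... | yes p | yes q | yes r = inj₁ (p , q , r)
    ... | no ¬p | _ | _ = inj₂ (ℤP.+-mono-<-≤ (ℤP.+-mono-<-≤ (square-pos ¬p) (square-nonneg y)) (square-nonneg z))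
    ... | yes _ | no ¬q | _ = inj₂ (ℤP.+-mono-<-≤ (ℤP.+-mono-≤-< (square-nonneg x) (square-pos ¬q)) (square-nonneg z))
    ... | yes _ | yes _ | no ¬r = inj₂ (ℤP.+-mono-≤-< (0≤-+ (square-nonneg x) (square-nonneg y)) (square-pos ¬r))

    -- Here `q` is half of `z`, rounded up. In `rise` it places a line of level one next to a line
    -- of level two.
    halves : ∀ z → ∃[ q ] (z ≡ q + q ⊎ z ≡ q + q - 1ℤ)
    halves z with z %ℕ 2 in eq | n%ℕd<d z 2
    ... | 0 | _ = z /ℕ 2 , inj₁ (trans (a≡a%ℕn+[a/ℕn]*n z 2)
      (trans (cong (λ r → + r + (z /ℕ 2) * + 2) eq) (even (z /ℕ 2))))
      where
      even : ∀ q → + 0 + q * + 2 ≡ q + q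
      even = solve-∀
    ... | 1 | _ = z /ℕ 2 + 1ℤ , inj₂ (trans (a≡a%ℕn+[a/ℕn]*n z 2)
      (trans (cong (λ r → + r + (z /ℕ 2) * + 2) eq) (odd (z /ℕ 2))))
      where
      odd : ∀ q → + 1 + q * + 2 ≡ (q + 1ℤ) + (q + 1ℤ) - 1ℤ
      odd = solve-∀
    ... | suc (suc _) | ℕ.s≤s (ℕ.s≤s ())

  -- Oriented matroids of rank two.  The set U is a half-open half-plane, ordered
  -- by x < y iff 0 < τ x y, and δ is its boundary ray.
  module RankTwo
    {P : Set} {neg : P → P} (𝓔 : Entailment P neg)
    (δ : P) (U : P → Set) (τ : P → P → ℤ)
    (τ-anti  : ∀ x y → τ x y ≡ Int.- τ y x)
    (τ-negˡ  : ∀ x y → τ (neg x) y ≡ Int.- τ x y)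
    (initial : ∀ {x y} → U x → U y → 0ℤ Int.< τ x y → Entailment._⊢_ 𝓔 (y ∷ δ ∷ []) x)
    (simple  : ∀ {x y} → τ x y ≢ 0ℤ → ¬ Entailment._⊢_ 𝓔 (y ∷ []) x)
    (order   : ∀ {x y z} → U x → U y → U z → 0ℤ Int.< τ x y → 0ℤ Int.< τ y z → 0ℤ Int.≤ τ x z)
    where

    open Int using (_<_; _≤_; _+_; _*_; _-_; -_)
    open Entailment 𝓔
    open Sign

    private
      flip : ∀ {x y} → 0ℤ < τ x y → 0ℤ < τ (neg y) x
      flip {x} {y} p = 0<-cong (trans (τ-negˡ y x) (sym (τ-anti x y))) p

      flip′ : ∀ {x y} → 0ℤ < τ x y → 0ℤ < τ y (neg x)
      flip′ {x} {y} p = 0<-cong (trans (τ-anti y (neg x))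
        (trans (cong -_ (τ-negˡ x y)) (ℤP.neg-involutive (τ x y)))) p

      both : ∀ {x y} → 0ℤ < τ x y → 0ℤ < τ (neg x) (neg y)
      both {x} {y} p = 0<-cong (trans (τ-negˡ x (neg y)) (trans (cong -_
        (trans (τ-anti x (neg y)) (cong -_ (τ-negˡ y x))))
        (trans (ℤP.neg-involutive (- τ y x)) (sym (τ-anti x y))))) p

      ≢-sym : ∀ {x y} → 0ℤ < τ x y → τ y x ≢ 0ℤ
      ≢-sym {x} {y} p q = pos≢0 p (trans (τ-anti x y) (cong -_ q))

      exch : ∀ {b y z} → y ∷ z ∷ [] ⊢ b → ¬ (z ∷ [] ⊢ b) → b ∷ neg z ∷ [] ⊢ y
      exch {b} {y} {z} h ¬h = subst (λ p → b ∷ neg z ∷ [] ⊢ p) (neg-invo y)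
        (subst (λ p → p ∷ neg z ∷ [] ⊢ neg (neg y)) (neg-invo b)
          (⊢-neg (⊢-exchange h ¬h)))

      unneg : ∀ {b c y} → neg b ∷ neg c ∷ [] ⊢ neg y → b ∷ c ∷ [] ⊢ y
      unneg {b} {c} {y} h = subst (λ p → b ∷ c ∷ [] ⊢ p) (neg-invo y)
        (subst (λ p → p ∷ c ∷ [] ⊢ neg (neg y)) (neg-invo b)
        (subst (λ p → neg (neg b) ∷ p ∷ [] ⊢ neg (neg y)) (neg-invo c) (⊢-neg h)))

      -- From `b < y` the element `b` lies in the closure of `y` and δ, and exchange turns this into
      -- δ lying in the closure of `b` and `neg y`. Since `y` lies in the closure of `c` and δ,
      -- substituting for δ leaves `neg y` as the only extra generator, which `⊢-opp` removes.
      increasing : ∀ {b y c} → U b → U y → U c → 0ℤ < τ b y → 0ℤ < τ y c → b ∷ c ∷ [] ⊢ y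
      increasing {b} {y} {c} Ub Uy Uc b<y y<c = ⊢-opp (⊢-cut
        (λ { (here refl)         → ⊢-∈ (there (there (here refl)))
           ; (there (here refl)) → ⊢-mono
               (λ { (here p) → there (here p) ; (there (here p)) → here p }) δ∈ })
        (initial Uy Uc y<c))
        where
        δ∈ : b ∷ neg y ∷ [] ⊢ δ
        δ∈ = exch (⊢-mono swap (initial Ub Uy b<y)) (simple (pos≢0 b<y))

      -- An element outside the half-plane is replaced by its opposite. This permutes the three
      -- cyclically, to `neg c < b < y` or `neg y < neg c < b`, and exchange carries the conclusion
      -- of `increasing` back. With `y` alone outside, the order would be `c < neg y < b`, which
      -- `order` excludes against `b < c`.
      between⁺ : ∀ {b y c} → U b → U y ⊎ U (neg y) → U c ⊎ U (neg c) →
                 0ℤ < τ b y → 0ℤ < τ y c → 0ℤ < τ b c → b ∷ c ∷ [] ⊢ y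
      between⁺ Ub (inj₁ Uy) (inj₁ Uc) b<y y<c b<c = increasing Ub Uy Uc b<y y<c
      between⁺ {b} {y} {c} Ub (inj₁ Uy) (inj₂ Uc*) b<y y<c b<c =
        subst (λ p → b ∷ p ∷ [] ⊢ y) (neg-invo c)
          (exch (⊢-mono swap (increasing Uc* Ub Uy (flip b<c) b<y))
                (simple (≢-sym (flip b<c))))
      between⁺ {b} {y} {c} Ub (inj₂ Uy*) (inj₂ Uc*) b<y y<c b<c =
        ⊢-mono swap (subst (λ p → c ∷ p ∷ [] ⊢ y) (neg-invo b)
          (exch (unneg (subst (λ p → neg y ∷ p ∷ [] ⊢ neg c) (sym (neg-invo b))
                  (increasing Uy* Uc* Ub (both y<c) (flip b<c))))
                (simple (pos≢0 (flip′ b<c)))))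
      between⁺ {b} {y} {c} Ub (inj₂ Uy*) (inj₁ Uc) b<y y<c b<c =
        ⊥-elim (¬0<×0≤- b<c (order Uc Uy* Ub (flip′ y<c) (flip b<y)) (τ-anti c b))

    between : ∀ {b y c} → U b ⊎ U (neg b) → U y ⊎ U (neg y) → U c ⊎ U (neg c) →
              0ℤ < τ b y → 0ℤ < τ y c → 0ℤ < τ b c → b ∷ c ∷ [] ⊢ y
    between (inj₁ Ub)  = between⁺ Ub
    between {b} {y} {c} (inj₂ Ub*) Uy Uc b<y y<c b<c =
      unneg (between⁺ Ub* (inv Uy) (inv Uc) (both b<y) (both y<c) (both b<c))
      where
      inv : ∀ {x} → U x ⊎ U (neg x) → U (neg x) ⊎ U (neg (neg x))
      inv {x} (inj₁ Ux)  = inj₂ (subst U (sym (neg-invo x)) Ux)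
      inv     (inj₂ Ux*) = inj₁ Ux*

  -- A direction i stands for the linear form (x , y) ↦ x * dx i + y * dy i on the
  -- plane, and the element (i , k) for the affine half-plane on which it is ≥ - k.
  record Directions : Set where
    open Int using (_<_; _≤_; _+_; _*_; _-_; -_)
    field
      size  : ℕ
      dx dy : Fin size → ℤ
      opp   : Fin size → Fin size

    ω : Fin size → Fin size → ℤ
    ω i j = dx i * dy j - dy i * dx j

    field
      opp-opp  : ∀ i → opp (opp i) ≡ i
      dx-opp   : ∀ i → dx (opp i) ≡ - dx i
      dy-opp   : ∀ i → dy (opp i) ≡ - dy i
      parallel : ∀ i j → ω i j ≡ 0ℤ → j ≡ i ⊎ j ≡ opp i
      -- The directions of one positive level over `i` form part of a single string, so that a line
      -- can be sheared by multiples of the line of `i` into any other direction of its level.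
      string   : ∀ i j k → 0ℤ < ω i j → ω i j ≡ ω i k →
                 ∃[ q ] (dx k ≡ dx j + q * dx i × dy k ≡ dy j + q * dy i)
      -- Different levels contain a pair of directions with determinant ± 1. After shearing into
      -- such a pair, every division by ω is exact.
      steps    : ∀ i j k → 0ℤ < ω i j → 0ℤ < ω i k →
                 ω i j ≡ ω i k ⊎
                 ∃₂ λ j′ k′ → ω i j ≡ ω i j′ × ω i k′ ≡ ω i k ×
                              (ω k′ j′ ≡ 1ℤ ⊎ ω k′ j′ ≡ - 1ℤ)
      -- A neighbour of `k` in its string gives the triple that moves a line of direction `k`
      -- parallel to itself. The last alternative covers directions without a neighbour, such as one
      -- of two orthogonal long roots of C₂ over the other; there a direction of level one serves as
      -- an intermediate.
      raise    : ∀ i k → 0ℤ < ω i k →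
                 (∃[ k′ ] (dx k′ ≡ dx k + dx i × dy k′ ≡ dy k + dy i)) ⊎
                 (∃[ k′ ] (dx k′ ≡ dx k - dx i × dy k′ ≡ dy k - dy i)) ⊎
                 (ω i k ≡ + 2 × ∃[ j ] (ω i j ≡ 1ℤ × (ω j k ≡ 1ℤ ⊎ ω j k ≡ - 1ℤ)))

    Element : Set
    Element = Fin size × ℤ

    X Y Z : Element → ℤ
    X (i , _) = dx i
    Y (i , _) = dy i
    Z (_ , k) = k

    neg : Element → Element
    neg (i , k) = opp i , - k

    neg-neg : ∀ p → neg (neg p) ≡ p
    neg-neg (i , k) = cong₂ _,_ (opp-opp i) (ℤP.neg-involutive k)

    -- Minus the determinant; in the plane, β and γ cross the line of α in this order
    -- (in the direction in which both become positive) iff τ α β γ > 0.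
    τ : Element → Element → Element → ℤ
    τ a b c = (X a * Y c - Y a * X c) * Z b - (X a * Y b - Y a * X b) * Z c
              - (X b * Y c - Y b * X c) * Z a

    Combination : ℤ → Element → ℤ → Element → ℤ → Element → Set
    Combination l p m q n r = l * X p ≡ m * X q + n * X r ×
                              l * Y p ≡ m * Y q + n * Y r ×
                              l * Z p ≡ m * Z q + n * Z r

  -- Determinant identities and the order of lines along the line of a root.

  module Circuits (D : Directions) where
    open Directions D
    open Int using (_<_; _≤_; _+_; _*_; _-_; -_)
    open Sign

    ω-anti : ∀ b c → ω b c ≡ - ω c b
    ω-anti b c = lemma (dx b) (dy b) (dx c) (dy c)
      where
      lemma : ∀ b₁ b₂ c₁ c₂ → b₁ * c₂ - b₂ * c₁ ≡ - (c₁ * b₂ - c₂ * b₁)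
      lemma = solve-∀

    unit-flip : ∀ {b c} → ω c b ≡ 1ℤ ⊎ ω c b ≡ - 1ℤ → ω b c ≡ 1ℤ ⊎ ω b c ≡ - 1ℤ
    unit-flip {b} {c} (inj₁ e) = inj₂ (trans (ω-anti b c) (cong -_ e))
    unit-flip {b} {c} (inj₂ e) = inj₁ (trans (ω-anti b c) (cong -_ e))

    τ-swap₂₃ : ∀ a b c → τ a b c ≡ - τ a c b
    τ-swap₂₃ a b c = lemma (X a) (Y a) (Z a) (X b) (Y b) (Z b) (X c) (Y c) (Z c)
      where
      lemma : ∀ x₁ y₁ z₁ x₂ y₂ z₂ x₃ y₃ z₃ →
              (x₁ * y₃ - y₁ * x₃) * z₂ - (x₁ * y₂ - y₁ * x₂) * z₃ - (x₂ * y₃ - y₂ * x₃) * z₁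
              ≡ - ((x₁ * y₂ - y₁ * x₂) * z₃ - (x₁ * y₃ - y₁ * x₃) * z₂ - (x₃ * y₂ - y₃ * x₂) * z₁)
      lemma = solve-∀

    τ-cycle : ∀ a b c → τ a b c ≡ τ b c a
    τ-cycle a b c = lemma (X a) (Y a) (Z a) (X b) (Y b) (Z b) (X c) (Y c) (Z c)
      where
      lemma : ∀ x₁ y₁ z₁ x₂ y₂ z₂ x₃ y₃ z₃ →
              (x₁ * y₃ - y₁ * x₃) * z₂ - (x₁ * y₂ - y₁ * x₂) * z₃ - (x₂ * y₃ - y₂ * x₃) * z₁
              ≡ (x₂ * y₁ - y₂ * x₁) * z₃ - (x₂ * y₃ - y₂ * x₃) * z₁ - (x₃ * y₁ - y₃ * x₁) * z₂
      lemma = solve-∀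

    τ-repeat : ∀ a c → τ a a c ≡ 0ℤ
    τ-repeat a c = lemma (X a) (Y a) (Z a) (X c) (Y c) (Z c)
      where
      lemma : ∀ x₁ y₁ z₁ x₃ y₃ z₃ →
              (x₁ * y₃ - y₁ * x₃) * z₁ - (x₁ * y₁ - y₁ * x₁) * z₃ - (x₁ * y₃ - y₁ * x₃) * z₁ ≡ 0ℤ
      lemma = solve-∀

    τ-neg₂ : ∀ a b c → τ a (neg b) c ≡ - τ a b c
    τ-neg₂ a b c rewrite dx-opp (proj₁ b) | dy-opp (proj₁ b) =
      lemma (X a) (Y a) (Z a) (X b) (Y b) (Z b) (X c) (Y c) (Z c)
      where
      lemma : ∀ x₁ y₁ z₁ x₂ y₂ z₂ x₃ y₃ z₃ →
              (x₁ * y₃ - y₁ * x₃) * (- z₂) - (x₁ * (- y₂) - y₁ * (- x₂)) * z₃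
                - ((- x₂) * y₃ - (- y₂) * x₃) * z₁
              ≡ - ((x₁ * y₃ - y₁ * x₃) * z₂ - (x₁ * y₂ - y₁ * x₂) * z₃
                   - (x₂ * y₃ - y₂ * x₃) * z₁)
      lemma = solve-∀

    -- Cramer's rule, or the expansion of a four by four determinant with two equal rows. The
    -- coordinate `f` ranges over the three projections because the identity is polynomial and is
    -- checked in each of them.
    cramer : ∀ (f : Element → ℤ) → f ≡ X ⊎ f ≡ Y ⊎ f ≡ Z → ∀ a b c y →
             τ a b c * f y ≡ τ y b c * f a + τ a y c * f b + τ a b y * f c
    cramer _ (inj₁ refl) a b c y =
      lemma (X a) (Y a) (Z a) (X b) (Y b) (Z b) (X c) (Y c) (Z c) (X y) (Y y) (Z y)
      where
      lemma : ∀ x₁ y₁ z₁ x₂ y₂ z₂ x₃ y₃ z₃ x y z →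
        ((x₁ * y₃ - y₁ * x₃) * z₂ - (x₁ * y₂ - y₁ * x₂) * z₃ - (x₂ * y₃ - y₂ * x₃) * z₁) * x ≡
        ((x * y₃ - y * x₃) * z₂ - (x * y₂ - y * x₂) * z₃ - (x₂ * y₃ - y₂ * x₃) * z) * x₁ +
        ((x₁ * y₃ - y₁ * x₃) * z - (x₁ * y - y₁ * x) * z₃ - (x * y₃ - y * x₃) * z₁) * x₂ +
        ((x₁ * y - y₁ * x) * z₂ - (x₁ * y₂ - y₁ * x₂) * z - (x₂ * y - y₂ * x) * z₁) * x₃
      lemma = solve-∀
    cramer _ (inj₂ (inj₁ refl)) a b c y =
      lemma (X a) (Y a) (Z a) (X b) (Y b) (Z b) (X c) (Y c) (Z c) (X y) (Y y) (Z y)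
      where
      lemma : ∀ x₁ y₁ z₁ x₂ y₂ z₂ x₃ y₃ z₃ x y z →
        ((x₁ * y₃ - y₁ * x₃) * z₂ - (x₁ * y₂ - y₁ * x₂) * z₃ - (x₂ * y₃ - y₂ * x₃) * z₁) * y ≡
        ((x * y₃ - y * x₃) * z₂ - (x * y₂ - y * x₂) * z₃ - (x₂ * y₃ - y₂ * x₃) * z) * y₁ +
        ((x₁ * y₃ - y₁ * x₃) * z - (x₁ * y - y₁ * x) * z₃ - (x * y₃ - y * x₃) * z₁) * y₂ +
        ((x₁ * y - y₁ * x) * z₂ - (x₁ * y₂ - y₁ * x₂) * z - (x₂ * y - y₂ * x) * z₁) * y₃
      lemma = solve-∀
    cramer _ (inj₂ (inj₂ refl)) a b c y =
      lemma (X a) (Y a) (Z a) (X b) (Y b) (Z b) (X c) (Y c) (Z c) (X y) (Y y) (Z y)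
      where
      lemma : ∀ x₁ y₁ z₁ x₂ y₂ z₂ x₃ y₃ z₃ x y z →
        ((x₁ * y₃ - y₁ * x₃) * z₂ - (x₁ * y₂ - y₁ * x₂) * z₃ - (x₂ * y₃ - y₂ * x₃) * z₁) * z ≡
        ((x * y₃ - y * x₃) * z₂ - (x * y₂ - y * x₂) * z₃ - (x₂ * y₃ - y₂ * x₃) * z) * z₁ +
        ((x₁ * y₃ - y₁ * x₃) * z - (x₁ * y - y₁ * x) * z₃ - (x * y₃ - y * x₃) * z₁) * z₂ +
        ((x₁ * y - y₁ * x) * z₂ - (x₁ * y₂ - y₁ * x₂) * z - (x₂ * y - y₂ * x) * z₁) * z₃
      lemma = solve-∀

    module PlanarEntailment
      (𝓔 : Entailment Element neg)
      (planar    : ∀ {p q r} l m n → 0ℤ < l → 0ℤ ≤ m → 0ℤ ≤ n →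
                   Combination l p m q n r → Entailment._⊢_ 𝓔 (q ∷ r ∷ []) p)
      (nonplanar : ∀ {q r t} → τ q r t ≢ 0ℤ →
                   ¬ Entailment._⊢_ 𝓔 (q ∷ neg q ∷ r ∷ neg r ∷ []) t)
      where

      module Contraction (α : Element) where
        private
          a  = proj₁ α
          k₀ = proj₂ α

          module M  = Entailment 𝓔
          module Mα = Entailment (contraction 𝓔 α)
        open Mα using () renaming (_⊢_ to _⊩_)

        h : Element → ℤ
        h β = ω a (proj₁ β)

        shift : ℤ → Element
        shift J = a , k₀ + J

        -- Modulo ± α this is a positive constant on the line of α. In the contraction it spans the
        -- boundary ray of the half-plane.
        δ : Element
        δ = shift 1ℤ

        -- Adding a positive constant moves the zero of an increasing form on the line of α
        -- backwards. For elements of positive level, `γ ⊵ β` is thus the abstract form of: β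
        -- crosses the line of α no later than γ.
        _⊵_ : Element → Element → Set
        γ ⊵ β = γ ∷ δ ∷ [] ⊩ β

        ⊵-trans : ∀ {β γ ρ} → ρ ⊵ γ → γ ⊵ β → ρ ⊵ β
        ⊵-trans ρ⊵γ γ⊵β = Mα.⊢-cut
          (λ { (here refl) → ρ⊵γ ; (there (here refl)) → Mα.⊢-∈ (there (here refl)) }) γ⊵β

        -- With ε the unit of height, α + J ε = J (α + ε) - (J - 1) α, and all terms lie in one
        -- plane.
        shift∈ : ∀ {J} → 0ℤ < J → δ ∷ [] ⊩ shift J
        shift∈ {J} 0<J = M.⊢-mono
          (λ { (here p) → there (there (here p)) ; (there (here p)) → there (here p) })
          (planar 1ℤ J (J - 1ℤ) (Int.+<+ (ℕ.s≤s ℕ.z≤n)) (ℤP.<⇒≤ 0<J) (pos-pred 0<J)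
            ( trans (lemma (dx a) J) (cong (λ z → J * dx a + (J - 1ℤ) * z) (sym (dx-opp a)))
            , trans (lemma (dy a) J) (cong (λ z → J * dy a + (J - 1ℤ) * z) (sym (dy-opp a)))
            , lemma′ k₀ J))
          where
          lemma : ∀ x J → 1ℤ * x ≡ J * x + (J - 1ℤ) * (- x)
          lemma = solve-∀
          lemma′ : ∀ k J → 1ℤ * (k + J) ≡ J * (k + 1ℤ) + (J - 1ℤ) * (- k)
          lemma′ = solve-∀

        -- In the same way, - α + J ε = J (α + ε) - (J + 1) α.
        shift*∈ : ∀ {J} → 0ℤ ≤ J → δ ∷ [] ⊩ (opp a , J - k₀)
        shift*∈ {J} 0≤J = M.⊢-mono
          (λ { (here p) → there (there (here p)) ; (there (here p)) → there (here p) })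
          (planar 1ℤ J (J + 1ℤ) (Int.+<+ (ℕ.s≤s ℕ.z≤n)) 0≤J (0≤-+ 0≤J (Int.+≤+ ℕ.z≤n))
            ( trans (cong (1ℤ *_) (dx-opp a))
                (trans (lemma (dx a) J) (cong (λ z → J * dx a + (J + 1ℤ) * z) (sym (dx-opp a))))
            , trans (cong (1ℤ *_) (dy-opp a))
                (trans (lemma (dy a) J) (cong (λ z → J * dy a + (J + 1ℤ) * z) (sym (dy-opp a))))
            , lemma′ k₀ J))
          where
          lemma : ∀ x J → 1ℤ * (- x) ≡ J * x + (J + 1ℤ) * (- x)
          lemma = solve-∀
          lemma′ : ∀ k J → 1ℤ * (J - k) ≡ J * (k + 1ℤ) + (J + 1ℤ) * (- k)
          lemma′ = solve-∀

        shift∈₀ : ∀ {J} → 0ℤ ≤ J → δ ∷ [] ⊩ shift J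
        shift∈₀ {J} 0≤J with 0≤-split 0≤J
        ... | inj₁ refl = Mα.⊢-mono {M = []} (λ ()) (M.⊢-∈ (here (cong (a ,_) (ℤP.+-identityʳ k₀))))
        ... | inj₂ 0<J  = shift∈ 0<J

        from-planar : ∀ {γ ρ β} → γ ∷ ρ ∷ [] M.⊢ β → δ ∷ [] ⊩ ρ → γ ⊵ β
        from-planar h δ⊩ρ = M.⊢-cut
          (λ { (here refl)         → M.⊢-∈ (there (there (here refl)))
             ; (there (here refl)) → Mα.⊢-mono there δ⊩ρ }) h

        private
          -- The three-term Plücker relation, which is the linear dependence of three directions in
          -- the plane, read in one coordinate.
          plücker : ∀ a₁ a₂ b₁ b₂ c₁ c₂ →
                    (a₁ * c₂ - a₂ * c₁) * b₁ ≡
                    (a₁ * b₂ - a₂ * b₁) * c₁ + (b₁ * c₂ - b₂ * c₁) * a₁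
          plücker = solve-∀

          plücker′ : ∀ a₁ a₂ b₁ b₂ c₁ c₂ →
                     (a₁ * c₂ - a₂ * c₁) * b₂ ≡
                     (a₁ * b₂ - a₂ * b₁) * c₂ + (b₁ * c₂ - b₂ * c₁) * a₂
          plücker′ = solve-∀

          level : ∀ hb hc w k l m t → t ≡ hc * l - hb * m - w * k →
                  hc * l ≡ hb * m + (w * k + t)
          level hb hc w k l m t refl = lemma hb hc w k l m
            where
            lemma : ∀ hb hc w k l m → hc * l ≡ hb * m + (w * k + (hc * l - hb * m - w * k))
            lemma = solve-∀

          neg-neg-* : ∀ w x → w * x ≡ (- w) * (- x)
          neg-neg-* = solve-∀

        -- In directions, the Plücker relation writes `h γ` times β as `h β` times γ plus ω(β, γ)
        -- times α. Comparing heights, the last term is ω(β, γ) times the root `shift J` exactly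
        -- when τ = ω(β, γ) J. This divisibility restricts which pairs can be compared directly.
        step⁺ : ∀ {β γ} J → 0ℤ < h β → 0ℤ < h γ → 0ℤ ≤ ω (proj₁ β) (proj₁ γ) → 0ℤ ≤ J →
                τ α β γ ≡ ω (proj₁ β) (proj₁ γ) * J → γ ⊵ β
        step⁺ {b , l} {c , m} J hβ hγ 0≤w 0≤J τ≡ = from-planar
          (planar (ω a c) (ω a b) (ω b c) hγ (ℤP.<⇒≤ hβ) 0≤w
            ( plücker (dx a) (dy a) (dx b) (dy b) (dx c) (dy c)
            , plücker′ (dx a) (dy a) (dx b) (dy b) (dx c) (dy c)
            , trans (level (ω a b) (ω a c) (ω b c) k₀ l m _ (sym τ≡))
                    (cong (λ z → ω a b * m + z) (sym (ℤP.*-distribˡ-+ (ω b c) k₀ J)))))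
          (shift∈₀ 0≤J)

        -- When ω(β, γ) is not positive, its sign is absorbed by a translate of the opposite of α.
        step⁻ : ∀ {β γ} J → 0ℤ < h β → 0ℤ < h γ → 0ℤ ≤ - ω (proj₁ β) (proj₁ γ) → 0ℤ ≤ J →
                τ α β γ ≡ - ω (proj₁ β) (proj₁ γ) * J → γ ⊵ β
        step⁻ {b , l} {c , m} J hβ hγ 0≤w 0≤J τ≡ = from-planar
          (planar (ω a c) (ω a b) (- ω b c) hγ (ℤP.<⇒≤ hβ) 0≤w
            ( trans (plücker (dx a) (dy a) (dx b) (dy b) (dx c) (dy c))
                (cong (λ z → ω a b * dx c + z) (trans (neg-neg-* (ω b c) (dx a))
                  (cong (λ z → - ω b c * z) (sym (dx-opp a)))))
            , trans (plücker′ (dx a) (dy a) (dx b) (dy b) (dx c) (dy c))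
                (cong (λ z → ω a b * dy c + z) (trans (neg-neg-* (ω b c) (dy a))
                  (cong (λ z → - ω b c * z) (sym (dy-opp a)))))
            , trans (level (ω a b) (ω a c) (ω b c) k₀ l m _ (sym τ≡))
                    (cong (λ z → ω a b * m + z) (lemma (ω b c) k₀ J))))
          (shift*∈ 0≤J)
          where
          lemma : ∀ w k J → w * k + - w * J ≡ - w * (J - k)
          lemma = solve-∀

        -- If the lines meet on the line of α, the triple closes with ± α itself, and no
        -- divisibility is involved.
        tight : ∀ {β γ} → 0ℤ < h β → 0ℤ < h γ → τ α β γ ≡ 0ℤ → γ ⊵ β
        tight {β} {γ} hβ hγ τ≡0 with ℤP.≤-total 0ℤ (ω (proj₁ β) (proj₁ γ))
        ... | inj₁ 0≤w = step⁺ 0ℤ hβ hγ 0≤w ℤP.≤-refl (trans τ≡0 (sym (ℤP.*-zeroʳ (ω (proj₁ β) (proj₁ γ)))))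
        ... | inj₂ w≤0 = step⁻ 0ℤ hβ hγ (0≤-neg w≤0) ℤP.≤-refl (trans τ≡0 (sym (ℤP.*-zeroʳ (- ω (proj₁ β) (proj₁ γ)))))

        unimodular : ∀ {β γ} → 0ℤ < h β → 0ℤ < h γ →
                     ω (proj₁ β) (proj₁ γ) ≡ 1ℤ ⊎ ω (proj₁ β) (proj₁ γ) ≡ - 1ℤ →
                     0ℤ ≤ τ α β γ → γ ⊵ β
        unimodular {β} {γ} hβ hγ (inj₁ w≡1) 0≤τ = step⁺ (τ α β γ) hβ hγ
          (subst (0ℤ ≤_) (sym w≡1) (Int.+≤+ ℕ.z≤n)) 0≤τ
          (sym (trans (cong (_* τ α β γ) w≡1) (ℤP.*-identityˡ (τ α β γ))))
        unimodular {β} {γ} hβ hγ (inj₂ w≡-1) 0≤τ = step⁻ (τ α β γ) hβ hγ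
          (subst (λ w → 0ℤ ≤ - w) (sym w≡-1) (Int.+≤+ ℕ.z≤n)) 0≤τ
          (sym (trans (cong (λ w → - w * τ α β γ) w≡-1) (ℤP.*-identityˡ (τ α β γ))))

        private
          ω-sheared : ∀ a₁ a₂ b₁ b₂ q → a₁ * (b₂ + q * a₂) - a₂ * (b₁ + q * a₁) ≡ a₁ * b₂ - a₂ * b₁
          ω-sheared = solve-∀

          τ-sheared : ∀ a₁ a₂ k b₁ b₂ l c₁ c₂ m q →
            (a₁ * c₂ - a₂ * c₁) * (l + q * k) - (a₁ * (b₂ + q * a₂) - a₂ * (b₁ + q * a₁)) * m
              - ((b₁ + q * a₁) * c₂ - (b₂ + q * a₂) * c₁) * k
            ≡ (a₁ * c₂ - a₂ * c₁) * l - (a₁ * b₂ - a₂ * b₁) * m - (b₁ * c₂ - b₂ * c₁) * k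
          τ-sheared = solve-∀

          τ-same : ∀ h l m b₁ b₂ k → h * l - h * m - (b₁ * b₂ - b₂ * b₁) * k ≡ h * (l - m)
          τ-same = solve-∀

        -- Adding a multiple of α does not change the position on the line of α.
        record _≃_ (β β′ : Element) : Set where
          constructor sheared
          field
            q   : ℤ
            dx≡ : X β′ ≡ X β + q * dx a
            dy≡ : Y β′ ≡ Y β + q * dy a
            Z≡  : Z β′ ≡ Z β + q * k₀

        ≃-h : ∀ {β β′} → β ≃ β′ → h β′ ≡ h β
        ≃-h {b , _} {b′ , _} (sheared q eqx eqy _) = trans
          (cong₂ (λ x y → dx a * y - dy a * x) eqx eqy)
          (ω-sheared (dx a) (dy a) (dx b) (dy b) q)

        ≃-τ₂ : ∀ {β β′} → β ≃ β′ → ∀ γ → τ α β′ γ ≡ τ α β γ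
        ≃-τ₂ {b , l} {b′ , _} (sheared q eqx eqy refl) (c , m) = trans
          (cong₂ (λ x y → (dx a * dy c - dy a * dx c) * (l + q * k₀) - (dx a * y - dy a * x) * m
                          - (x * dy c - y * dx c) * k₀) eqx eqy)
          (τ-sheared (dx a) (dy a) k₀ (dx b) (dy b) l (dx c) (dy c) m q)

        ≃-τ₃ : ∀ {β β′} → β ≃ β′ → ∀ γ → τ α γ β′ ≡ τ α γ β
        ≃-τ₃ {β} {β′} s γ = trans (τ-swap₂₃ α γ β′)
          (trans (cong -_ (≃-τ₂ s γ)) (sym (τ-swap₂₃ α γ β)))

        τ-diagonal : ∀ β → τ α β β ≡ 0ℤ
        τ-diagonal (b , l) = lemma (dx a) (dy a) k₀ (dx b) (dy b) l
          where
          lemma : ∀ a₁ a₂ k b₁ b₂ l →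
            (a₁ * b₂ - a₂ * b₁) * l - (a₁ * b₂ - a₂ * b₁) * l - (b₁ * b₂ - b₂ * b₁) * k ≡ 0ℤ
          lemma = solve-∀

        ≃-⊵ : ∀ {β β′} → 0ℤ < h β → β ≃ β′ → β ⊵ β′
        ≃-⊵ {β} hβ s = tight (0<-cong (≃-h s) hβ) hβ (trans (≃-τ₂ s β) (τ-diagonal β))

        ≃-⊵′ : ∀ {β β′} → 0ℤ < h β → β ≃ β′ → β′ ⊵ β
        ≃-⊵′ {β} hβ s = tight hβ (0<-cong (≃-h s) hβ) (trans (≃-τ₃ s β) (τ-diagonal β))

        -- If `b + a` or `b - a` is a direction, `(b , l)` is sheared to it, and adding a translate
        -- of ∓ α in the closure of δ leads from there to `(b , l + J)`.
        rise : ∀ {b l J} → 0ℤ < ω a b → 0ℤ ≤ J → (b , l) ⊵ (b , l + J)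
        rise {b} {l} {J} hb 0≤J with raise a b hb
        ... | inj₁ (c , eqx , eqy) = ⊵-trans
          (≃-⊵ hb (sheared {β′ = c , l + k₀} 1ℤ
            (trans eqx (cong (λ z → dx b + z) (sym (ℤP.*-identityˡ (dx a)))))
            (trans eqy (cong (λ z → dy b + z) (sym (ℤP.*-identityˡ (dy a)))))
            (cong (λ z → l + z) (sym (ℤP.*-identityˡ k₀)))))
          (from-planar (planar 1ℤ 1ℤ 1ℤ (Int.+<+ (ℕ.s≤s ℕ.z≤n)) (Int.+≤+ ℕ.z≤n) (Int.+≤+ ℕ.z≤n)
            ( trans (lemma (dx b) (dx a)) (sym (cong₂ (λ x y → 1ℤ * x + 1ℤ * y) eqx (dx-opp a)))
            , trans (lemma (dy b) (dy a)) (sym (cong₂ (λ x y → 1ℤ * x + 1ℤ * y) eqy (dy-opp a)))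
            , lemma′ l J k₀))
            (shift*∈ 0≤J))
          where
          lemma : ∀ x y → 1ℤ * x ≡ 1ℤ * (x + y) + 1ℤ * (- y)
          lemma = solve-∀
          lemma′ : ∀ l J k → 1ℤ * (l + J) ≡ 1ℤ * (l + k) + 1ℤ * (J - k)
          lemma′ = solve-∀
        ... | inj₂ (inj₁ (c , eqx , eqy)) = ⊵-trans
          (≃-⊵ hb (sheared {β′ = c , l - k₀} (- 1ℤ)
            (trans eqx (lemma″ (dx b) (dx a))) (trans eqy (lemma″ (dy b) (dy a))) (lemma″ l k₀)))
          (from-planar (planar 1ℤ 1ℤ 1ℤ (Int.+<+ (ℕ.s≤s ℕ.z≤n)) (Int.+≤+ ℕ.z≤n) (Int.+≤+ ℕ.z≤n)
            ( trans (lemma (dx b) (dx a)) (sym (cong (λ x → 1ℤ * x + 1ℤ * dx a) eqx))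
            , trans (lemma (dy b) (dy a)) (sym (cong (λ x → 1ℤ * x + 1ℤ * dy a) eqy))
            , lemma′ l J k₀))
            (shift∈₀ 0≤J))
          where
          lemma : ∀ x y → 1ℤ * x ≡ 1ℤ * (x - y) + 1ℤ * y
          lemma = solve-∀
          lemma′ : ∀ l J k → 1ℤ * (l + J) ≡ 1ℤ * (l - k) + 1ℤ * (k + J)
          lemma′ = solve-∀
          lemma″ : ∀ x y → x - y ≡ x + - 1ℤ * y
          lemma″ = solve-∀
        ... | inj₂ (inj₂ (hb≡2 , c , hc≡1 , w)) with 0≤-split 0≤J
        ...   | inj₁ refl = Mα.⊢-∈ (here (cong (b ,_) (ℤP.+-identityʳ l)))
        -- There is no neighbour and `b` has level two. Measured so that lines of direction `c`
        -- cross at integers, those of direction `b` cross at multiples of one half. The integer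
        -- obtained by rounding up the position of `(b , l)` gives a crossing between those of
        -- `(b , l)` and `(b , l + J)`, because `J` is at least one.
        ...   | inj₂ 0<J = ⊵-trans
          (unimodular 0<hc hb w (proj₁ (bounds (proj₂ half))))
          (unimodular hb 0<hc (unit-flip w) (proj₂ (bounds (proj₂ half))))
          where
          half = halves (l + ω c b * k₀)
          r = proj₁ half

          0<hc : 0ℤ < ω a c
          0<hc = 0<-cong hc≡1 (Int.+<+ (ℕ.s≤s ℕ.z≤n))

          lower : τ α (c , r) (b , l) ≡ (r + r) - (l + ω c b * k₀)
          lower = trans (cong₂ (λ x y → x * r - y * l - ω c b * k₀) hb≡2 hc≡1)
                        (lemma r l (ω c b) k₀)
            where
            lemma : ∀ r l w k → + 2 * r - 1ℤ * l - w * k ≡ (r + r) - (l + w * k)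
            lemma = solve-∀

          upper : τ α (b , l + J) (c , r) ≡ (l + ω c b * k₀) + J - (r + r)
          upper = trans (cong₂ (λ x y → x * (l + J) - y * r - ω b c * k₀) hc≡1 hb≡2)
            (trans (cong (λ w → 1ℤ * (l + J) - + 2 * r - w * k₀) (ω-anti b c))
                   (lemma r l (ω c b) k₀ J))
            where
            lemma : ∀ r l w k J → 1ℤ * (l + J) - + 2 * r - - w * k ≡ (l + w * k) + J - (r + r)
            lemma = solve-∀

          bounds : l + ω c b * k₀ ≡ r + r ⊎ l + ω c b * k₀ ≡ r + r - 1ℤ →
                   0ℤ ≤ τ α (c , r) (b , l) × 0ℤ ≤ τ α (b , l + J) (c , r)
          bounds (inj₁ e) =
            subst (0ℤ ≤_) (sym (trans lower (trans (cong (λ z → r + r - z) e) (ℤP.+-inverseʳ (r + r))))) ℤP.≤-refl ,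
            subst (0ℤ ≤_) (sym (trans upper (trans (cong (λ z → z + J - (r + r)) e) (lemma r J)))) 0≤J
            where
            lemma : ∀ r J → (r + r) + J - (r + r) ≡ J
            lemma = solve-∀
          bounds (inj₂ e) =
            subst (0ℤ ≤_) (sym (trans lower (trans (cong (λ z → r + r - z) e) (lemma r)))) (Int.+≤+ ℕ.z≤n) ,
            subst (0ℤ ≤_) (sym (trans upper (trans (cong (λ z → z + J - (r + r)) e) (lemma′ r J)))) (pos-pred 0<J)
            where
            lemma : ∀ r → r + r - (r + r - 1ℤ) ≡ 1ℤ
            lemma = solve-∀
            lemma′ : ∀ r J → (r + r - 1ℤ) + J - (r + r) ≡ J - 1ℤ
            lemma′ = solve-∀

        -- Shears within a level do not move crossing points. For equal levels γ is sheared into the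
        -- direction of β, and `rise` compares the two parallel lines. For different levels both are
        -- sheared into the unimodular pair given by `steps`.
        chain : ∀ {β γ} → 0ℤ < h β → 0ℤ < h γ → 0ℤ ≤ τ α β γ → γ ⊵ β
        chain {b , l} {c , m} hb hc 0≤τ with steps a b c hb hc
        ... | inj₁ hb≡hc with string a c b hc (sym hb≡hc)
        ...   | q , eqx , eqy = ⊵-trans (≃-⊵ hc s)
          (subst (λ z → (b , m + q * k₀) ⊵ (b , z)) (lemma l (m + q * k₀))
            (rise hb (0≤-cancel hb (subst (0ℤ ≤_) τ≡ 0≤τ))))
          where
          s : (c , m) ≃ (b , m + q * k₀)
          s = sheared q eqx eqy refl
          τ≡ : τ α (b , l) (c , m) ≡ ω a b * (l - (m + q * k₀))
          τ≡ = trans (sym (≃-τ₃ s (b , l)))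
                     (τ-same (ω a b) l (m + q * k₀) (dx b) (dy b) k₀)
          lemma : ∀ l n → n + (l - n) ≡ l
          lemma = solve-∀
        chain {b , l} {c , m} hb hc 0≤τ
          | inj₂ (b′ , c′ , hb≡hb′ , hc′≡hc , w)
          with string a b b′ hb hb≡hb′ | string a c c′ hc (sym hc′≡hc)
        ... | q , eqx , eqy | q′ , eqx′ , eqy′ = ⊵-trans (≃-⊵ hc sc)
          (⊵-trans (unimodular (0<-cong (sym hb≡hb′) hb) (0<-cong hc′≡hc hc) (unit-flip w)
                     (subst (0ℤ ≤_) (sym (trans (≃-τ₂ sb _) (≃-τ₃ sc _))) 0≤τ))
                   (≃-⊵′ hb sb))
          where
          sb : (b , l) ≃ (b′ , l + q * k₀)
          sb = sheared q eqx eqy refl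
          sc : (c , m) ≃ (c′ , m + q′ * k₀)
          sc = sheared q′ eqx′ eqy′ refl

        -- These elements, α + J ε and - α + J ε with positive `J`, are the positive multiples of δ
        -- modulo ± α.
        Boundary : Element → ℤ → Set
        Boundary β J = 0ℤ < J × (β ≡ shift J ⊎ β ≡ (opp a , J - k₀))

        -- The half-open half-plane for `RankTwo`: the forms increasing along the line of α,
        -- together with the ray of δ.
        Upper : Element → Set
        Upper β = 0ℤ < h β ⊎ ∃ (Boundary β)

        h-boundary : ∀ {β J} → Boundary β J → h β ≡ 0ℤ
        h-boundary (_ , inj₁ refl) = lemma (dx a) (dy a)
          where
          lemma : ∀ x y → x * y - y * x ≡ 0ℤ
          lemma = solve-∀
        h-boundary (_ , inj₂ refl) = trans
          (cong₂ (λ x y → dx a * y - dy a * x) (dx-opp a) (dy-opp a)) (lemma (dx a) (dy a))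
          where
          lemma : ∀ x y → x * (- y) - y * (- x) ≡ 0ℤ
          lemma = solve-∀

        τ-boundary : ∀ β {γ J} → Boundary γ J → τ α β γ ≡ - (h β * J)
        τ-boundary (b , l) {J = J} (_ , inj₁ refl) = lemma (dx a) (dy a) k₀ (dx b) (dy b) l J
          where
          lemma : ∀ a₁ a₂ k b₁ b₂ l J →
            (a₁ * a₂ - a₂ * a₁) * l - (a₁ * b₂ - a₂ * b₁) * (k + J) - (b₁ * a₂ - b₂ * a₁) * k
            ≡ - ((a₁ * b₂ - a₂ * b₁) * J)
          lemma = solve-∀
        τ-boundary (b , l) {J = J} (_ , inj₂ refl) = trans
          (cong₂ (λ x y → (dx a * y - dy a * x) * l - ω a b * (J - k₀) - (dx b * y - dy b * x) * k₀)
                 (dx-opp a) (dy-opp a))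
          (lemma (dx a) (dy a) k₀ (dx b) (dy b) l J)
          where
          lemma : ∀ a₁ a₂ k b₁ b₂ l J →
            (a₁ * (- a₂) - a₂ * (- a₁)) * l - (a₁ * b₂ - a₂ * b₁) * (J - k)
              - (b₁ * (- a₂) - b₂ * (- a₁)) * k
            ≡ - ((a₁ * b₂ - a₂ * b₁) * J)
          lemma = solve-∀

        0≤h : ∀ {β} → Upper β → 0ℤ ≤ h β
        0≤h (inj₁ 0<h)     = ℤP.<⇒≤ 0<h
        0≤h (inj₂ (_ , B)) = ℤP.≤-reflexive (sym (h-boundary B))

        -- Elements on the ray of δ lie in the closure of δ modulo ± α, and nothing precedes them:
        -- `τ-boundary` is a nonpositive value there. For two increasing forms this is `chain`.
        initial : ∀ {β γ} → Upper β → Upper γ → 0ℤ < τ α β γ → γ ⊵ β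
        initial (inj₂ (_ , 0<J , inj₁ refl)) _ _ = Mα.⊢-mono there (shift∈ 0<J)
        initial (inj₂ (_ , 0<J , inj₂ refl)) _ _ = Mα.⊢-mono there (shift*∈ (ℤP.<⇒≤ 0<J))
        initial (inj₁ hβ) (inj₁ hγ) β<γ = chain hβ hγ (ℤP.<⇒≤ β<γ)
        initial {β} (inj₁ hβ) (inj₂ (J , B@(0<J , _))) β<γ =
          ⊥-elim (¬0<×0≤- β<γ (ℤP.<⇒≤ (0<-* hβ 0<J))
            (trans (sym (ℤP.neg-involutive (h β * J))) (cong -_ (sym (τ-boundary β B)))))

        -- A Plücker relation gives h(y) τ(x, z) = h(x) τ(y, z) + h(z) τ(x, y) with nonnegative
        -- terms on the right. A `y` on the boundary ray cannot follow any `x`.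
        order : ∀ {x y z} → Upper x → Upper y → Upper z →
                0ℤ < τ α x y → 0ℤ < τ α y z → 0ℤ ≤ τ α x z
        order {x} {y} {z} Ux (inj₁ hy) Uz x<y y<z = 0≤-cancel hy (subst (0ℤ ≤_) (sym eq)
          (0≤-+ (0≤-* (0≤h Ux) (ℤP.<⇒≤ y<z)) (0≤-* (0≤h Uz) (ℤP.<⇒≤ x<y))))
          where
          eq : h y * τ α x z ≡ h x * τ α y z + h z * τ α x y
          eq = lemma (dx a) (dy a) k₀ (X x) (Y x) (Z x) (X y) (Y y) (Z y) (X z) (Y z) (Z z)
            where
            lemma : ∀ a₁ a₂ k x₁ x₂ x₃ y₁ y₂ y₃ z₁ z₂ z₃ →
              (a₁ * y₂ - a₂ * y₁) * ((a₁ * z₂ - a₂ * z₁) * x₃ - (a₁ * x₂ - a₂ * x₁) * z₃ - (x₁ * z₂ - x₂ * z₁) * k) ≡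
              (a₁ * x₂ - a₂ * x₁) * ((a₁ * z₂ - a₂ * z₁) * y₃ - (a₁ * y₂ - a₂ * y₁) * z₃ - (y₁ * z₂ - y₂ * z₁) * k) +
              (a₁ * z₂ - a₂ * z₁) * ((a₁ * y₂ - a₂ * y₁) * x₃ - (a₁ * x₂ - a₂ * x₁) * y₃ - (x₁ * y₂ - x₂ * y₁) * k)
            lemma = solve-∀
        order {x} Ux (inj₂ (J , B@(0<J , _))) _ x<y _ =
          ⊥-elim (¬0<×0≤- x<y (0≤-* (0≤h Ux) (ℤP.<⇒≤ 0<J))
            (trans (sym (ℤP.neg-involutive (h x * J))) (cong -_ (sym (τ-boundary x B)))))

        simple : ∀ {x y} → τ α x y ≢ 0ℤ → ¬ (y ∷ [] ⊩ x)
        simple {x} {y} τ≢0 h = nonplanar {α} {y} {x}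
          (λ τ≡0 → τ≢0 (trans (τ-swap₂₃ α x y) (cong -_ τ≡0)))
          (M.⊢-mono (λ { (here p)                 → here p
                       ; (there (here p))         → there (here p)
                       ; (there (there (here p))) → there (there (here p)) }) h)

        -- The hypothesis on τ rules out ± α, which are loops of the contraction and belong to
        -- neither side.
        upper? : ∀ β → (∃[ γ ] τ α β γ ≢ 0ℤ) → Upper β ⊎ Upper (neg β)
        upper? (b , l) (γ , τ≢0) with ℤP.<-cmp 0ℤ (ω a b)
        ... | tri< 0<h _ _ = inj₁ (inj₁ 0<h)
        ... | tri> _ _ h<0 = inj₂ (inj₁ (0<-neg
          (trans (cong₂ (λ x y → dx a * y - dy a * x) (dx-opp b) (dy-opp b))
                 (lemma (dx a) (dy a) (dx b) (dy b))) h<0))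
          where
          lemma : ∀ a₁ a₂ b₁ b₂ → a₁ * (- b₂) - a₂ * (- b₁) ≡ - (a₁ * b₂ - a₂ * b₁)
          lemma = solve-∀
        ... | tri≈ _ 0≡h _ with parallel a b (sym 0≡h)
        ...   | inj₁ refl with ℤP.<-cmp 0ℤ (l - k₀)
        ...     | tri< 0<J _ _ = inj₁ (inj₂ (l - k₀ , 0<J , inj₁ (cong (a ,_) (lemma k₀ l))))
          where
          lemma : ∀ k l → l ≡ k + (l - k)
          lemma = solve-∀
        ...     | tri> _ _ J<0 = inj₂ (inj₂ (k₀ - l , 0<-neg (lemma′ k₀ l) J<0 ,
                                             inj₂ (cong (opp a ,_) (lemma k₀ l))))
          where
          lemma : ∀ k l → - l ≡ (k - l) - k
          lemma = solve-∀
          lemma′ : ∀ k l → k - l ≡ - (l - k)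
          lemma′ = solve-∀
        ...     | tri≈ _ 0≡J _ = ⊥-elim (τ≢0 (trans
          (cong (λ z → τ α (a , z) γ) (ℤP.i-j≡0⇒i≡j l k₀ (sym 0≡J))) (τ-repeat α γ)))
        upper? (_ , l) (γ , τ≢0) | tri≈ _ _ _ | inj₂ refl with ℤP.<-cmp 0ℤ (l + k₀)
        ... | tri< 0<J _ _ = inj₁ (inj₂ (l + k₀ , 0<J , inj₂ (cong (opp a ,_) (lemma k₀ l))))
          where
          lemma : ∀ k l → l ≡ (l + k) - k
          lemma = solve-∀
        ... | tri> _ _ J<0 = inj₂ (inj₂ (- (l + k₀) , ℤP.neg-mono-< J<0 ,
                                         inj₁ (cong₂ _,_ (opp-opp a) (lemma k₀ l))))
          where
          lemma : ∀ k l → - l ≡ k + - (l + k)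
          lemma = solve-∀
        ... | tri≈ _ 0≡J _ = ⊥-elim (τ≢0 (trans
          (cong (λ z → τ α (opp a , z) γ) (ℤP.i-j≡0⇒i≡j l (- k₀)
            (trans (cong (λ z → l + z) (ℤP.neg-involutive k₀)) (sym 0≡J))))
          (trans (τ-neg₂ α α γ) (cong -_ (τ-repeat α γ)))))

        open RankTwo (contraction 𝓔 α) δ Upper (τ α)
          (τ-swap₂₃ α) (τ-neg₂ α) initial simple order public using (between)

        between-mod : ∀ {b c y} → 0ℤ < τ α b y → 0ℤ < τ α y c → 0ℤ < τ α b c →
                      b ∷ c ∷ [] ⊩ y
        between-mod {b} {c} {y} b<y y<c b<c = between
          (upper? b (y , pos≢0 b<y)) (upper? y (c , pos≢0 y<c))
          (upper? c (b , λ τ≡0 → pos≢0 b<c (trans (τ-swap₂₃ α b c) (cong -_ τ≡0))))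
          b<y y<c b<c

      open Entailment 𝓔
      open Contraction using (between-mod)

      -- Modulo ± a and modulo ± b the claim holds in rank two; of the four ways
      -- of fixing the two signs, only the one with both signs wrong does not give
      -- the claim, and it violates the independence of b, c, y.
      simplicial⁺ : ∀ {a b c y} → 0ℤ < τ a b c → 0ℤ < τ y b c → 0ℤ < τ a y c → 0ℤ < τ a b y →
                    a ∷ b ∷ c ∷ [] ⊢ y
      simplicial⁺ {a} {b} {c} {y} abc ybc ayc aby = combine
        (⊢-line (between-mod a aby ayc abc))
        (⊢-line (between-mod b (0<-cong (sym (τ-cycle y b c)) ybc)
                               (0<-cong (sym (τ-cycle a b y)) aby)
                               (0<-cong (sym (τ-cycle a b c)) abc)))
        where
        independent : ¬ (b ∷ neg b ∷ c ∷ [] ⊢ y)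
        independent h″ = nonplanar {b} {c} {y}
          (λ τ≡0 → pos≢0 ybc (trans (τ-cycle y b c) τ≡0))
          (⊢-mono (λ { (here p) → here p ; (there (here p)) → there (here p)
                     ; (there (there (here p))) → there (there (here p)) }) h″)

        combine : a ∷ b ∷ c ∷ [] ⊢ y ⊎ neg a ∷ b ∷ c ∷ [] ⊢ y →
                  b ∷ c ∷ a ∷ [] ⊢ y ⊎ neg b ∷ c ∷ a ∷ [] ⊢ y → a ∷ b ∷ c ∷ [] ⊢ y
        combine (inj₁ h) _ = h
        combine (inj₂ _) (inj₁ h) = ⊢-mono
          (λ { (here p)                 → there (here p)
             ; (there (here p))         → there (there (here p))
             ; (there (there (here p))) → here p }) h
        -- The first membership exchanges to `neg y ∷ b ∷ c ∷ [] ⊢ a`. Substituted into the second,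
        -- it leaves ± `b`, `c` and `neg y`, the last of which `⊢-opp` removes.
        combine (inj₂ h) (inj₂ h′) = ⊥-elim (independent (⊢-opp (⊢-cut
          (λ { (here p)                 → ⊢-∈ (there (there (here p)))
             ; (there (here p))         → ⊢-∈ (there (there (there (here p))))
             ; (there (there (here refl))) → ⊢-mono
                 (λ { (here p) → here p ; (there (here p)) → there (here p)
                    ; (there (there (here p))) → there (there (there (here p))) }) a∈ }) h′)))
          where
          a∈ : neg y ∷ b ∷ c ∷ [] ⊢ a
          a∈ = ⊢-exch inj₂ h (λ h″ → independent (⊢-mono
            (λ { (here p) → here p ; (there (here p)) → there (there (here p)) }) h″))

  -- Carathéodory's theorem and the comparison of two closures.

  module Comparison (D : Directions) where
    open Directions D
    open Circuits D
    open Int using (_<_; _≤_; _+_; _*_; _-_; -_)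
    open Sign

    weighted : (Element → ℤ) → List (ℤ × Element) → ℤ
    weighted f []             = 0ℤ
    weighted f ((n , q) ∷ ps) = n * f q + weighted f ps

    record Relation (n : ℤ) (p : Element) (ps : List (ℤ × Element)) : Set where
      constructor relation
      field
        X-relation : n * X p ≡ weighted X ps
        Y-relation : n * Y p ≡ weighted Y ps
        Z-relation : n * Z p ≡ weighted Z ps

    -- Signs of coefficients move into the elements, so that a linear relation reads as membership
    -- in a cone. A zero coefficient leaves the element as it is.
    orient : ℤ × Element → Element
    orient (+ _      , q) = q
    orient (-[1+ _ ] , q) = neg q

    orient-pos : ∀ {n} q → 0ℤ ≤ n → orient (n , q) ≡ q
    orient-pos {+ _} q _ = refl

    evaluate : ℤ × ℤ × ℤ → Element → ℤ
    evaluate (f , g , h) p = f * X p + g * Y p + h * Z p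

    oriented : ∀ ps → Pointwise (λ m m′ → m′ ≡ m ⊎ m′ ≡ neg m) (map proj₂ ps) (map orient ps)
    oriented []                   = []
    oriented ((+ _ , _) ∷ ps)     = inj₁ refl ∷ oriented ps
    oriented ((-[1+ _ ] , _) ∷ ps) = inj₂ refl ∷ oriented ps

    -- The positive denominator `n` stays on the left, so rational conical combinations are
    -- expressed over the integers.
    Generated : Entailment Element neg → Set
    Generated 𝓔 = ∀ n p ps → 0ℤ < n → Relation n p ps → Entailment._⊢_ 𝓔 (map orient ps) p

    module _ (a b : Element) where
      -- The cross product of the coordinate vectors. A positive sum of its squares is the integral
      -- form of linear independence.
      n₁ n₂ n₃ : ℤ
      n₁ = Y a * Z b - Z a * Y b
      n₂ = Z a * X b - X a * Z b
      n₃ = X a * Y b - Y a * X b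

      Collinear : Set
      Collinear = n₁ ≡ 0ℤ × n₂ ≡ 0ℤ × n₃ ≡ 0ℤ

      norm² : ℤ
      norm² = n₁ * n₁ + n₂ * n₂ + n₃ * n₃

      collinear? : Collinear ⊎ 0ℤ < norm²
      collinear? = sum-of-squares n₁ n₂ n₃

      dot : ℤ
      dot = X a * X b + Y a * Y b + Z a * Z b

    module _ (a b c : Element) where
      private
        u v : ℤ
        u = n₁ c b * n₁ a b + n₂ c b * n₂ a b + n₃ c b * n₃ a b
        v = n₁ a c * n₁ a b + n₂ a c * n₂ a b + n₃ a c * n₃ a b

      -- With n the cross product of `a` and `b`, projection along n gives |n|² c = u a + v b - τ n,
      -- where `u` and `v` are dot products of cross products with n.
      coplanar-relation : τ a b c ≡ 0ℤ → Relation (norm² a b) c ((u , a) ∷ (v , b) ∷ [])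
      coplanar-relation τ≡0 = relation
        (trans (lemma₁ (X a) (Y a) (Z a) (X b) (Y b) (Z b) (X c) (Y c) (Z c)) (close (n₁ a b) (X a) (X b)))
        (trans (lemma₂ (X a) (Y a) (Z a) (X b) (Y b) (Z b) (X c) (Y c) (Z c)) (close (n₂ a b) (Y a) (Y b)))
        (trans (lemma₃ (X a) (Y a) (Z a) (X b) (Y b) (Z b) (X c) (Y c) (Z c)) (close (n₃ a b) (Z a) (Z b)))
        where
        close : ∀ n x y → u * x + (v * y + 0ℤ) - τ a b c * n ≡ u * x + (v * y + 0ℤ)
        close n x y = trans (cong (λ t → u * x + (v * y + 0ℤ) - t * n) τ≡0) (lemma (u * x + (v * y + 0ℤ)) n)
          where
          lemma : ∀ s n → s - 0ℤ * n ≡ s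
          lemma = solve-∀
        lemma₁ : ∀ x₁ y₁ z₁ x₂ y₂ z₂ x₃ y₃ z₃ →
          ((y₁ * z₂ - z₁ * y₂) * (y₁ * z₂ - z₁ * y₂) + (z₁ * x₂ - x₁ * z₂) * (z₁ * x₂ - x₁ * z₂) + (x₁ * y₂ - y₁ * x₂) * (x₁ * y₂ - y₁ * x₂)) * x₃ ≡
          ((y₃ * z₂ - z₃ * y₂) * (y₁ * z₂ - z₁ * y₂) + (z₃ * x₂ - x₃ * z₂) * (z₁ * x₂ - x₁ * z₂) + (x₃ * y₂ - y₃ * x₂) * (x₁ * y₂ - y₁ * x₂)) * x₁ +
          (((y₁ * z₃ - z₁ * y₃) * (y₁ * z₂ - z₁ * y₂) + (z₁ * x₃ - x₁ * z₃) * (z₁ * x₂ - x₁ * z₂) + (x₁ * y₃ - y₁ * x₃) * (x₁ * y₂ - y₁ * x₂)) * x₂ + 0ℤ) -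
          ((x₁ * y₃ - y₁ * x₃) * z₂ - (x₁ * y₂ - y₁ * x₂) * z₃ - (x₂ * y₃ - y₂ * x₃) * z₁) * (y₁ * z₂ - z₁ * y₂)
        lemma₁ = solve-∀
        lemma₂ : ∀ x₁ y₁ z₁ x₂ y₂ z₂ x₃ y₃ z₃ →
          ((y₁ * z₂ - z₁ * y₂) * (y₁ * z₂ - z₁ * y₂) + (z₁ * x₂ - x₁ * z₂) * (z₁ * x₂ - x₁ * z₂) + (x₁ * y₂ - y₁ * x₂) * (x₁ * y₂ - y₁ * x₂)) * y₃ ≡
          ((y₃ * z₂ - z₃ * y₂) * (y₁ * z₂ - z₁ * y₂) + (z₃ * x₂ - x₃ * z₂) * (z₁ * x₂ - x₁ * z₂) + (x₃ * y₂ - y₃ * x₂) * (x₁ * y₂ - y₁ * x₂)) * y₁ +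
          (((y₁ * z₃ - z₁ * y₃) * (y₁ * z₂ - z₁ * y₂) + (z₁ * x₃ - x₁ * z₃) * (z₁ * x₂ - x₁ * z₂) + (x₁ * y₃ - y₁ * x₃) * (x₁ * y₂ - y₁ * x₂)) * y₂ + 0ℤ) -
          ((x₁ * y₃ - y₁ * x₃) * z₂ - (x₁ * y₂ - y₁ * x₂) * z₃ - (x₂ * y₃ - y₂ * x₃) * z₁) * (z₁ * x₂ - x₁ * z₂)
        lemma₂ = solve-∀
        lemma₃ : ∀ x₁ y₁ z₁ x₂ y₂ z₂ x₃ y₃ z₃ →
          ((y₁ * z₂ - z₁ * y₂) * (y₁ * z₂ - z₁ * y₂) + (z₁ * x₂ - x₁ * z₂) * (z₁ * x₂ - x₁ * z₂) + (x₁ * y₂ - y₁ * x₂) * (x₁ * y₂ - y₁ * x₂)) * z₃ ≡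
          ((y₃ * z₂ - z₃ * y₂) * (y₁ * z₂ - z₁ * y₂) + (z₃ * x₂ - x₃ * z₂) * (z₁ * x₂ - x₁ * z₂) + (x₃ * y₂ - y₃ * x₂) * (x₁ * y₂ - y₁ * x₂)) * z₁ +
          (((y₁ * z₃ - z₁ * y₃) * (y₁ * z₂ - z₁ * y₂) + (z₁ * x₃ - x₁ * z₃) * (z₁ * x₂ - x₁ * z₂) + (x₁ * y₃ - y₁ * x₃) * (x₁ * y₂ - y₁ * x₂)) * z₂ + 0ℤ) -
          ((x₁ * y₃ - y₁ * x₃) * z₂ - (x₁ * y₂ - y₁ * x₂) * z₃ - (x₂ * y₃ - y₂ * x₃) * z₁) * (x₁ * y₂ - y₁ * x₂)
        lemma₃ = solve-∀

    -- The triple product a × (a × b) = (a · b) a - (a · a) b vanishes together with a × b.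
    collinear-relation : ∀ a b → Collinear a b → Relation (dot a a) b ((dot a b , a) ∷ [])
    collinear-relation a b (e₁ , e₂ , e₃) = relation
      (trans (lemma (X a) (Y a) (Z a) (X b) (Y b) (Z b)) (close (Y a) (Z a) e₃ e₂ (dot a b * X a)))
      (trans (lemma′ (X a) (Y a) (Z a) (X b) (Y b) (Z b)) (close (Z a) (X a) e₁ e₃ (dot a b * Y a)))
      (trans (lemma″ (X a) (Y a) (Z a) (X b) (Y b) (Z b)) (close (X a) (Y a) e₂ e₁ (dot a b * Z a)))
      where
      close : ∀ y z {m n} → m ≡ 0ℤ → n ≡ 0ℤ → ∀ s → s - y * m + z * n ≡ s + 0ℤ
      close y z refl refl s = solved s y z
        where
        solved : ∀ s y z → s - y * 0ℤ + z * 0ℤ ≡ s + 0ℤ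
        solved = solve-∀
      lemma : ∀ x₁ y₁ z₁ x₂ y₂ z₂ → (x₁ * x₁ + y₁ * y₁ + z₁ * z₁) * x₂ ≡
        (x₁ * x₂ + y₁ * y₂ + z₁ * z₂) * x₁ - y₁ * (x₁ * y₂ - y₁ * x₂) + z₁ * (z₁ * x₂ - x₁ * z₂)
      lemma = solve-∀
      lemma′ : ∀ x₁ y₁ z₁ x₂ y₂ z₂ → (x₁ * x₁ + y₁ * y₁ + z₁ * z₁) * y₂ ≡
        (x₁ * x₂ + y₁ * y₂ + z₁ * z₂) * y₁ - z₁ * (y₁ * z₂ - z₁ * y₂) + x₁ * (x₁ * y₂ - y₁ * x₂)
      lemma′ = solve-∀
      lemma″ : ∀ x₁ y₁ z₁ x₂ y₂ z₂ → (x₁ * x₁ + y₁ * y₁ + z₁ * z₁) * z₂ ≡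
        (x₁ * x₂ + y₁ * y₂ + z₁ * z₂) * z₁ - x₁ * (z₁ * x₂ - x₁ * z₂) + y₁ * (y₁ * z₂ - z₁ * y₂)
      lemma″ = solve-∀

    -- Cramer's rule multiplied once more by τ, so that the coefficient on the left is a square and
    -- positive for either orientation of `a`, `b`, `c`.
    cramer-relation : ∀ a b c y → Relation (τ a b c * τ a b c) y
      ((τ a b c * τ y b c , a) ∷ (τ a b c * τ a y c , b) ∷ (τ a b c * τ a b y , c) ∷ [])
    cramer-relation a b c y = relation
      (scale X (inj₁ refl)) (scale Y (inj₂ (inj₁ refl))) (scale Z (inj₂ (inj₂ refl)))
      where
      t = τ a b c

      lemma : ∀ t t₁ t₂ t₃ x₁ x₂ x₃ → t * (t₁ * x₁ + t₂ * x₂ + t₃ * x₃) ≡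
              t * t₁ * x₁ + (t * t₂ * x₂ + (t * t₃ * x₃ + 0ℤ))
      lemma = solve-∀

      scale : ∀ f → f ≡ X ⊎ f ≡ Y ⊎ f ≡ Z →
              t * t * f y ≡ t * τ y b c * f a + (t * τ a y c * f b + (t * τ a b y * f c + 0ℤ))
      scale f isf = trans (ℤP.*-assoc t t (f y)) (trans (cong (λ z → t * z) (cramer f isf a b c y))
        (lemma t (τ y b c) (τ a y c) (τ a b y) (f a) (f b) (f c)))

    data Small : List Element → Set where
      none  : Small []
      one   : ∀ a → Small (a ∷ [])
      two   : ∀ a b → Small (a ∷ b ∷ [])
      three : ∀ {a b c} → τ a b c ≢ 0ℤ → Small (a ∷ b ∷ c ∷ [])

    module Carathéodory (nonzero : ∀ a → 0ℤ < dot a a)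
                        (𝓔 : Entailment Element neg) (generated : Generated 𝓔) where
      open Entailment 𝓔

      Shorter : List Element → Element → Set
      Shorter L x = ∃[ L′ ] (length L′ ℕ.< length L × (∀ {q} → q ∈ L′ → q ∈ L) × L′ ⊢ x)

      private
        -- The relation puts `a` into the closure of the signed members of `ps`, and this is the
        -- dependence that `drop` consumes.
        shorter : ∀ Q a ps {x n} → 0ℤ < n → Relation n a ps →
                  Q ++ a ∷ map proj₂ ps ⊢ x → Shorter (Q ++ a ∷ map proj₂ ps) x
        shorter Q a ps {x} {n} 0<n rel h = conclude (drop Q (oriented ps)
          (⊢-mono (∈-++⁺ʳ Q) (generated n a ps 0<n rel)) h)
          where
          M = map proj₂ ps
          conclude : ∃[ L ] (length L ≡ length M × (∀ {q} → q ∈ L → q ∈ a ∷ M) × Q ++ L ⊢ x) →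
                     Shorter (Q ++ a ∷ M) x
          conclude (L , len , L⊆ , h′) = Q ++ L , len< ,
            (λ q → [ ∈-++⁺ˡ , ∈-++⁺ʳ Q ∘ L⊆ ]′ (∈-++⁻ Q q)) , h′
            where
            len< : length (Q ++ L) ℕ.< length (Q ++ a ∷ M)
            len< rewrite ListP.length-++ Q {L} | ListP.length-++ Q {a ∷ M} | len =
              ℕP.+-monoʳ-< (length Q) ℕP.≤-refl

        permute : ∀ {L M x} → length L ≡ length M → (∀ {q} → q ∈ L → q ∈ M) →
                  Shorter L x → Shorter M x
        permute len L⊆M (L′ , len< , L′⊆ , h) = L′ , ℕP.<-≤-trans len< (ℕP.≤-reflexive len) , L⊆M ∘ L′⊆ , h

        -- If `a` and `b` are independent, `c` depends on them; otherwise `b` is a multiple of `a`,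
        -- which is not zero. The list is permuted so that the dependent element and those it
        -- depends on come last.
        coplanar : ∀ a b c Q {x} → τ a b c ≡ 0ℤ → a ∷ b ∷ c ∷ Q ⊢ x → Shorter (a ∷ b ∷ c ∷ Q) x
        coplanar a b c Q {x} τ≡0 h with collinear? a b
        ... | inj₂ 0<n = permute (length≡ Q) back
          (shorter Q c (_ ∷ _ ∷ []) 0<n (coplanar-relation a b c τ≡0) (⊢-mono forth h))
          where
          forth : ∀ {q} → q ∈ a ∷ b ∷ c ∷ Q → q ∈ Q ++ c ∷ a ∷ b ∷ []
          forth (here p)                   = ∈-++⁺ʳ Q (there (here p))
          forth (there (here p))           = ∈-++⁺ʳ Q (there (there (here p)))
          forth (there (there (here p)))   = ∈-++⁺ʳ Q (here p)
          forth (there (there (there p)))  = ∈-++⁺ˡ p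
          back : ∀ {q} → q ∈ Q ++ c ∷ a ∷ b ∷ [] → q ∈ a ∷ b ∷ c ∷ Q
          back q with ∈-++⁻ Q q
          ... | inj₁ p                         = there (there (there p))
          ... | inj₂ (here p)                  = there (there (here p))
          ... | inj₂ (there (here p))          = here p
          ... | inj₂ (there (there (here p)))  = there (here p)
          length≡ : ∀ Q → length (Q ++ c ∷ a ∷ b ∷ []) ≡ length (a ∷ b ∷ c ∷ Q)
          length≡ Q = trans (ListP.length-++ Q) (ℕP.+-comm (length Q) 3)
        ... | inj₁ col = permute length≡ back
          (shorter (c ∷ Q) b (_ ∷ []) (nonzero a) (collinear-relation a b col) (⊢-mono forth h))
          where
          forth : ∀ {q} → q ∈ a ∷ b ∷ c ∷ Q → q ∈ (c ∷ Q) ++ b ∷ a ∷ []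
          forth (here p)                   = ∈-++⁺ʳ (c ∷ Q) (there (here p))
          forth (there (here p))           = ∈-++⁺ʳ (c ∷ Q) (here p)
          forth (there (there (here p)))   = here p
          forth (there (there (there p)))  = ∈-++⁺ˡ (there p)
          back : ∀ {q} → q ∈ (c ∷ Q) ++ b ∷ a ∷ [] → q ∈ a ∷ b ∷ c ∷ Q
          back q with ∈-++⁻ (c ∷ Q) q
          ... | inj₁ (here p)          = there (there (here p))
          ... | inj₁ (there p)         = there (there (there p))
          ... | inj₂ (here p)          = there (here p)
          ... | inj₂ (there (here p))  = here p
          length≡ : length ((c ∷ Q) ++ b ∷ a ∷ []) ≡ length (a ∷ b ∷ c ∷ Q)
          length≡ = trans (ListP.length-++ (c ∷ Q)) (ℕP.+-comm (length (c ∷ Q)) 2)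

        spatial : ∀ a b c e Q {x} → τ a b c ≢ 0ℤ → a ∷ b ∷ c ∷ e ∷ Q ⊢ x → Shorter (a ∷ b ∷ c ∷ e ∷ Q) x
        spatial a b c e Q {x} τ≢0 h = permute length≡ back
          (shorter Q e (_ ∷ _ ∷ _ ∷ []) (square-pos τ≢0) (cramer-relation a b c e) (⊢-mono forth h))
          where
          forth : ∀ {q} → q ∈ a ∷ b ∷ c ∷ e ∷ Q → q ∈ Q ++ e ∷ a ∷ b ∷ c ∷ []
          forth (here p)                           = ∈-++⁺ʳ Q (there (here p))
          forth (there (here p))                   = ∈-++⁺ʳ Q (there (there (here p)))
          forth (there (there (here p)))           = ∈-++⁺ʳ Q (there (there (there (here p))))
          forth (there (there (there (here p))))   = ∈-++⁺ʳ Q (here p)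
          forth (there (there (there (there p))))  = ∈-++⁺ˡ p
          back : ∀ {q} → q ∈ Q ++ e ∷ a ∷ b ∷ c ∷ [] → q ∈ a ∷ b ∷ c ∷ e ∷ Q
          back q with ∈-++⁻ Q q
          ... | inj₁ p                                 = there (there (there (there p)))
          ... | inj₂ (here p)                          = there (there (there (here p)))
          ... | inj₂ (there (here p))                  = here p
          ... | inj₂ (there (there (here p)))          = there (here p)
          ... | inj₂ (there (there (there (here p))))  = there (there (here p))
          length≡ : length (Q ++ e ∷ a ∷ b ∷ c ∷ []) ≡ length (a ∷ b ∷ c ∷ e ∷ Q)
          length≡ = trans (ListP.length-++ Q) (ℕP.+-comm (length Q) 4)

        small? : ∀ L {x} → L ⊢ x → Small L ⊎ Shorter L x
        small? []          h = inj₁ none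
        small? (a ∷ [])    h = inj₁ (one a)
        small? (a ∷ b ∷ []) h = inj₁ (two a b)
        small? (a ∷ b ∷ c ∷ Q) h with τ a b c ℤP.≟ 0ℤ
        small? (a ∷ b ∷ c ∷ Q)      h | yes τ≡0 = inj₂ (coplanar a b c Q τ≡0 h)
        small? (a ∷ b ∷ c ∷ [])     h | no τ≢0  = inj₁ (three τ≢0)
        small? (a ∷ b ∷ c ∷ e ∷ Q)  h | no τ≢0  = inj₂ (spatial a b c e Q τ≢0 h)

      carathéodory : ∀ L {x} → L ⊢ x → ∃[ L′ ] (Small L′ × (∀ {q} → q ∈ L′ → q ∈ L) × L′ ⊢ x)
      carathéodory L = go (length L) L ℕP.≤-refl
        where
        go : ∀ n L {x} → length L ℕ.≤ n → L ⊢ x →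
             ∃[ L′ ] (Small L′ × (∀ {q} → q ∈ L′ → q ∈ L) × L′ ⊢ x)
        go n L len h with small? L h
        ... | inj₁ small = L , small , id , h
        go ℕ.zero    L len h | inj₂ (L′ , len< , _) = ⊥-elim (ℕP.n≮0 (ℕP.<-≤-trans len< len))
        go (ℕ.suc n) L len h | inj₂ (L′ , len< , L′⊆ , h′)
          with go n L′ (ℕP.≤-pred (ℕP.<-≤-trans len< len)) h′
        ... | L″ , small , L″⊆ , h″ = L″ , small , L′⊆ ∘ L″⊆ , h″

    module Agreement
      (nonzero : ∀ a → 0ℤ < dot a a)
      (𝓒 𝓓 : Entailment Element neg)
      (generated : Generated 𝓒)
      -- The easy half of Farkas' lemma: a functional nonnegative on the generators is nonnegative
      -- on their cone.
      (dual   : ∀ f L p → (∀ {q} → q ∈ L → 0ℤ ≤ evaluate f q) →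
                Entailment._⊢_ 𝓒 L p → 0ℤ ≤ evaluate f p)
      -- A list inside a plane or a line is presented by two of its own members that span it.
      (planar : ∀ {q r L} → q ∈ L → r ∈ L →
                (∀ {m} → m ∈ L → ∃[ n ] (0ℤ < n × ∃₂ λ k l → Combination n m k q l r)) → ∀ p →
                (Entailment._⊢_ 𝓒 L p → Entailment._⊢_ 𝓓 L p) ×
                (Entailment._⊢_ 𝓓 L p → Entailment._⊢_ 𝓒 L p))
      (empty𝓒 : ∀ p → ¬ Entailment._⊢_ 𝓒 [] p)
      (empty𝓓 : ∀ p → ¬ Entailment._⊢_ 𝓓 [] p)
      where

      private
        module 𝓒 = Entailment 𝓒
        module 𝓓 = Entailment 𝓓

        trivialˡ : ∀ q r → Combination 1ℤ q 1ℤ q 0ℤ r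
        trivialˡ q r = lemma (X q) (X r) , lemma (Y q) (Y r) , lemma (Z q) (Z r)
          where
          lemma : ∀ x y → 1ℤ * x ≡ 1ℤ * x + 0ℤ * y
          lemma = solve-∀

        trivialʳ : ∀ q r → Combination 1ℤ r 0ℤ q 1ℤ r
        trivialʳ q r = lemma (X q) (X r) , lemma (Y q) (Y r) , lemma (Z q) (Z r)
          where
          lemma : ∀ x y → 1ℤ * y ≡ 0ℤ * x + 1ℤ * y
          lemma = solve-∀

        trivialˡ-neg : ∀ q r → Combination 1ℤ (neg q) (- 1ℤ) q 0ℤ r
        trivialˡ-neg q r = at (X r) (dx-opp (proj₁ q)) , at (Y r) (dy-opp (proj₁ q)) , at (Z r) refl
          where
          lemma : ∀ x y → 1ℤ * (- x) ≡ - 1ℤ * x + 0ℤ * y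
          lemma = solve-∀
          at : ∀ y {x′ x} → x′ ≡ - x → 1ℤ * x′ ≡ - 1ℤ * x + 0ℤ * y
          at y {x = x} refl = lemma x y

        trivialʳ-neg : ∀ q r → Combination 1ℤ (neg r) 0ℤ q (- 1ℤ) r
        trivialʳ-neg q r = at (X q) (dx-opp (proj₁ r)) , at (Y q) (dy-opp (proj₁ r)) , at (Z q) refl
          where
          lemma : ∀ x y → 1ℤ * (- y) ≡ 0ℤ * x + - 1ℤ * y
          lemma = solve-∀
          at : ∀ x {y′ y} → y′ ≡ - y → 1ℤ * y′ ≡ 0ℤ * x + - 1ℤ * y
          at x {y = y} refl = lemma x y

        0<1 : 0ℤ < 1ℤ
        0<1 = Int.+<+ (ℕ.s≤s ℕ.z≤n)

        pair : ∀ q r p → (q ∷ r ∷ [] 𝓒.⊢ p → q ∷ r ∷ [] 𝓓.⊢ p) × (q ∷ r ∷ [] 𝓓.⊢ p → q ∷ r ∷ [] 𝓒.⊢ p)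
        pair q r = planar (here refl) (there (here refl))
          (λ { (here refl)         → 1ℤ , 0<1 , 1ℤ , 0ℤ , trivialˡ q r
             ; (there (here refl)) → 1ℤ , 0<1 , 0ℤ , 1ℤ , trivialʳ q r })

        -- The functional vanishing on `a` and `b`: their cross product, with the sign that makes
        -- its value equal to τ.
        covector : Element → Element → ℤ × ℤ × ℤ
        covector a b = Y b * Z a - Y a * Z b , X a * Z b - X b * Z a , Y a * X b - X a * Y b

        covector-τ : ∀ a b c → evaluate (covector a b) c ≡ τ a b c
        covector-τ a b c = lemma (X a) (Y a) (Z a) (X b) (Y b) (Z b) (X c) (Y c) (Z c)
          where
          lemma : ∀ x₁ y₁ z₁ x₂ y₂ z₂ x₃ y₃ z₃ →
            (y₂ * z₁ - y₁ * z₂) * x₃ + (x₁ * z₂ - x₂ * z₁) * y₃ + (y₁ * x₂ - x₁ * y₂) * z₃ ≡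
            (x₁ * y₃ - y₁ * x₃) * z₂ - (x₁ * y₂ - y₁ * x₂) * z₃ - (x₂ * y₃ - y₂ * x₃) * z₁
          lemma = solve-∀

        τ-dual : ∀ a b L p → (∀ {q} → q ∈ L → 0ℤ ≤ τ a b q) → L 𝓒.⊢ p → 0ℤ ≤ τ a b p
        τ-dual a b L p h L⊢p = subst (0ℤ ≤_) (covector-τ a b p)
          (dual (covector a b) L p (λ {q} q∈L → subst (0ℤ ≤_) (sym (covector-τ a b q)) (h q∈L)) L⊢p)

        ≡0⇒0≤ : ∀ {x} → x ≡ 0ℤ → 0ℤ ≤ x
        ≡0⇒0≤ e = ℤP.≤-reflexive (sym e)

        τ-first : ∀ a b → τ a b a ≡ 0ℤ
        τ-first a b = trans (τ-swap₂₃ a b a) (cong -_ (τ-repeat a b))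

        τ-second : ∀ a b → τ a b b ≡ 0ℤ
        τ-second a b = trans (τ-cycle a b b) (trans (τ-swap₂₃ b b a) (cong -_ (τ-first b a)))

        τ-neg₃ : ∀ a b c → τ a b (neg c) ≡ - τ a b c
        τ-neg₃ a b c = trans (τ-swap₂₃ a b (neg c)) (trans (cong -_ (τ-neg₂ a c b))
          (cong -_ (sym (τ-swap₂₃ a b c))))

        -- The functionals τ q r and τ r q are opposite and both vanish on the four generators, so
        -- duality bounds τ q r t from both sides.
        plane-τ : ∀ q r t → q ∷ neg q ∷ r ∷ neg r ∷ [] 𝓒.⊢ t → τ q r t ≡ 0ℤ
        plane-τ q r t h = ℤP.≤-antisym
          (subst (_≤ 0ℤ) (trans (cong -_ (trans (τ-cycle r q t) (trans (τ-swap₂₃ q t r) refl)))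
                                (ℤP.neg-involutive (τ q r t)))
            (ℤP.neg-mono-≤ (τ-dual r q _ t
              (λ { (here refl)                         → ≡0⇒0≤ (τ-second r q)
                 ; (there (here refl))                 → ≡0⇒0≤ (trans (τ-neg₃ r q q) (cong -_ (τ-second r q)))
                 ; (there (there (here refl)))         → ≡0⇒0≤ (τ-first r q)
                 ; (there (there (there (here refl)))) → ≡0⇒0≤ (trans (τ-neg₃ r q r) (cong -_ (τ-first r q))) }) h)))
          (τ-dual q r _ t
            (λ { (here refl)                         → ≡0⇒0≤ (τ-first q r)
               ; (there (here refl))                 → ≡0⇒0≤ (trans (τ-neg₃ q r q) (cong -_ (τ-first q r)))
               ; (there (there (here refl)))         → ≡0⇒0≤ (τ-second q r)
               ; (there (there (there (here refl)))) → ≡0⇒0≤ (trans (τ-neg₃ q r r) (cong -_ (τ-second q r))) }) h)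

        -- The generators lie in the span of `q` and `r`, so planarity moves the question to the
        -- conical closure, where functionals decide it.
        nonplanar : ∀ {q r t} → τ q r t ≢ 0ℤ → ¬ (q ∷ neg q ∷ r ∷ neg r ∷ [] 𝓓.⊢ t)
        nonplanar {q} {r} {t} τ≢0 h = τ≢0 (plane-τ q r t (proj₂ (planar {q} {r}
          (here refl) (there (there (here refl)))
          (λ { (here refl)                         → 1ℤ , 0<1 , 1ℤ , 0ℤ , trivialˡ q r
             ; (there (here refl))                 → 1ℤ , 0<1 , - 1ℤ , 0ℤ , trivialˡ-neg q r
             ; (there (there (here refl)))         → 1ℤ , 0<1 , 0ℤ , 1ℤ , trivialʳ q r
             ; (there (there (there (here refl)))) → 1ℤ , 0<1 , 0ℤ , - 1ℤ , trivialʳ-neg q r }) t) h))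

        planar-combination : ∀ {p q r} l m n → 0ℤ < l → 0ℤ ≤ m → 0ℤ ≤ n →
                             Combination l p m q n r → q ∷ r ∷ [] 𝓓.⊢ p
        planar-combination {p} {q} {r} l m n 0<l 0≤m 0≤n (ex , ey , ez) = proj₁ (pair q r p)
          (subst (𝓒._⊢ p) (cong₂ (λ a b → a ∷ b ∷ []) (orient-pos q 0≤m) (orient-pos r 0≤n))
            (generated l p ((m , q) ∷ (n , r) ∷ []) 0<l (relation (pad (m * X q) (n * X r) ex) (pad (m * Y q) (n * Y r) ey) (pad (m * Z q) (n * Z r) ez))))
          where
          pad : ∀ {s} x y → s ≡ x + y → s ≡ x + (y + 0ℤ)
          pad x y e = trans e (cong (λ z → x + z) (sym (ℤP.+-identityʳ y)))

      open PlanarEntailment 𝓓 planar-combination nonplanar using (simplicial⁺)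

      private
        swap₂₃ : ∀ {a b c : Element} {q} → q ∈ a ∷ b ∷ c ∷ [] → q ∈ a ∷ c ∷ b ∷ []
        swap₂₃ (here p)                 = here p
        swap₂₃ (there (here p))         = there (there (here p))
        swap₂₃ (there (there (here p))) = there (here p)

        -- Duality makes the three Cramer coefficients of `p` nonnegative. If one of them vanishes,
        -- `p` lies over two generators and planarity applies; the interior case is `simplicial⁺`.
        simplex : ∀ {a b c} p → 0ℤ < τ a b c → a ∷ b ∷ c ∷ [] 𝓒.⊢ p → a ∷ b ∷ c ∷ [] 𝓓.⊢ p
        simplex {a} {b} {c} p 0<τ h = cases (0≤-split 0≤₁) (0≤-split 0≤₂) (0≤-split 0≤₃)
          where
          L = a ∷ b ∷ c ∷ []
          t = τ a b c

          0≤₁ : 0ℤ ≤ τ p b c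
          0≤₁ = subst (0ℤ ≤_) (sym (τ-cycle p b c)) (τ-dual b c L p
            (λ { (here refl)                 → subst (0ℤ ≤_) (τ-cycle a b c) (ℤP.<⇒≤ 0<τ)
               ; (there (here refl))         → ≡0⇒0≤ (τ-first b c)
               ; (there (there (here refl))) → ≡0⇒0≤ (τ-second b c) }) h)
          0≤₂ : 0ℤ ≤ τ a p c
          0≤₂ = subst (0ℤ ≤_) (τ-cycle c a p) (τ-dual c a L p
            (λ { (here refl)                 → ≡0⇒0≤ (τ-second c a)
               ; (there (here refl))         → subst (0ℤ ≤_) (sym (τ-cycle c a b)) (ℤP.<⇒≤ 0<τ)
               ; (there (there (here refl))) → ≡0⇒0≤ (τ-first c a) }) h)
          0≤₃ : 0ℤ ≤ τ a b p
          0≤₃ = τ-dual a b L p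
            (λ { (here refl)                 → ≡0⇒0≤ (τ-first a b)
               ; (there (here refl))         → ≡0⇒0≤ (τ-second a b)
               ; (there (there (here refl))) → ℤP.<⇒≤ 0<τ }) h

          Cramer : (Element → ℤ) → Set
          Cramer f = t * f p ≡ τ p b c * f a + τ a p c * f b + τ a b p * f c

          drop₁ : ∀ f → τ p b c ≡ 0ℤ → Cramer f → t * f p ≡ τ a p c * f b + τ a b p * f c
          drop₁ f e eq = trans eq (trans (cong (λ z → z * f a + τ a p c * f b + τ a b p * f c) e)
            (lemma (f a) (τ a p c * f b) (τ a b p * f c)))
            where
            lemma : ∀ u v w → 0ℤ * u + v + w ≡ v + w
            lemma = solve-∀
          drop₂ : ∀ f → τ a p c ≡ 0ℤ → Cramer f → t * f p ≡ τ p b c * f a + τ a b p * f c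
          drop₂ f e eq = trans eq (trans (cong (λ z → τ p b c * f a + z * f b + τ a b p * f c) e)
            (lemma (τ p b c * f a) (f b) (τ a b p * f c)))
            where
            lemma : ∀ u v w → u + 0ℤ * v + w ≡ u + w
            lemma = solve-∀
          drop₃ : ∀ f → τ a b p ≡ 0ℤ → Cramer f → t * f p ≡ τ p b c * f a + τ a p c * f b
          drop₃ f e eq = trans eq (trans (cong (λ z → τ p b c * f a + τ a p c * f b + z * f c) e)
            (lemma (τ p b c * f a) (τ a p c * f b) (f c)))
            where
            lemma : ∀ u v w → u + v + 0ℤ * w ≡ u + v
            lemma = solve-∀

          cX = cramer X (inj₁ refl) a b c p
          cY = cramer Y (inj₂ (inj₁ refl)) a b c p
          cZ = cramer Z (inj₂ (inj₂ refl)) a b c p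

          cases : τ p b c ≡ 0ℤ ⊎ 0ℤ < τ p b c → τ a p c ≡ 0ℤ ⊎ 0ℤ < τ a p c →
                  τ a b p ≡ 0ℤ ⊎ 0ℤ < τ a b p → L 𝓓.⊢ p
          cases (inj₁ e) _ _ = 𝓓.⊢-mono there
            (planar-combination t _ _ 0<τ 0≤₂ 0≤₃
              ( drop₁ X e cX , drop₁ Y e cY , drop₁ Z e cZ))
          cases _ (inj₁ e) _ = 𝓓.⊢-mono (λ { (here q) → here q ; (there (here q)) → there (there (here q)) })
            (planar-combination t _ _ 0<τ 0≤₁ 0≤₃
              ( drop₂ X e cX , drop₂ Y e cY , drop₂ Z e cZ))
          cases _ _ (inj₁ e) = 𝓓.⊢-mono (λ { (here q) → here q ; (there (here q)) → there (here q) })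
            (planar-combination t _ _ 0<τ 0≤₁ 0≤₂
              ( drop₃ X e cX , drop₃ Y e cY , drop₃ Z e cZ))
          cases (inj₂ 0<₁) (inj₂ 0<₂) (inj₂ 0<₃) = simplicial⁺ 0<τ 0<₁ 0<₂ 0<₃

        flip-sign : ∀ {a b c} → τ a b c < 0ℤ → 0ℤ < τ a c b
        flip-sign {a} {b} {c} τ<0 = 0<-neg (τ-swap₂₃ a c b) τ<0

        simplex′ : ∀ {a b c} p → τ a b c ≢ 0ℤ → a ∷ b ∷ c ∷ [] 𝓒.⊢ p → a ∷ b ∷ c ∷ [] 𝓓.⊢ p
        simplex′ {a} {b} {c} p τ≢0 h with ℤP.<-cmp 0ℤ (τ a b c)
        ... | tri< 0<τ _ _ = simplex p 0<τ h
        ... | tri≈ _ 0≡τ _ = ⊥-elim (τ≢0 (sym 0≡τ))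
        ... | tri> _ _ τ<0 = 𝓓.⊢-mono swap₂₃ (simplex p (flip-sign τ<0) (𝓒.⊢-mono swap₂₃ h))

      𝓒⊆𝓓 : ∀ L p → L 𝓒.⊢ p → L 𝓓.⊢ p
      𝓒⊆𝓓 L p h = conclude (carathéodory L h)
        where
        open Carathéodory nonzero 𝓒 generated using (carathéodory)
        small : ∀ {L′} → Small L′ → L′ 𝓒.⊢ p → L′ 𝓓.⊢ p
        small none        h = ⊥-elim (empty𝓒 p h)
        small (one a)     h = proj₁ (planar {a} {a} {a ∷ []} (here refl) (here refl)
          (λ { (here refl) → 1ℤ , 0<1 , 1ℤ , 0ℤ , trivialˡ a a }) p) h
        small (two a b)   h = proj₁ (pair a b p) h
        small (three τ≢0) h = simplex′ p τ≢0 h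
        conclude : ∃[ L′ ] (Small L′ × (∀ {q} → q ∈ L′ → q ∈ L) × L′ 𝓒.⊢ p) → L 𝓓.⊢ p
        conclude (L′ , s , L′⊆ , h′) = 𝓓.⊢-mono L′⊆ (small s h′)

      private
        -- A negative coefficient of c would put c in the closure of ± a, ± b, - p.
        coefficient-nonneg : ∀ {a b c} p → 0ℤ < τ a b c → a ∷ b ∷ c ∷ [] 𝓓.⊢ p → ¬ (τ a b p < 0ℤ)
        coefficient-nonneg {a} {b} {c} p 0<τ h neg< = nonplanar {a} {b} {p}
          (λ e → ℤP.<-irrefl e neg<)
          (𝓓.⊢-opp (𝓓.⊢-cut
            (λ { (here refl)                 → 𝓓.⊢-∈ (there (here refl))
               ; (there (here refl))         → 𝓓.⊢-∈ (there (there (there (here refl))))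
               ; (there (there (here refl))) → 𝓓.⊢-mono locate c∈ }) h))
          where
          ps : List (ℤ × Element)
          ps = (τ p b c , a) ∷ (τ a p c , b) ∷ (τ a b c , neg p) ∷ []

          solve-for : ∀ t t₁ t₂ t₃ x x₁ x₂ x₃ → t * x ≡ t₁ * x₁ + t₂ * x₂ + t₃ * x₃ →
                      - t₃ * x₃ ≡ t₁ * x₁ + (t₂ * x₂ + (t * (- x) + 0ℤ))
          solve-for t t₁ t₂ t₃ x x₁ x₂ x₃ e = trans (lemma t₁ t₂ t₃ x₁ x₂ x₃)
            (trans (cong (λ z → t₁ * x₁ + (t₂ * x₂ + (- z + 0ℤ))) (sym e)) (lemma′ t t₁ t₂ x x₁ x₂))
            where
            lemma : ∀ t₁ t₂ t₃ x₁ x₂ x₃ → - t₃ * x₃ ≡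
                    t₁ * x₁ + (t₂ * x₂ + (- (t₁ * x₁ + t₂ * x₂ + t₃ * x₃) + 0ℤ))
            lemma = solve-∀
            lemma′ : ∀ t t₁ t₂ x x₁ x₂ → t₁ * x₁ + (t₂ * x₂ + (- (t * x) + 0ℤ)) ≡
                     t₁ * x₁ + (t₂ * x₂ + (t * (- x) + 0ℤ))
            lemma′ = solve-∀

          rel : Relation (- τ a b p) c ps
          rel = relation
            (trans (solve-for (τ a b c) (τ p b c) (τ a p c) (τ a b p) (X p) (X a) (X b) (X c)
                      (cramer X (inj₁ refl) a b c p))
              (cong (λ x → τ p b c * X a + (τ a p c * X b + (τ a b c * x + 0ℤ))) (sym (dx-opp (proj₁ p)))))
            (trans (solve-for (τ a b c) (τ p b c) (τ a p c) (τ a b p) (Y p) (Y a) (Y b) (Y c)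
                      (cramer Y (inj₂ (inj₁ refl)) a b c p))
              (cong (λ x → τ p b c * Y a + (τ a p c * Y b + (τ a b c * x + 0ℤ))) (sym (dy-opp (proj₁ p)))))
            (solve-for (τ a b c) (τ p b c) (τ a p c) (τ a b p) (Z p) (Z a) (Z b) (Z c)
                      (cramer Z (inj₂ (inj₂ refl)) a b c p))

          c∈ : map orient ps 𝓓.⊢ c
          c∈ = 𝓒⊆𝓓 (map orient ps) c (generated (- τ a b p) c ps (ℤP.neg-mono-< neg<) rel)

          signs : ∀ n q → orient (n , q) ≡ q ⊎ orient (n , q) ≡ neg q
          signs (+ _)    q = inj₁ refl
          signs -[1+ _ ] q = inj₂ refl

          locate : ∀ {q} → q ∈ map orient ps → q ∈ neg p ∷ a ∷ neg a ∷ b ∷ neg b ∷ []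
          locate (here refl) with signs (τ p b c) a
          ... | inj₁ e = there (here e)
          ... | inj₂ e = there (there (here e))
          locate (there (here refl)) with signs (τ a p c) b
          ... | inj₁ e = there (there (there (here e)))
          ... | inj₂ e = there (there (there (there (here e))))
          locate (there (there (here refl))) = here (orient-pos (neg p) (ℤP.<⇒≤ 0<τ))

        simplex⁻ : ∀ {a b c} p → 0ℤ < τ a b c → a ∷ b ∷ c ∷ [] 𝓓.⊢ p → a ∷ b ∷ c ∷ [] 𝓒.⊢ p
        simplex⁻ {a} {b} {c} p 0<τ h = subst (𝓒._⊢ p)
          (list≡ (orient-pos a 0≤₁) (orient-pos b 0≤₂) (orient-pos c 0≤₃))
          (generated t p ((τ p b c , a) ∷ (τ a p c , b) ∷ (τ a b p , c) ∷ []) 0<τ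
            (relation (pad X (cramer X (inj₁ refl) a b c p))
                      (pad Y (cramer Y (inj₂ (inj₁ refl)) a b c p))
                      (pad Z (cramer Z (inj₂ (inj₂ refl)) a b c p))))
          where
          t = τ a b c
          list≡ : {x x′ y y′ z z′ : Element} → x ≡ x′ → y ≡ y′ → z ≡ z′ →
                  x ∷ y ∷ z ∷ [] ≡ x′ ∷ y′ ∷ z′ ∷ []
          list≡ refl refl refl = refl
          pad : ∀ f → t * f p ≡ τ p b c * f a + τ a p c * f b + τ a b p * f c →
                t * f p ≡ τ p b c * f a + (τ a p c * f b + (τ a b p * f c + 0ℤ))
          pad f e = trans e (lemma (τ p b c * f a) (τ a p c * f b) (τ a b p * f c))
            where
            lemma : ∀ x y z → x + y + z ≡ x + (y + (z + 0ℤ))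
            lemma = solve-∀
          0≤₁ : 0ℤ ≤ τ p b c
          0≤₁ = ℤP.≮⇒≥ (λ <0 → coefficient-nonneg {b} {c} {a} p (subst (0ℤ <_) (τ-cycle a b c) 0<τ)
            (𝓓.⊢-mono (λ { (here q) → there (there (here q)) ; (there (here q)) → here q
                          ; (there (there (here q))) → there (here q) }) h)
            (subst (_< 0ℤ) (τ-cycle p b c) <0))
          0≤₂ : 0ℤ ≤ τ a p c
          0≤₂ = ℤP.≮⇒≥ (λ <0 → coefficient-nonneg {c} {a} {b} p (subst (0ℤ <_) (sym (τ-cycle c a b)) 0<τ)
            (𝓓.⊢-mono (λ { (here q) → there (here q) ; (there (here q)) → there (there (here q))
                          ; (there (there (here q))) → here q }) h)
            (subst (_< 0ℤ) (sym (τ-cycle c a p)) <0))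
          0≤₃ : 0ℤ ≤ τ a b p
          0≤₃ = ℤP.≮⇒≥ (coefficient-nonneg p 0<τ h)

        simplex⁻′ : ∀ {a b c} p → τ a b c ≢ 0ℤ → a ∷ b ∷ c ∷ [] 𝓓.⊢ p → a ∷ b ∷ c ∷ [] 𝓒.⊢ p
        simplex⁻′ {a} {b} {c} p τ≢0 h with ℤP.<-cmp 0ℤ (τ a b c)
        ... | tri< 0<τ _ _ = simplex⁻ p 0<τ h
        ... | tri≈ _ 0≡τ _ = ⊥-elim (τ≢0 (sym 0≡τ))
        ... | tri> _ _ τ<0 = 𝓒.⊢-mono swap₂₃ (simplex⁻ p (flip-sign τ<0) (𝓓.⊢-mono swap₂₃ h))

      𝓓⊆𝓒 : ∀ L p → L 𝓓.⊢ p → L 𝓒.⊢ p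
      𝓓⊆𝓒 L p h = conclude (carathéodory L h)
        where
        -- By the inclusion already proved, `𝓓` inherits every conical relation, which makes
        -- Carathéodory's theorem available for it.
        open Carathéodory nonzero 𝓓 (λ n p ps 0<n rel → 𝓒⊆𝓓 (map orient ps) p (generated n p ps 0<n rel))
          using (carathéodory)
        small : ∀ {L′} → Small L′ → L′ 𝓓.⊢ p → L′ 𝓒.⊢ p
        small none        h = ⊥-elim (empty𝓓 p h)
        small (one a)     h = proj₂ (planar {a} {a} {a ∷ []} (here refl) (here refl)
          (λ { (here refl) → 1ℤ , 0<1 , 1ℤ , 0ℤ , trivialˡ a a }) p) h
        small (two a b)   h = proj₂ (pair a b p) h
        small (three τ≢0) h = simplex⁻′ p τ≢0 h
        conclude : ∃[ L′ ] (Small L′ × (∀ {q} → q ∈ L′ → q ∈ L) × L′ 𝓓.⊢ p) → L 𝓒.⊢ p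
        conclude (L′ , s , L′⊆ , h′) = 𝓒.⊢-mono L′⊆ (small s h′)

  -- The three finite root systems and their affine extensions, verified by evaluation.

  module Tabulated (size : ℕ) (vecs : Vec (ℤ × ℤ) size) (opps : Vec (Fin size) size) where
    open Int using (_<_; _+_; _*_; _-_; -_)
    open ℤP using (_≟_; _<?_)

    private
      dx dy : Fin size → ℤ
      dx i = proj₁ (lookup vecs i)
      dy i = proj₂ (lookup vecs i)

      opp : Fin size → Fin size
      opp = lookup opps

      ω : Fin size → Fin size → ℤ
      ω i j = dx i * dy j - dy i * dx j

      infix 4 _≐_+_·_
      _≐_+_·_ : Fin size → Fin size → ℤ → Fin size → Set
      k ≐ j + q · i = dx k ≡ dx j + q * dx i × dy k ≡ dy j + q * dy i

      Unit : ℤ → Set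
      Unit w = w ≡ 1ℤ ⊎ w ≡ - 1ℤ

      unit? : ∀ w → Dec (Unit w)
      unit? w = w ≟ 1ℤ ⊎-dec w ≟ - 1ℤ

      -- Root strings in rank two have at most four members, so multiples from - 3 to 3 connect any
      -- two of them.
      coefficient : Fin 7 → ℤ
      coefficient t = + toℕ t - + 3

    opposite? = all? λ i → all? {P = λ j → j ≡ opp i → dx j ≡ - dx i × dy j ≡ - dy i × opp j ≡ i}
      λ j → (j FinP.≟ opp i) →-dec
            (dx j ≟ - dx i ×-dec dy j ≟ - dy i ×-dec opp j FinP.≟ i)

    parallel? = all? λ i → all? λ j →
      (ω i j ≟ 0ℤ) →-dec (j FinP.≟ i ⊎-dec j FinP.≟ opp i)

    string? = all? λ i → all? λ j → all? λ k →
      (0ℤ <? ω i j) →-dec ((ω i j ≟ ω i k) →-dec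
      any? {P = λ t → k ≐ j + coefficient t · i} λ t →
        (dx k ≟ dx j + coefficient t * dx i ×-dec dy k ≟ dy j + coefficient t * dy i))

    steps? = all? λ i → all? λ j → all? λ k →
      (0ℤ <? ω i j) →-dec ((0ℤ <? ω i k) →-dec
      (ω i j ≟ ω i k ⊎-dec any? λ j′ → ω i j ≟ ω i j′ ×-dec any? λ k′ →
        (ω i k′ ≟ ω i k ×-dec unit? (ω k′ j′))))

    raise? = all? λ i → all? λ k → (0ℤ <? ω i k) →-dec
      (any? (λ k′ → dx k′ ≟ dx k + dx i ×-dec dy k′ ≟ dy k + dy i) ⊎-dec
       (any? (λ k′ → dx k′ ≟ dx k - dx i ×-dec dy k′ ≟ dy k - dy i) ⊎-dec
        (ω i k ≟ + 2 ×-dec any? λ j → ω i j ≟ 1ℤ ×-dec unit? (ω j k))))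

    directions : {_ : True opposite?} {_ : True parallel?} {_ : True string?}
                 {_ : True steps?} {_ : True raise?} → Directions
    directions {o} {p} {s} {t} {r} = record
      { size     = size
      ; dx       = dx
      ; dy       = dy
      ; opp      = opp
      ; opp-opp  = λ i → proj₂ (proj₂ (toWitness o i (opp i) refl))
      ; dx-opp   = λ i → proj₁ (toWitness o i (opp i) refl)
      ; dy-opp   = λ i → proj₁ (proj₂ (toWitness o i (opp i) refl))
      ; parallel = toWitness p
      ; string   = λ i j k 0<h h≡ → let t , eq = toWitness s i j k 0<h h≡ in coefficient t , eq
      ; steps    = λ i j k hj hk → [ inj₁ , (λ { (j′ , e , k′ , e′ , u) → inj₂ (j′ , k′ , e , e′ , u) }) ]′
                                     (toWitness t i j k hj hk)
      ; raise    = toWitness r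
      }

  module A₂ where
    -- Positive roots in the basis of simple roots, then their negatives in the same order; the
    -- other two tables are arranged alike.
    vecs : Vec (ℤ × ℤ) 6
    vecs = (+ 1 , + 0) ∷ (+ 0 , + 1) ∷ (+ 1 , + 1) ∷
           (-[1+ 0 ] , + 0) ∷ (+ 0 , -[1+ 0 ]) ∷ (-[1+ 0 ] , -[1+ 0 ]) ∷ []

    directions : Directions
    directions = Tabulated.directions 6 vecs (# 3 ∷ # 4 ∷ # 5 ∷ # 0 ∷ # 1 ∷ # 2 ∷ [])

  module C₂ where
    -- The first basis vector is the short simple root, the second the long one.
    vecs : Vec (ℤ × ℤ) 8
    vecs = (+ 1 , + 0) ∷ (+ 0 , + 1) ∷ (+ 1 , + 1) ∷ (+ 2 , + 1) ∷
           (-[1+ 0 ] , + 0) ∷ (+ 0 , -[1+ 0 ]) ∷ (-[1+ 0 ] , -[1+ 0 ]) ∷ (-[1+ 1 ] , -[1+ 0 ]) ∷ []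

    directions : Directions
    directions = Tabulated.directions 8 vecs
      (# 4 ∷ # 5 ∷ # 6 ∷ # 7 ∷ # 0 ∷ # 1 ∷ # 2 ∷ # 3 ∷ [])

  module G₂ where
    -- Here the first basis vector is the long simple root and the second the short one.
    vecs : Vec (ℤ × ℤ) 12
    vecs = (+ 1 , + 0) ∷ (+ 0 , + 1) ∷ (+ 1 , + 1) ∷ (+ 1 , + 2) ∷ (+ 1 , + 3) ∷ (+ 2 , + 3) ∷
           (-[1+ 0 ] , + 0) ∷ (+ 0 , -[1+ 0 ]) ∷ (-[1+ 0 ] , -[1+ 0 ]) ∷
           (-[1+ 0 ] , -[1+ 1 ]) ∷ (-[1+ 0 ] , -[1+ 2 ]) ∷ (-[1+ 1 ] , -[1+ 2 ]) ∷ []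

    directions : Directions
    directions = Tabulated.directions 12 vecs
      (# 6 ∷ # 7 ∷ # 8 ∷ # 9 ∷ # 10 ∷ # 11 ∷ # 0 ∷ # 1 ∷ # 2 ∷ # 3 ∷ # 4 ∷ # 5 ∷ [])

  -- The triple (x , y , z) stands for x e₁ + y e₂ + z δ, where e₀ , e₁ , e₂ are the
  -- (rescaled) simple roots and δ = e₀ + m₁ e₁ + m₂ e₂ spans the radical; A i j is
  -- the Cartan integer 2 (eᵢ , eⱼ) / (eⱼ , eⱼ).
  record CartanDatum : Set where
    open Int using (_<_; _+_; _*_; _-_; -_)
    field
      directions : Directions
      m₁ m₂      : ℤ
      A          : Fin 3 → Fin 3 → ℤ
    open Directions directions public

    Triple : Set
    Triple = ℤ × ℤ × ℤ

    height : Triple → ℤ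
    height v = proj₂ (proj₂ v)

    simple : Fin 3 → Triple
    simple zero             = - m₁ , - m₂ , 1ℤ
    simple (suc zero)       = 1ℤ , 0ℤ , 0ℤ
    simple (suc (suc zero)) = 0ℤ , 1ℤ , 0ℤ

    -- The null root δ pairs to zero with every coroot, hence the height does not occur.
    pairing : Fin 3 → Triple → ℤ
    pairing j (x , y , _) = A (# 1) j * x + A (# 2) j * y

    reflect : Fin 3 → Triple → Triple
    reflect j v@(x , y , z) =
      x - pairing j v * proj₁ (simple j) ,
      y - pairing j v * proj₁ (proj₂ (simple j)) ,
      z - pairing j v * height (simple j)

    run : List (Fin 3) → Triple → Triple
    run []      v = v
    run (j ∷ w) v = reflect j (run w v)

    triple : Element → Triple
    triple p = X p , Y p , Z p

    raiseBy : ℤ → Triple → Triple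
    raiseBy n (x , y , z) = x , y , z + n

    reflect-raiseBy : ∀ j n v → reflect j (raiseBy n v) ≡ raiseBy n (reflect j v)
    reflect-raiseBy j n v@(x , y , z) = cong (λ z′ → _ , _ , z′) (lemma z n (pairing j v * height (simple j)))
      where
      lemma : ∀ z n t → z + n - t ≡ z - t + n
      lemma = solve-∀

    run-raiseBy : ∀ w n v → run w (raiseBy n v) ≡ raiseBy n (run w v)
    run-raiseBy []      n v = refl
    run-raiseBy (j ∷ w) n v = trans (cong (reflect j) (run-raiseBy w n v)) (reflect-raiseBy j n (run w v))

  -- By `listed` and `closed` no root leaves the table of directions; by `reach₀`, `reach₁` and
  -- `climb` every pair of a direction and an integer is a root.
  record AffineType : Set where
    open Int using (_<_; _+_; _*_; _-_; -_)
    field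
      datum : CartanDatum
    open CartanDatum datum public
    field
      0<m₁    : 0ℤ < m₁
      0<m₂    : 0ℤ < m₂
      null    : ∀ j → A (# 0) j + m₁ * A (# 1) j + m₂ * A (# 2) j ≡ 0ℤ
      regular : A (# 1) (# 1) * A (# 2) (# 2) - A (# 1) (# 2) * A (# 2) (# 1) ≢ 0ℤ
      listed  : ∀ j → ∃[ i ] triple (i , height (simple j)) ≡ simple j
      closed  : ∀ j i → ∃[ i′ ] triple (i′ , height (reflect j (triple (i , 0ℤ)))) ≡ reflect j (triple (i , 0ℤ))
      reach₀  : ∀ i → ∃₂ λ w j → run w (simple j) ≡ triple (i , 0ℤ)
      reach₁  : ∀ i → ∃₂ λ w j → run w (simple j) ≡ triple (i , 1ℤ)
      -- The reflections in a root and in its nearest parallel compose to a translation which raises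
      -- that root by two. Heights 0 and 1 therefore need separate starting points.
      climb   : ∀ i → ∃[ w ] run w (triple (i , 0ℤ)) ≡ triple (i , + 2)

  module Checked (datum : CartanDatum)
    (words₀ words₁ : Vec (List (Fin 3) × Fin 3) (CartanDatum.size datum))
    (words₂ : Vec (List (Fin 3)) (CartanDatum.size datum)) where
    open Int using (_+_; _*_; _-_)
    open ℤP using (_≟_; _<?_)
    open CartanDatum datum

    private
      _≟³_ : (u v : Triple) → Dec (u ≡ v)
      _≟³_ = ≡-dec _≟_ (≡-dec _≟_ _≟_)

    null? = all? λ j → A (# 0) j + m₁ * A (# 1) j + m₂ * A (# 2) j ≟ 0ℤ

    regular? = ¬? (A (# 1) (# 1) * A (# 2) (# 2) - A (# 1) (# 2) * A (# 2) (# 1) ≟ 0ℤ)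

    listed? = all? λ j → any? λ i → triple (i , height (simple j)) ≟³ simple j

    closed? = all? λ j → all? λ i → any? λ i′ →
      triple (i′ , height (reflect j (triple (i , 0ℤ)))) ≟³ reflect j (triple (i , 0ℤ))

    reach₀? = all? λ i → run (proj₁ (lookup words₀ i)) (simple (proj₂ (lookup words₀ i))) ≟³ triple (i , 0ℤ)

    reach₁? = all? λ i → run (proj₁ (lookup words₁ i)) (simple (proj₂ (lookup words₁ i))) ≟³ triple (i , 1ℤ)

    climb? = all? λ i → run (lookup words₂ i) (triple (i , 0ℤ)) ≟³ triple (i , + 2)

    affineType : {_ : True (0ℤ <? m₁)} {_ : True (0ℤ <? m₂)} {_ : True null?} {_ : True regular?}
      {_ : True listed?} {_ : True closed?} {_ : True reach₀?} {_ : True reach₁?} {_ : True climb?} → AffineType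
    affineType {p₁} {p₂} {n} {d} {l} {c} {r₀} {r₁} {r₂} = record
      { datum   = datum
      ; 0<m₁    = toWitness p₁
      ; 0<m₂    = toWitness p₂
      ; null    = toWitness n
      ; regular = toWitness d
      ; listed  = toWitness l
      ; closed  = toWitness c
      ; reach₀  = λ i → proj₁ (lookup words₀ i) , proj₂ (lookup words₀ i) , toWitness r₀ i
      ; reach₁  = λ i → proj₁ (lookup words₁ i) , proj₂ (lookup words₁ i) , toWitness r₁ i
      ; climb   = λ i → lookup words₂ i , toWitness r₂ i
      }

  module Ã₂ where
    datum : CartanDatum
    datum = record
      { directions = A₂.directions
      ; m₁ = + 1
      ; m₂ = + 1
      ; A  = λ i j → lookup (lookup (((+ 2 ∷ -[1+ 0 ] ∷ -[1+ 0 ] ∷ []) ∷ (-[1+ 0 ] ∷ + 2 ∷ -[1+ 0 ] ∷ []) ∷ (-[1+ 0 ] ∷ -[1+ 0 ] ∷ + 2 ∷ []) ∷ [])) i) j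
      }

    affineType : AffineType
    affineType = Checked.affineType datum
        -- For each direction in the order of the table: a word and a simple root reaching height 0,
        -- next the same for height 1, and last a word for a translation by two.
        (([] , # 1) ∷
        ([] , # 2) ∷
        ((# 2 ∷ []) , # 1) ∷
        ((# 1 ∷ []) , # 1) ∷
        ((# 2 ∷ []) , # 2) ∷
        ((# 2 ∷ # 1 ∷ []) , # 1) ∷
        [])
        (((# 1 ∷ # 2 ∷ []) , # 0) ∷
        ((# 2 ∷ # 1 ∷ []) , # 0) ∷
        ((# 1 ∷ # 2 ∷ # 1 ∷ []) , # 0) ∷
        ((# 2 ∷ []) , # 0) ∷
        ((# 1 ∷ []) , # 0) ∷
        ([] , # 0) ∷
        [])
        ((# 1 ∷ # 0 ∷ # 2 ∷ # 0 ∷ []) ∷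
        (# 2 ∷ # 0 ∷ # 1 ∷ # 0 ∷ []) ∷
        (# 1 ∷ # 2 ∷ # 1 ∷ # 0 ∷ []) ∷
        (# 0 ∷ # 2 ∷ # 0 ∷ # 1 ∷ []) ∷
        (# 0 ∷ # 1 ∷ # 0 ∷ # 2 ∷ []) ∷
        (# 0 ∷ # 1 ∷ # 2 ∷ # 1 ∷ []) ∷
        [])

  module C̃₂ where
    datum : CartanDatum
    datum = record
      { directions = C₂.directions
      -- The null root is e₀ + 2 e₁ + e₂, with the short root e₁ in the middle of the diagram.
      ; m₁ = + 2
      ; m₂ = + 1
      ; A  = λ i j → lookup (lookup (((+ 2 ∷ -[1+ 1 ] ∷ + 0 ∷ []) ∷ (-[1+ 0 ] ∷ + 2 ∷ -[1+ 0 ] ∷ []) ∷ (+ 0 ∷ -[1+ 1 ] ∷ + 2 ∷ []) ∷ [])) i) j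
      }

    affineType : AffineType
    affineType = Checked.affineType datum
        (([] , # 1) ∷
        ([] , # 2) ∷
        ((# 2 ∷ []) , # 1) ∷
        ((# 1 ∷ []) , # 2) ∷
        ((# 1 ∷ []) , # 1) ∷
        ((# 2 ∷ []) , # 2) ∷
        ((# 2 ∷ # 1 ∷ []) , # 1) ∷
        ((# 1 ∷ # 2 ∷ []) , # 2) ∷
        [])
        (((# 1 ∷ # 2 ∷ # 0 ∷ []) , # 1) ∷
        ((# 2 ∷ # 1 ∷ []) , # 0) ∷
        ((# 2 ∷ # 1 ∷ # 2 ∷ # 0 ∷ []) , # 1) ∷
        ((# 1 ∷ # 2 ∷ # 1 ∷ []) , # 0) ∷
        ((# 2 ∷ # 0 ∷ []) , # 1) ∷
        ((# 1 ∷ []) , # 0) ∷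
        ((# 0 ∷ []) , # 1) ∷
        ([] , # 0) ∷
        [])
        ((# 1 ∷ # 2 ∷ # 0 ∷ # 1 ∷ # 2 ∷ # 0 ∷ []) ∷
        (# 2 ∷ # 1 ∷ # 0 ∷ # 1 ∷ []) ∷
        (# 2 ∷ # 1 ∷ # 2 ∷ # 0 ∷ # 1 ∷ # 0 ∷ []) ∷
        (# 1 ∷ # 2 ∷ # 1 ∷ # 0 ∷ []) ∷
        (# 2 ∷ # 0 ∷ # 1 ∷ # 2 ∷ # 0 ∷ # 1 ∷ []) ∷
        (# 1 ∷ # 0 ∷ # 1 ∷ # 2 ∷ []) ∷
        (# 0 ∷ # 1 ∷ # 2 ∷ # 0 ∷ # 1 ∷ # 2 ∷ []) ∷
        (# 0 ∷ # 1 ∷ # 2 ∷ # 1 ∷ []) ∷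
        [])

  module G̃₂ where
    datum : CartanDatum
    datum = record
      { directions = G₂.directions
      -- The null root is e₀ + 2 e₁ + 3 e₂, with the short root e₂ at the end of the diagram.
      ; m₁ = + 2
      ; m₂ = + 3
      ; A  = λ i j → lookup (lookup (((+ 2 ∷ -[1+ 0 ] ∷ + 0 ∷ []) ∷ (-[1+ 0 ] ∷ + 2 ∷ -[1+ 2 ] ∷ []) ∷ (+ 0 ∷ -[1+ 0 ] ∷ + 2 ∷ []) ∷ [])) i) j
      }

    affineType : AffineType
    affineType = Checked.affineType datum
        (([] , # 1) ∷
        ([] , # 2) ∷
        ((# 1 ∷ []) , # 2) ∷
        ((# 2 ∷ # 1 ∷ []) , # 2) ∷
        ((# 2 ∷ []) , # 1) ∷
        ((# 1 ∷ # 2 ∷ []) , # 1) ∷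
        ((# 1 ∷ []) , # 1) ∷
        ((# 2 ∷ []) , # 2) ∷
        ((# 1 ∷ # 2 ∷ []) , # 2) ∷
        ((# 2 ∷ # 1 ∷ # 2 ∷ []) , # 2) ∷
        ((# 2 ∷ # 1 ∷ []) , # 1) ∷
        ((# 1 ∷ # 2 ∷ # 1 ∷ []) , # 1) ∷
        [])
        (((# 1 ∷ # 2 ∷ # 1 ∷ []) , # 0) ∷
        ((# 2 ∷ # 1 ∷ # 2 ∷ # 0 ∷ # 1 ∷ []) , # 2) ∷
        ((# 1 ∷ # 2 ∷ # 1 ∷ # 2 ∷ # 0 ∷ # 1 ∷ []) , # 2) ∷
        ((# 2 ∷ # 1 ∷ # 2 ∷ # 1 ∷ # 2 ∷ # 0 ∷ # 1 ∷ []) , # 2) ∷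
        ((# 2 ∷ # 1 ∷ # 2 ∷ # 1 ∷ []) , # 0) ∷
        ((# 1 ∷ # 2 ∷ # 1 ∷ # 2 ∷ # 1 ∷ []) , # 0) ∷
        ((# 2 ∷ # 1 ∷ []) , # 0) ∷
        ((# 1 ∷ # 2 ∷ # 0 ∷ # 1 ∷ []) , # 2) ∷
        ((# 2 ∷ # 0 ∷ # 1 ∷ []) , # 2) ∷
        ((# 0 ∷ # 1 ∷ []) , # 2) ∷
        ((# 1 ∷ []) , # 0) ∷
        ([] , # 0) ∷
        [])
        ((# 1 ∷ # 2 ∷ # 0 ∷ # 1 ∷ # 2 ∷ # 0 ∷ []) ∷
        (# 2 ∷ # 1 ∷ # 2 ∷ # 0 ∷ # 1 ∷ # 2 ∷ # 1 ∷ # 2 ∷ # 0 ∷ # 1 ∷ []) ∷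
        (# 1 ∷ # 2 ∷ # 1 ∷ # 2 ∷ # 0 ∷ # 1 ∷ # 2 ∷ # 1 ∷ # 2 ∷ # 0 ∷ []) ∷
        (# 2 ∷ # 1 ∷ # 2 ∷ # 1 ∷ # 2 ∷ # 0 ∷ # 1 ∷ # 2 ∷ # 1 ∷ # 0 ∷ []) ∷
        (# 2 ∷ # 1 ∷ # 2 ∷ # 0 ∷ # 1 ∷ # 0 ∷ []) ∷
        (# 1 ∷ # 2 ∷ # 1 ∷ # 2 ∷ # 1 ∷ # 0 ∷ []) ∷
        (# 2 ∷ # 0 ∷ # 1 ∷ # 2 ∷ # 0 ∷ # 1 ∷ []) ∷
        (# 1 ∷ # 2 ∷ # 0 ∷ # 1 ∷ # 2 ∷ # 1 ∷ # 2 ∷ # 0 ∷ # 1 ∷ # 2 ∷ []) ∷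
        (# 2 ∷ # 0 ∷ # 1 ∷ # 2 ∷ # 1 ∷ # 2 ∷ # 0 ∷ # 1 ∷ # 2 ∷ # 1 ∷ []) ∷
        (# 0 ∷ # 1 ∷ # 2 ∷ # 1 ∷ # 2 ∷ # 0 ∷ # 1 ∷ # 2 ∷ # 1 ∷ # 2 ∷ []) ∷
        (# 0 ∷ # 1 ∷ # 2 ∷ # 0 ∷ # 1 ∷ # 2 ∷ []) ∷
        (# 0 ∷ # 1 ∷ # 2 ∷ # 1 ∷ # 2 ∷ # 1 ∷ []) ∷
        [])

open Combinatorics
open import Defs

-- Integers and inequalities in the ordered field.

module IntegerEmbedding (K : CompleteOrderedField) where
  open CompleteOrderedField K
  open RingProperties ring using (-‿involutive; -‿distribˡ-*; -‿distribʳ-*; -0#≈0#; -‿+-comm)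
  private module × = Mult semiring
  open × using () renaming (_×_ to _×′_)
  open SetoidReasoning setoid

  -- The optimised multiple makes `ι 1ℤ` and `ι (+ 2)` reduce to `1#` and `2#`, so that integer
  -- constants of the solver agree with the field expressions by computation.
  ι : ℤ → Carrier
  ι (+ n)    = n ×′ 1#
  ι -[1+ n ] = - (suc n ×′ 1#)

  private
    ι-⊖ : ∀ m n → ι (m ⊖ n) ≈ m ×′ 1# + - (n ×′ 1#)
    ι-⊖ m zero = begin
      m ×′ 1#          ≈⟨ +-identityʳ (m ×′ 1#) ⟨
      m ×′ 1# + 0#     ≈⟨ +-congˡ -0#≈0# ⟨
      m ×′ 1# + - 0#   ∎
    ι-⊖ zero (suc n) = sym (+-identityˡ _)
    ι-⊖ (suc m) (suc n) = begin
      ι (suc m ⊖ suc n)                          ≡⟨ ≡.cong ι (ℤP.[1+m]⊖[1+n]≡m⊖n m n) ⟩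
      ι (m ⊖ n)                                  ≈⟨ ι-⊖ m n ⟩
      m ×′ 1# + - (n ×′ 1#)                      ≈⟨ +-congʳ (+-identityˡ _) ⟨
      0# + m ×′ 1# + - (n ×′ 1#)                 ≈⟨ +-congʳ (+-congʳ (-‿inverseʳ 1#)) ⟨
      1# + - 1# + m ×′ 1# + - (n ×′ 1#)          ≈⟨ +-congʳ (+-assoc 1# (- 1#) _) ⟩
      1# + (- 1# + m ×′ 1#) + - (n ×′ 1#)        ≈⟨ +-congʳ (+-congˡ (+-comm (- 1#) _)) ⟩
      1# + (m ×′ 1# + - 1#) + - (n ×′ 1#)        ≈⟨ +-congʳ (+-assoc 1# _ (- 1#)) ⟨
      1# + m ×′ 1# + - 1# + - (n ×′ 1#)          ≈⟨ +-assoc _ (- 1#) _ ⟩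
      1# + m ×′ 1# + (- 1# + - (n ×′ 1#))        ≈⟨ +-congˡ (-‿+-comm 1# (n ×′ 1#)) ⟩
      1# + m ×′ 1# + - (1# + n ×′ 1#)            ≈⟨ +-cong (×.1+× m 1#) (-‿cong (×.1+× n 1#)) ⟨
      suc m ×′ 1# + - (suc n ×′ 1#)              ∎

  ι-+ : ∀ x y → ι (x Int.+ y) ≈ ι x + ι y
  ι-+ (+ m) (+ n)       = ×.×-homo-+ 1# m n
  ι-+ (+ m) -[1+ n ]    = ι-⊖ m (suc n)
  ι-+ -[1+ m ] (+ n)    = trans (ι-⊖ n (suc m)) (+-comm _ _)
  ι-+ -[1+ m ] -[1+ n ] = begin
    - (suc (suc (m ℕ.+ n)) ×′ 1#)          ≡⟨ ≡.cong (λ k → - (suc k ×′ 1#)) (≡.sym (ℕP.+-suc m n)) ⟩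
    - ((suc m ℕ.+ suc n) ×′ 1#)            ≈⟨ -‿cong (×.×-homo-+ 1# (suc m) (suc n)) ⟩
    - (suc m ×′ 1# + suc n ×′ 1#)          ≈⟨ -‿+-comm _ _ ⟨
    - (suc m ×′ 1#) + - (suc n ×′ 1#)      ∎
    where import Data.Nat.Properties as ℕP

  ι-neg : ∀ x → ι (Int.- x) ≈ - ι x
  ι-neg (+ zero)  = sym -0#≈0#
  ι-neg (+ suc n) = refl
  ι-neg -[1+ n ]  = sym (-‿involutive _)

  private
    ι-*⁺ : ∀ x n → ι (x Int.* + n) ≈ ι x * ι (+ n)
    ι-*⁺ (+ m) n    = trans (reflexive (≡.cong ι (≡.sym (ℤP.pos-* m n)))) (×.×1-homo-* m n)
    ι-*⁺ -[1+ m ] n = begin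
      ι ((Int.- + suc m) Int.* + n)    ≡⟨ ≡.cong ι (ℤP.neg-distribˡ-* (+ suc m) (+ n)) ⟨
      ι (Int.- (+ suc m Int.* + n))    ≈⟨ ι-neg (+ suc m Int.* + n) ⟩
      - ι (+ suc m Int.* + n)          ≈⟨ -‿cong (ι-*⁺ (+ suc m) n) ⟩
      - (ι (+ suc m) * ι (+ n))        ≈⟨ -‿distribˡ-* (ι (+ suc m)) (ι (+ n)) ⟩
      - ι (+ suc m) * ι (+ n)          ∎

  ι-* : ∀ x y → ι (x Int.* y) ≈ ι x * ι y
  ι-* x (+ n) = ι-*⁺ x n
  ι-* x -[1+ n ] = begin
    ι (x Int.* (Int.- + suc n))      ≡⟨ ≡.cong ι (ℤP.neg-distribʳ-* x (+ suc n)) ⟨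
    ι (Int.- (x Int.* + suc n))      ≈⟨ ι-neg (x Int.* + suc n) ⟩
    - ι (x Int.* + suc n)            ≈⟨ -‿cong (ι-*⁺ x (suc n)) ⟩
    - (ι x * ι (+ suc n))            ≈⟨ -‿distribʳ-* (ι x) (ι (+ suc n)) ⟩
    ι x * - ι (+ suc n)              ∎

  private
    morphism : Int.+-*-rawRing -Raw-AlmostCommutative⟶ fromCommutativeRing commutativeRing
    morphism = record
      { ⟦_⟧ = ι ; +-homo = ι-+ ; *-homo = ι-* ; -‿homo = ι-neg ; 0-homo = refl ; 1-homo = refl }

    weaklyDecide : ∀ x y → Maybe (ι x ≈ ι y)
    weaklyDecide x y with x ℤP.≟ y
    ... | yes x≡y = just (reflexive (≡.cong ι x≡y))
    ... | no _    = nothing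

  module Solver = RingSolver Int.+-*-rawRing (fromCommutativeRing commutativeRing) morphism weaklyDecide

module OrderedField (em : ExcludedMiddle 0ℓ) (K : CompleteOrderedField) where
  open CompleteOrderedField K
  open OrderedFieldProperties K
  open IntegerEmbedding K
  open Solver using (solve; _:=_; _:+_; _:*_; :-_; _:-_; con)
  open RingProperties ring using (-‿involutive; -0#≈0#)

  infix 4 _≟_
  _≟_ : ∀ x y → Dec (x ≈ y)
  x ≟ y = em

  0≤-+ : ∀ {x y} → 0# ≤ x → 0# ≤ y → 0# ≤ x + y
  0≤-+ {x} {y} 0≤x 0≤y =
    ≤-trans 0≤y (≤-respˡ-≈ (+-identityˡ y) (+-monoˡ-≤ y 0≤x))

  0≤-resp : ∀ {x y} → x ≈ y → 0# ≤ x → 0# ≤ y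
  0≤-resp = ≤-respʳ-≈

  0<-resp : ∀ {x y} → x ≈ y → 0# < x → 0# < y
  0<-resp x≈y (0≤x , 0≉x) = 0≤-resp x≈y 0≤x , λ 0≈y → 0≉x (trans 0≈y (sym x≈y))

  ≤0-neg : ∀ {x} → 0# ≤ - x → x ≤ 0#
  ≤0-neg {x} p = ≤-respʳ-≈ (-‿inverseˡ x) (≤-respˡ-≈ (+-identityˡ x) (+-monoˡ-≤ x p))

  ≤⇒0≤- : ∀ {x y} → x ≤ y → 0# ≤ y + - x
  ≤⇒0≤- {x} {y} p = ≤-respˡ-≈ (-‿inverseʳ x) (+-monoˡ-≤ (- x) p)

  0≤-⇒≤ : ∀ {x y} → 0# ≤ y + - x → x ≤ y
  0≤-⇒≤ {x} {y} p = ≤-respʳ-≈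
    (solve 2 (λ x y → (y :- x) :+ x := y) refl x y)
    (≤-respˡ-≈ (+-identityˡ x) (+-monoˡ-≤ x p))

  0<-+ : ∀ {x y} → 0# < x → 0# ≤ y → 0# < x + y
  0<-+ {x} {y} (0≤x , 0≉x) 0≤y = 0≤-+ 0≤x 0≤y , λ 0≈x+y → 0≉x (antisym 0≤x
    (≤0-neg (0≤-resp (trans (solve 2 (λ x y → y := (x :+ y) :- x) refl x y)
      (trans (+-congʳ (sym 0≈x+y)) (+-identityˡ (- x)))) 0≤y)))

  0≤-square : ∀ x → 0# ≤ x * x
  0≤-square x with total 0# x
  ... | inj₁ 0≤x = *-nonNeg 0≤x 0≤x
  ... | inj₂ x≤0 = 0≤-resp (solve 1 (λ x → (:- x) :* (:- x) := x :* x) refl x)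
                           (*-nonNeg (0≤-neg x≤0) (0≤-neg x≤0))

  *-cancelˡ-0 : ∀ {x y} → ¬ (x ≈ 0#) → x * y ≈ 0# → y ≈ 0#
  *-cancelˡ-0 {x} {y} x≉0 xy≈0 = trans (sym (*-identityˡ y)) (trans (*-congʳ (sym (⁻¹-inverse x≉0)))
    (trans (solve 3 (λ x z y → x :* z :* y := z :* (x :* y)) refl x (x ⁻¹) y)
      (trans (*-congˡ xy≈0) (zeroʳ (x ⁻¹)))))

  *-cancelˡ : ∀ {x y z} → ¬ (x ≈ 0#) → x * y ≈ x * z → y ≈ z
  *-cancelˡ {x} {y} {z} x≉0 xy≈xz = trans
    (solve 2 (λ y z → y := (y :- z) :+ z) refl y z)
    (trans (+-congʳ (*-cancelˡ-0 x≉0 (trans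
      (solve 3 (λ x y z → x :* (y :- z) := x :* y :- x :* z) refl x y z)
      (trans (+-congʳ xy≈xz) (-‿inverseʳ (x * z))))))
      (+-identityˡ z))

  0<⇒≉0 : ∀ {x} → 0# < x → ¬ (x ≈ 0#)
  0<⇒≉0 (_ , 0≉x) x≈0 = 0≉x (sym x≈0)

  0≤-split : ∀ {x} → 0# ≤ x → x ≈ 0# ⊎ 0# < x
  0≤-split {x} 0≤x with x ≟ 0#
  ... | yes x≈0 = inj₁ x≈0
  ... | no x≉0  = inj₂ (0≤x , x≉0 ∘ sym)

  ¬0<-neg : ∀ {x} → 0# < x → ¬ (0# ≤ - x)
  ¬0<-neg (0≤x , 0≉x) 0≤-x = 0≉x (antisym 0≤x (≤0-neg 0≤-x))

  sign : ∀ x → 0# < x ⊎ x ≈ 0# ⊎ 0# < - x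
  sign x with total 0# x
  ... | inj₁ 0≤x with 0≤-split 0≤x
  ...   | inj₁ x≈0 = inj₂ (inj₁ x≈0)
  ...   | inj₂ 0<x = inj₁ 0<x
  sign x | inj₂ x≤0 with 0≤-split (0≤-neg x≤0)
  ...   | inj₁ -x≈0 = inj₂ (inj₁ (trans (sym (-‿involutive x)) (trans (-‿cong -x≈0) -0#≈0#)))
  ...   | inj₂ 0<-x = inj₂ (inj₂ 0<-x)

  0≤-cancel : ∀ {x y} → 0# < x → 0# ≤ x * y → 0# ≤ y
  0≤-cancel {x} {y} 0<x 0≤xy with sign y
  ... | inj₁ 0<y        = proj₁ 0<y
  ... | inj₂ (inj₁ y≈0) = ≤-reflexive (sym y≈0)
  ... | inj₂ (inj₂ 0<-y) = ⊥-elim (¬0<-neg (*-positive 0<x 0<-y) (0≤-resp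
    (solve 2 (λ x y → x :* y := :- (x :* (:- y))) refl x y) 0≤xy))

  0<-cancel : ∀ {x y} → 0# < x → 0# < x * y → 0# < y
  0<-cancel {x} 0<x (0≤xy , 0≉xy) = 0≤-cancel 0<x 0≤xy ,
    λ 0≈y → 0≉xy (trans (sym (zeroʳ x)) (*-congˡ 0≈y))

  -- Either x + y = 0 and both vanish, or x + y cancels from (x + y) (x - y) = 0.
  square-injective : ∀ {x y} → 0# ≤ x → 0# ≤ y → x * x ≈ y * y → x ≈ y
  square-injective {x} {y} 0≤x 0≤y xx≈yy with 0≤-split (0≤-+ 0≤x 0≤y)
  ... | inj₁ x+y≈0 = trans x≈0 (sym (trans (solve 2 (λ x y → y := (x :+ y) :- x) refl x y)
      (trans (+-cong x+y≈0 (trans (-‿cong x≈0) -0#≈0#)) (+-identityˡ 0#))))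
    where
    x≈0 : x ≈ 0#
    x≈0 = antisym (≤0-neg (0≤-resp (trans (solve 2 (λ x y → y := (x :+ y) :- x) refl x y)
      (trans (+-congʳ x+y≈0) (+-identityˡ (- x)))) 0≤y)) 0≤x
  ... | inj₂ 0<x+y = trans (solve 2 (λ x y → x := (x :- y) :+ y) refl x y)
    (trans (+-congʳ (*-cancelˡ-0 (0<⇒≉0 0<x+y) (trans
      (solve 2 (λ x y → (x :+ y) :* (x :- y) := x :* x :- y :* y) refl x y)
      (trans (+-congʳ xx≈yy) (-‿inverseʳ (y * y)))))) (+-identityˡ y))

  square-reflects-≤ : ∀ {x y} → 0# ≤ x → y * y ≤ x * x → y ≤ x
  square-reflects-≤ {x} {y} 0≤x yy≤xx with sign (y + - x)
  ... | inj₁ 0<y-x = ⊥-elim (¬0<-neg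
    (*-positive 0<y-x (0<-resp (solve 2 (λ x y → (y :- x) :+ (x :+ x) := x :+ y) refl x y)
                               (0<-+ 0<y-x (0≤-+ 0≤x 0≤x))))
    (0≤-resp (solve 2 (λ x y → x :* x :- y :* y := :- ((y :- x) :* (x :+ y))) refl x y) (≤⇒0≤- yy≤xx)))
  ... | inj₂ (inj₁ y-x≈0) = ≤-reflexive (trans (solve 2 (λ x y → y := (y :- x) :+ x) refl x y)
    (trans (+-congʳ y-x≈0) (+-identityˡ x)))
  ... | inj₂ (inj₂ 0<x-y) = 0≤-⇒≤ (0≤-resp (solve 2 (λ x y → :- (y :- x) := x :- y) refl x y) (proj₁ 0<x-y))

  0≤ι : ∀ {n} → 0ℤ Int.≤ n → 0# ≤ ι n
  0≤ι (Int.+≤+ {n = n} _) = go n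
    where
    go : ∀ n → 0# ≤ ι (+ n)
    go zero          = ≤-refl
    go (suc zero)    = 0≤1
    go (suc (suc n)) = 0≤-+ (go (suc n)) 0≤1

  0<ι : ∀ {n} → 0ℤ Int.< n → 0# < ι n
  0<ι (Int.+<+ {n = suc n} _) = go n
    where
    go : ∀ n → 0# < ι (+ suc n)
    go zero    = 0<1
    go (suc n) = 0<-+ (go n) 0≤1

  0≤ι⁻ : ∀ {n} → 0# ≤ ι n → 0ℤ Int.≤ n
  0≤ι⁻ {+ n} _          = Int.+≤+ ℕ.z≤n
  0≤ι⁻ { -[1+ n ]} 0≤-n = ⊥-elim (¬0<-neg (0<ι {+ suc n} (Int.+<+ (ℕ.s≤s ℕ.z≤n))) 0≤-n)

  ι≈0 : ∀ {n} → ι n ≈ 0# → n ≡ 0ℤ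
  ι≈0 {n} ιn≈0 = ℤP.≤-antisym
    (≡.subst (Int._≤ 0ℤ) (ℤP.neg-involutive n) (ℤP.neg-mono-≤ (0≤ι⁻ {Int.- n}
      (≤-reflexive (sym (trans (ι-neg n) (trans (-‿cong ιn≈0) -0#≈0#)))))))
    (0≤ι⁻ (≤-reflexive (sym ιn≈0)))

-- Vector identities are checked by comparing coefficients.
module LinearExpressions (K : CompleteOrderedField)
                         (V : Module (CompleteOrderedField.commutativeRing K) 0ℓ 0ℓ) where
  open CompleteOrderedField K hiding (zero)
  open Module V
  open LinearAlgebra K V
  open SetoidReasoning ≈ᴹ-setoid

  infixr 8 ⊝_
  infixr 7 _⊛_
  infixl 6 _⊕_

  data Expr (m : ℕ) : Set where
    var : Fin m → Expr m
    𝟎   : Expr m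
    _⊕_ : Expr m → Expr m → Expr m
    ⊝_  : Expr m → Expr m
    _⊛_ : Carrier → Expr m → Expr m

  ⟦_⟧ : ∀ {m} → Expr m → Vec Carrierᴹ m → Carrierᴹ
  ⟦ var i ⟧ ρ = lookup ρ i
  ⟦ 𝟎 ⟧     ρ = 0ᴹ
  ⟦ e ⊕ f ⟧ ρ = ⟦ e ⟧ ρ +ᴹ ⟦ f ⟧ ρ
  ⟦ ⊝ e ⟧   ρ = -ᴹ ⟦ e ⟧ ρ
  ⟦ c ⊛ e ⟧ ρ = c *ₗ ⟦ e ⟧ ρ

  coefficient : ∀ {m} → Expr m → Vector Carrier m
  coefficient (var zero)    zero    = 1#
  coefficient (var zero)    (suc i) = 0#
  coefficient (var (suc j)) zero    = 0#
  coefficient (var (suc j)) (suc i) = coefficient (var j) i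
  coefficient 𝟎             i = 0#
  coefficient (e ⊕ f)       i = coefficient e i + coefficient f i
  coefficient (⊝ e)         i = - coefficient e i
  coefficient (c ⊛ e)       i = c * coefficient e i

  linComb-cong : ∀ {n} {c d : Vector Carrier n} {u v : Vector Carrierᴹ n} →
                 (∀ i → c i ≈ d i) → (∀ i → u i ≈ᴹ v i) → linComb c u ≈ᴹ linComb d v
  linComb-cong {zero}  c≈d u≈v = ≈ᴹ-refl
  linComb-cong {suc n} c≈d u≈v =
    +ᴹ-cong (*ₗ-cong (c≈d zero) (u≈v zero)) (linComb-cong (c≈d ∘ suc) (u≈v ∘ suc))

  linComb-0 : ∀ {n} (v : Vector Carrierᴹ n) → 0ᴹ ≈ᴹ linComb (λ _ → 0#) v
  linComb-0 {zero}  v = ≈ᴹ-refl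
  linComb-0 {suc n} v = ≈ᴹ-trans (≈ᴹ-sym (+ᴹ-identityˡ 0ᴹ))
    (+ᴹ-cong (≈ᴹ-sym (*ₗ-zeroˡ (v zero))) (linComb-0 (v ∘ suc)))

  open CommutativeSemigroupProperties (CommutativeMonoid.commutativeSemigroup +ᴹ-commutativeMonoid)
    public using (interchange)

  linComb-+ : ∀ {n} (c d : Vector Carrier n) (v : Vector Carrierᴹ n) →
              linComb c v +ᴹ linComb d v ≈ᴹ linComb (λ i → c i + d i) v
  linComb-+ {zero}  c d v = +ᴹ-identityˡ 0ᴹ
  linComb-+ {suc n} c d v = ≈ᴹ-trans
    (interchange (c zero *ₗ v zero) (linComb (c ∘ suc) (v ∘ suc)) (d zero *ₗ v zero) (linComb (d ∘ suc) (v ∘ suc)))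
    (+ᴹ-cong (≈ᴹ-sym (*ₗ-distribʳ (v zero) (c zero) (d zero)))
             (linComb-+ (c ∘ suc) (d ∘ suc) (v ∘ suc)))

  linComb-* : ∀ {n} k (c : Vector Carrier n) (v : Vector Carrierᴹ n) →
              k *ₗ linComb c v ≈ᴹ linComb (λ i → k * c i) v
  linComb-* {zero}  k c v = *ₗ-zeroʳ k
  linComb-* {suc n} k c v = ≈ᴹ-trans
    (*ₗ-distribˡ k (c zero *ₗ v zero) (linComb (c ∘ suc) (v ∘ suc)))
    (+ᴹ-cong (≈ᴹ-sym (*ₗ-assoc k (c zero) (v zero))) (linComb-* k (c ∘ suc) (v ∘ suc)))

  private
    neg≈-1 : ∀ v → -ᴹ v ≈ᴹ (- 1#) *ₗ v
    neg≈-1 v = ≈ᴹ-sym (inverseʳ-uniqueᴹ v ((- 1#) *ₗ v) (begin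
      v +ᴹ (- 1#) *ₗ v         ≈⟨ +ᴹ-congʳ (*ₗ-identityˡ v) ⟨
      1# *ₗ v +ᴹ (- 1#) *ₗ v   ≈⟨ *ₗ-distribʳ v 1# (- 1#) ⟨
      (1# + (- 1#)) *ₗ v       ≈⟨ *ₗ-congʳ (-‿inverseʳ 1#) ⟩
      0# *ₗ v                  ≈⟨ *ₗ-zeroˡ v ⟩
      0ᴹ                       ∎))
      where open import Algebra.Module.Properties V using (inverseʳ-uniqueᴹ)

    linComb-var : ∀ {m} (i : Fin m) (ρ : Vec Carrierᴹ m) →
                  lookup ρ i ≈ᴹ linComb (coefficient (var i)) (lookup ρ)
    linComb-var zero (v ∷ ρ) = begin
      v                                            ≈⟨ *ₗ-identityˡ v ⟨
      1# *ₗ v                                      ≈⟨ +ᴹ-identityʳ (1# *ₗ v) ⟨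
      1# *ₗ v +ᴹ 0ᴹ                                ≈⟨ +ᴹ-congˡ (linComb-0 (lookup ρ)) ⟩
      1# *ₗ v +ᴹ linComb (λ _ → 0#) (lookup ρ)     ∎
    linComb-var (suc i) (v ∷ ρ) = begin
      lookup ρ i                                        ≈⟨ linComb-var i ρ ⟩
      linComb (coefficient (var i)) (lookup ρ)          ≈⟨ +ᴹ-identityˡ _ ⟨
      0ᴹ +ᴹ linComb (coefficient (var i)) (lookup ρ)    ≈⟨ +ᴹ-congʳ (*ₗ-zeroˡ v) ⟨
      0# *ₗ v +ᴹ linComb (coefficient (var i)) (lookup ρ)  ∎

  normal-form : ∀ {m} (e : Expr m) ρ → ⟦ e ⟧ ρ ≈ᴹ linComb (coefficient e) (lookup ρ)
  normal-form (var i) ρ = linComb-var i ρ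
  normal-form 𝟎       ρ = linComb-0 (lookup ρ)
  normal-form (e ⊕ f) ρ = ≈ᴹ-trans (+ᴹ-cong (normal-form e ρ) (normal-form f ρ))
    (linComb-+ (coefficient e) (coefficient f) (lookup ρ))
  normal-form (⊝ e)   ρ = ≈ᴹ-trans (neg≈-1 (⟦ e ⟧ ρ)) (≈ᴹ-trans (*ₗ-congˡ (normal-form e ρ))
    (≈ᴹ-trans (linComb-* (- 1#) (coefficient e) (lookup ρ))
      (linComb-cong (λ i → -1*x≈-x (coefficient e i)) (λ _ → ≈ᴹ-refl))))
    where open RingProperties ring using (-1*x≈-x)
  normal-form (c ⊛ e) ρ = ≈ᴹ-trans (*ₗ-congˡ (normal-form e ρ))
    (linComb-* c (coefficient e) (lookup ρ))

  by-coefficients : ∀ {m} (e f : Expr m) ρ → (∀ i → coefficient e i ≈ coefficient f i) →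
                    ⟦ e ⟧ ρ ≈ᴹ ⟦ f ⟧ ρ
  by-coefficients e f ρ eq = ≈ᴹ-trans (normal-form e ρ)
    (≈ᴹ-trans (linComb-cong eq (λ _ → ≈ᴹ-refl)) (≈ᴹ-sym (normal-form f ρ)))

-- Conical hulls.

module Cones (em : ExcludedMiddle 0ℓ) (K : CompleteOrderedField)
             (V : Module (CompleteOrderedField.commutativeRing K) 0ℓ 0ℓ) where
  open CompleteOrderedField K hiding (zero)
  open OrderedFieldProperties K
  open OrderedField em K
  open Module V
  open LinearAlgebra K V
  open LinearExpressions K V

  module _ {P : Pred Carrierᴹ 0ℓ} where
    cone-0 : Cone P 0ᴹ
    cone-0 = 0 , (λ ()) , (λ ()) , (λ ()) , (λ ()) , ≈ᴹ-refl

    cone-resp : ∀ {u v} → u ≈ᴹ v → Cone P u → Cone P v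
    cone-resp u≈v (n , c , a , 0≤c , Pa , u≈) = n , c , a , 0≤c , Pa , ≈ᴹ-trans (≈ᴹ-sym u≈v) u≈

    cone-∷ : ∀ {c a v} → 0# ≤ c → P a → Cone P v → Cone P (c *ₗ a +ᴹ v)
    cone-∷ {c} {a} 0≤c Pa (n , d , b , 0≤d , Pb , v≈) =
      suc n , c Vector.∷ d , a Vector.∷ b ,
      (λ { zero → 0≤c ; (suc i) → 0≤d i }) , (λ { zero → Pa ; (suc i) → Pb i }) , +ᴹ-congˡ v≈

    -- Induction over the summands, which keeps families of coefficients out of later arguments
    -- about cones.
    cone-elim : (Q : Pred Carrierᴹ 0ℓ) → (∀ {u v} → u ≈ᴹ v → Q u → Q v) → Q 0ᴹ →
                (∀ {c a v} → 0# ≤ c → P a → Q v → Q (c *ₗ a +ᴹ v)) → ∀ {v} → Cone P v → Q v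
    cone-elim Q resp Q0 Q∷ (n , c , a , 0≤c , Pa , v≈) = resp (≈ᴹ-sym v≈) (go n c a 0≤c Pa)
      where
      go : ∀ n (c : Vector Carrier n) a → (∀ i → 0# ≤ c i) → (∀ i → P (a i)) → Q (linComb c a)
      go zero    c a 0≤c Pa = Q0
      go (suc n) c a 0≤c Pa =
        Q∷ (0≤c zero) (Pa zero) (go n (c ∘ suc) (a ∘ suc) (0≤c ∘ suc) (Pa ∘ suc))

    cone-+ : ∀ {u v} → Cone P u → Cone P v → Cone P (u +ᴹ v)
    cone-+ {v = v} Cu Cv = cone-elim (λ u → Cone P (u +ᴹ v))
      (λ u≈u′ → cone-resp (+ᴹ-congʳ u≈u′)) (cone-resp (≈ᴹ-sym (+ᴹ-identityˡ v)) Cv)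
      (λ 0≤c Pa → cone-resp (≈ᴹ-sym (+ᴹ-assoc _ _ v)) ∘ cone-∷ 0≤c Pa) Cu

    cone-* : ∀ {c v} → 0# ≤ c → Cone P v → Cone P (c *ₗ v)
    cone-* {c} 0≤c = cone-elim (λ v → Cone P (c *ₗ v))
      (λ u≈v → cone-resp (*ₗ-congˡ u≈v)) (cone-resp (≈ᴹ-sym (*ₗ-zeroʳ c)) cone-0)
      (λ {d} {a} {v} 0≤d Pa h → cone-resp
        (≈ᴹ-trans (+ᴹ-congʳ (*ₗ-assoc c d a)) (≈ᴹ-sym (*ₗ-distribˡ c (d *ₗ a) v)))
        (cone-∷ (*-nonNeg 0≤c 0≤d) Pa h))

    cone-generator : ∀ {a} → P a → Cone P a
    cone-generator {a} Pa = cone-resp (≈ᴹ-trans (+ᴹ-identityʳ (1# *ₗ a)) (*ₗ-identityˡ a))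
      (cone-∷ 0≤1 Pa cone-0)

  cone-bind : ∀ {P Q : Pred Carrierᴹ 0ℓ} → (∀ {a} → P a → Cone Q a) → ∀ {v} → Cone P v → Cone Q v
  cone-bind {P} {Q} f = cone-elim {P} (Cone Q) (cone-resp {Q}) (cone-0 {Q})
    (λ 0≤c Pa → cone-+ {Q} (cone-* {Q} 0≤c (f Pa)))

-- Conical closure satisfies the axioms on every root system.

module Roots (em : ExcludedMiddle 0ℓ) {K : CompleteOrderedField} {T : Trigonometry K}
             {V : Module (CompleteOrderedField.commutativeRing K) 0ℓ 0ℓ}
             {rank : ℕ} (Φ : RootSystem T V rank) where
  open CompleteOrderedField K hiding (zero)
  open OrderedFieldProperties K
  open IntegerEmbedding K
  open Solver using (solve; _:=_; _:+_; _:*_; :-_; _:-_; con)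
  open OrderedField em K
  open Module V
  open LinearAlgebra K V
  open LinearExpressions K V
  open Cones em K V
  open RootSystem Φ
  open Root using (vec)

  *ₗ-cancel : ∀ {c u v} → 0# < c → c *ₗ u ≈ᴹ v → u ≈ᴹ c ⁻¹ *ₗ v
  *ₗ-cancel {c} {u} {v} 0<c cu≈v = begin
    u                ≈⟨ *ₗ-identityˡ u ⟨
    1# *ₗ u          ≈⟨ *ₗ-congʳ (trans (*-comm (c ⁻¹) c) (⁻¹-inverse (0<⇒≉0 0<c))) ⟨
    (c ⁻¹ * c) *ₗ u  ≈⟨ *ₗ-assoc (c ⁻¹) c u ⟩
    c ⁻¹ *ₗ c *ₗ u   ≈⟨ *ₗ-congˡ cu≈v ⟩
    c ⁻¹ *ₗ v        ∎
    where open SetoidReasoning ≈ᴹ-setoid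

  *ₗ-cancel-0 : ∀ {c u} → ¬ (c ≈ 0#) → c *ₗ u ≈ᴹ 0ᴹ → u ≈ᴹ 0ᴹ
  *ₗ-cancel-0 {c} {u} c≉0 cu≈0 = begin
    u                ≈⟨ *ₗ-identityˡ u ⟨
    1# *ₗ u          ≈⟨ *ₗ-congʳ (trans (*-comm (c ⁻¹) c) (⁻¹-inverse c≉0)) ⟨
    (c ⁻¹ * c) *ₗ u  ≈⟨ *ₗ-assoc (c ⁻¹) c u ⟩
    c ⁻¹ *ₗ c *ₗ u   ≈⟨ *ₗ-congˡ cu≈0 ⟩
    c ⁻¹ *ₗ 0ᴹ       ≈⟨ *ₗ-zeroʳ (c ⁻¹) ⟩
    0ᴹ               ∎
    where open SetoidReasoning ≈ᴹ-setoid

  module _ (i : Fin rank) where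
    private
      N = ⟪ α i , α i ⟫

    -- The pairing with the coroot of `α i`.
    κ : Carrierᴹ → Carrier
    κ v = 2# * ⟪ v , α i ⟫ / N

    κ-cong : ∀ {u v} → u ≈ᴹ v → κ u ≈ κ v
    κ-cong u≈v = *-congʳ (*-congˡ (⟪⟫-cong u≈v ≈ᴹ-refl))

    κ-+ : ∀ u v → κ (u +ᴹ v) ≈ κ u + κ v
    κ-+ u v = trans (*-congʳ (*-congˡ (⟪⟫-+ˡ u v (α i))))
      (solve 4 (λ t a b n → t :* (a :+ b) :* n := t :* a :* n :+ t :* b :* n) refl
             2# ⟪ u , α i ⟫ ⟪ v , α i ⟫ (N ⁻¹))

    κ-* : ∀ c v → κ (c *ₗ v) ≈ c * κ v
    κ-* c v = trans (*-congʳ (*-congˡ (⟪⟫-*ˡ c v (α i))))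
      (solve 4 (λ t c a n → t :* (c :* a) :* n := c :* (t :* a :* n)) refl
             2# c ⟪ v , α i ⟫ (N ⁻¹))

    κ-α : κ (α i) ≈ 2#
    κ-α = trans (*-assoc 2# N (N ⁻¹))
      (trans (*-congˡ (⁻¹-inverse (0<⇒≉0 (α-positive i)))) (*-identityʳ 2#))

    s≈ : ∀ v → s i v ≈ᴹ v +ᴹ (- κ v) *ₗ α i
    s≈ v = by-coefficients (x ⊕ ⊝ (κ v ⊛ a)) (x ⊕ (- κ v) ⊛ a) (v ∷ α i ∷ [])
      (λ { zero → solve 1 (λ k → con 1ℤ :+ :- (k :* con 0ℤ) := con 1ℤ :+ (:- k) :* con 0ℤ) refl (κ v)
         ; (suc zero) → solve 1 (λ k → con 0ℤ :+ :- (k :* con 1ℤ) := con 0ℤ :+ (:- k) :* con 1ℤ) refl (κ v) })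
      where
      x a : Expr 2
      x = var zero
      a = var (suc zero)

    s-cong : ∀ {u v} → u ≈ᴹ v → s i u ≈ᴹ s i v
    s-cong u≈v = +ᴹ-cong u≈v (-ᴹ‿cong (*ₗ-congʳ (κ-cong u≈v)))

    s-involutive : ∀ v → s i (s i v) ≈ᴹ v
    s-involutive v = begin
      s i (s i v)                                            ≈⟨ s≈ (s i v) ⟩
      s i v +ᴹ (- κ (s i v)) *ₗ α i                          ≈⟨ +ᴹ-cong (s≈ v) (*ₗ-congʳ κs) ⟩
      (v +ᴹ (- κ v) *ₗ α i) +ᴹ κ v *ₗ α i                    ≈⟨ +ᴹ-assoc v _ _ ⟩
      v +ᴹ ((- κ v) *ₗ α i +ᴹ κ v *ₗ α i)                    ≈⟨ +ᴹ-congˡ (*ₗ-distribʳ (α i) (- κ v) (κ v)) ⟨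
      v +ᴹ (- κ v + κ v) *ₗ α i                              ≈⟨ +ᴹ-congˡ (≈ᴹ-trans (*ₗ-congʳ (-‿inverseˡ (κ v))) (*ₗ-zeroˡ (α i))) ⟩
      v +ᴹ 0ᴹ                                                ≈⟨ +ᴹ-identityʳ v ⟩
      v                                                      ∎
      where
      open SetoidReasoning ≈ᴹ-setoid
      κs : - κ (s i v) ≈ κ v
      κs = trans (-‿cong (trans (κ-cong (s≈ v)) (trans (κ-+ v _) (+-congˡ (trans (κ-* (- κ v) (α i)) (*-congˡ κ-α))))))
        (solve 1 (λ k → :- (k :+ (:- k) :* (con 1ℤ :+ con 1ℤ)) := k) refl (κ v))

    s-+ : ∀ u v → s i (u +ᴹ v) ≈ᴹ s i u +ᴹ s i v
    s-+ u v = begin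
      s i (u +ᴹ v)                                               ≈⟨ s≈ (u +ᴹ v) ⟩
      (u +ᴹ v) +ᴹ (- κ (u +ᴹ v)) *ₗ α i                          ≈⟨ +ᴹ-congˡ (*ₗ-congʳ (trans (-‿cong (κ-+ u v))
                                                                      (solve 2 (λ a b → :- (a :+ b) := :- a :+ :- b) refl (κ u) (κ v)))) ⟩
      (u +ᴹ v) +ᴹ (- κ u + - κ v) *ₗ α i                         ≈⟨ +ᴹ-congˡ (*ₗ-distribʳ (α i) (- κ u) (- κ v)) ⟩
      (u +ᴹ v) +ᴹ ((- κ u) *ₗ α i +ᴹ (- κ v) *ₗ α i)             ≈⟨ interchange u v ((- κ u) *ₗ α i) ((- κ v) *ₗ α i) ⟩
      (u +ᴹ (- κ u) *ₗ α i) +ᴹ (v +ᴹ (- κ v) *ₗ α i)             ≈⟨ +ᴹ-cong (s≈ u) (s≈ v) ⟨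
      s i u +ᴹ s i v                                             ∎
      where
      open SetoidReasoning ≈ᴹ-setoid

    s-* : ∀ c v → s i (c *ₗ v) ≈ᴹ c *ₗ s i v
    s-* c v = begin
      s i (c *ₗ v)                             ≈⟨ s≈ (c *ₗ v) ⟩
      c *ₗ v +ᴹ (- κ (c *ₗ v)) *ₗ α i          ≈⟨ +ᴹ-congˡ (*ₗ-congʳ (trans (-‿cong (κ-* c v))
                                                    (solve 2 (λ c k → :- (c :* k) := c :* (:- k)) refl c (κ v)))) ⟩
      c *ₗ v +ᴹ (c * - κ v) *ₗ α i             ≈⟨ +ᴹ-congˡ (*ₗ-assoc c (- κ v) (α i)) ⟩
      c *ₗ v +ᴹ c *ₗ (- κ v) *ₗ α i            ≈⟨ *ₗ-distribˡ c v ((- κ v) *ₗ α i) ⟨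
      c *ₗ (v +ᴹ (- κ v) *ₗ α i)               ≈⟨ *ₗ-congˡ (s≈ v) ⟨
      c *ₗ s i v                               ∎
      where open SetoidReasoning ≈ᴹ-setoid

  act-cong : ∀ w {u v} → u ≈ᴹ v → act w u ≈ᴹ act w v
  act-cong []      u≈v = u≈v
  act-cong (i ∷ w) u≈v = s-cong i (act-cong w u≈v)

  act-* : ∀ w c v → act w (c *ₗ v) ≈ᴹ c *ₗ act w v
  act-* []      c v = ≈ᴹ-refl
  act-* (i ∷ w) c v = ≈ᴹ-trans (s-cong i (act-* w c v)) (s-* i c (act w v))

  act-++ : ∀ w w′ v → act (w ++ w′) v ≡ act w (act w′ v)
  act-++ []      w′ v = ≡.refl
  act-++ (i ∷ w) w′ v = ≡.cong (s i) (act-++ w w′ v)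

  act-+ : ∀ w u v → act w (u +ᴹ v) ≈ᴹ act w u +ᴹ act w v
  act-+ []      u v = ≈ᴹ-refl
  act-+ (i ∷ w) u v = ≈ᴹ-trans (s-cong i (act-+ w u v)) (s-+ i (act w u) (act w v))

  act-reverse : ∀ w v → act (reverse w) (act w v) ≈ᴹ v
  act-reverse []      v = ≈ᴹ-refl
  act-reverse (i ∷ w) v = begin
    act (reverse (i ∷ w)) (act (i ∷ w) v)          ≡⟨ ≡.cong (λ w′ → act w′ (act (i ∷ w) v)) (ListP.unfold-reverse i w) ⟩
    act (reverse w ++ i ∷ []) (s i (act w v))      ≡⟨ act-++ (reverse w) (i ∷ []) (s i (act w v)) ⟩
    act (reverse w) (s i (s i (act w v)))          ≈⟨ act-cong (reverse w) (s-involutive i (act w v)) ⟩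
    act (reverse w) (act w v)                      ≈⟨ act-reverse w v ⟩
    v                                              ∎
    where open SetoidReasoning ≈ᴹ-setoid

  act-reverse′ : ∀ w v → act w (act (reverse w) v) ≈ᴹ v
  act-reverse′ w v = ≈ᴹ-trans
    (≈ᴹ-reflexive (≡.cong (λ w′ → act w′ (act (reverse w) v)) (≡.sym (ListP.reverse-involutive w))))
    (act-reverse (reverse w) v)

  act-0 : ∀ w → act w 0ᴹ ≈ᴹ 0ᴹ
  act-0 w = ≈ᴹ-trans (act-cong w (≈ᴹ-sym (*ₗ-zeroˡ 0ᴹ)))
    (≈ᴹ-trans (act-* w 0# 0ᴹ) (*ₗ-zeroˡ (act w 0ᴹ)))

  α≉0 : ∀ i → ¬ (α i ≈ᴹ 0ᴹ)
  α≉0 i α≈0 = 0<⇒≉0 (α-positive i) (trans (⟪⟫-cong (≈ᴹ-trans α≈0 (≈ᴹ-sym (*ₗ-zeroˡ 0ᴹ))) ≈ᴹ-refl)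
    (trans (⟪⟫-*ˡ 0# 0ᴹ (α i)) (zeroˡ ⟪ 0ᴹ , α i ⟫)))

  root≉0 : ∀ (r : Root Φ) → ¬ (vec r ≈ᴹ 0ᴹ)
  root≉0 (v ,ʳ (w , i , v≈)) v≈0 = α≉0 i (begin
    α i                           ≈⟨ act-reverse w (α i) ⟨
    act (reverse w) (act w (α i)) ≈⟨ act-cong (reverse w) (≈ᴹ-trans (≈ᴹ-sym v≈) v≈0) ⟩
    act (reverse w) 0ᴹ            ≈⟨ act-0 (reverse w) ⟩
    0ᴹ                            ∎)
    where open SetoidReasoning ≈ᴹ-setoid

  open Subsets (Φ̄ Φ)
  open Setoid (Φ̄ Φ) using () renaming (refl to ∼-refl; sym to ∼-sym; trans to ∼-trans)

  Cone∈ : Subset → Pred Carrierᴹ 0ℓ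
  Cone∈ X = Cone (representatives Φ X)

  coneΦ⁻ : ∀ X x → x ∈ coneΦ Φ X → Cone∈ X (vec x)
  coneΦ⁻ X x (y , Cy , c , 0<c , x≈cy) =
    cone-resp {representatives Φ X} (≈ᴹ-sym x≈cy) (cone-* {representatives Φ X} (proj₁ 0<c) Cy)

  coneΦ⁺ : ∀ X x → Cone∈ X (vec x) → x ∈ coneΦ Φ X
  coneΦ⁺ X x Cx = x , Cx , ∼-refl {x}

  cone∈-generator : ∀ X x → x ∈ X → Cone∈ X (vec x)
  cone∈-generator X x x∈X = cone-generator {representatives Φ X} (x , x∈X , ≈ᴹ-refl)

  cone∈-bind : ∀ X Y → (∀ x → x ∈ X → Cone∈ Y (vec x)) → ∀ {v} → Cone∈ X v → Cone∈ Y v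
  cone∈-bind X Y f = cone-bind {representatives Φ X} {representatives Φ Y}
    (λ { (x , x∈X , a≈x) → cone-resp {representatives Φ Y} (≈ᴹ-sym a≈x) (f x x∈X) })

  cone∈-mono : ∀ X Y → X ⊆ Y → ∀ {v} → Cone∈ X v → Cone∈ Y v
  cone∈-mono X Y X⊆Y = cone∈-bind X Y (λ x → cone∈-generator Y x ∘ X⊆Y {x})

  coneΦ-isClosureOperator : IsClosureOperator (coneΦ Φ)
  coneΦ-isClosureOperator = record
    { extensive  = λ X {x} x∈X → coneΦ⁺ X x (cone∈-generator X x x∈X)
    ; monotone   = λ {X} {Y} X⊆Y {x} x∈ →
        coneΦ⁺ Y x (cone∈-mono X Y (λ {z} → X⊆Y {z}) (coneΦ⁻ X x x∈))
    ; idempotent = λ X →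
        (λ {x} x∈ → coneΦ⁺ X x (cone∈-bind (coneΦ Φ X) X (coneΦ⁻ X) (coneΦ⁻ (coneΦ Φ X) x x∈))) ,
        (λ {x} x∈ → coneΦ⁺ (coneΦ Φ X) x (cone∈-generator (coneΦ Φ X) x x∈))
    }

  -- Negation and the elements of W enter alike, as linear bijections preserving the roots. The
  -- inverse is recorded with its action on roots because preimages of roots have to be exhibited.
  record Symmetry (f : Root Φ → Root Φ) : Set where
    field
      F G     : Carrierᴹ → Carrierᴹ
      F-cong  : ∀ {u v} → u ≈ᴹ v → F u ≈ᴹ F v
      G-cong  : ∀ {u v} → u ≈ᴹ v → G u ≈ᴹ G v
      F-+     : ∀ u v → F (u +ᴹ v) ≈ᴹ F u +ᴹ F v
      G-+     : ∀ u v → G (u +ᴹ v) ≈ᴹ G u +ᴹ G v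
      F-*     : ∀ c v → F (c *ₗ v) ≈ᴹ c *ₗ F v
      G-*     : ∀ c v → G (c *ₗ v) ≈ᴹ c *ₗ G v
      G∘F     : ∀ v → G (F v) ≈ᴹ v
      F∘G     : ∀ v → F (G v) ≈ᴹ v
      g       : Root Φ → Root Φ
      vec-f   : ∀ x → vec (f x) ≈ᴹ F (vec x)
      vec-g   : ∀ x → vec (g x) ≈ᴹ G (vec x)

  cone-map : ∀ {P Q : Pred Carrierᴹ 0ℓ} (F : Carrierᴹ → Carrierᴹ) →
             (∀ {u v} → u ≈ᴹ v → F u ≈ᴹ F v) → (∀ u v → F (u +ᴹ v) ≈ᴹ F u +ᴹ F v) →
             (∀ c v → F (c *ₗ v) ≈ᴹ c *ₗ F v) → (∀ {a} → P a → Cone Q (F a)) →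
             ∀ {v} → Cone P v → Cone Q (F v)
  cone-map {P} {Q} F F-cong F-+ F-* h = cone-elim {P} (λ v → Cone Q (F v))
    (λ u≈v → cone-resp {Q} (F-cong u≈v))
    (cone-resp {Q} (≈ᴹ-sym (≈ᴹ-trans (F-cong (≈ᴹ-sym (*ₗ-zeroˡ 0ᴹ)))
      (≈ᴹ-trans (F-* 0# 0ᴹ) (*ₗ-zeroˡ (F 0ᴹ))))) (cone-0 {Q}))
    (λ {c} {a} {v} 0≤c Pa CFv → cone-resp {Q}
      (≈ᴹ-sym (≈ᴹ-trans (F-+ (c *ₗ a) v) (+ᴹ-congʳ (F-* c a))))
      (cone-+ {Q} (cone-* {Q} 0≤c (h Pa)) CFv))

  image-coneΦ : ∀ {f} → Symmetry f → ∀ X → image f (coneΦ Φ X) ≐ coneΦ Φ (image f X)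
  image-coneΦ {f} S X = (λ {z} → to {z}) , (λ {z} → from {z})
    where
    open Symmetry S
    Y = image f X

    to : image f (coneΦ Φ X) ⊆ coneΦ Φ Y
    to {z} (y , (x , x∈ , y∼fx) , z∼y) with ∼-trans {z} {y} {f x} z∼y y∼fx
    ... | c , 0<c , z≈ = coneΦ⁺ Y z (cone-resp {representatives Φ Y}
      (≈ᴹ-sym (≈ᴹ-trans z≈ (*ₗ-congˡ (vec-f x))))
      (cone-* {representatives Φ Y} (proj₁ 0<c)
        (cone-map {representatives Φ X} {representatives Φ Y} F F-cong F-+ F-*
          (λ { (r , r∈X , a≈r) → cone-resp {representatives Φ Y}
            (≈ᴹ-trans (vec-f r) (F-cong (≈ᴹ-sym a≈r)))
            (cone∈-generator Y (f r) (f r , (r , r∈X , ∼-refl {f r}) , ∼-refl {f r})) })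
          (coneΦ⁻ X x x∈))))

    from : coneΦ Φ Y ⊆ image f (coneΦ Φ X)
    from {z} z∈ = f (g z) , (g z , coneΦ⁺ X (g z) Cgz , ∼-refl {f (g z)}) , 1# , 0<1 ,
      ≈ᴹ-sym (≈ᴹ-trans (*ₗ-identityˡ _) (≈ᴹ-trans (vec-f (g z)) (≈ᴹ-trans (F-cong (vec-g z)) (F∘G (vec z)))))
      where
      Cgz : Cone∈ X (vec (g z))
      Cgz = cone-resp {representatives Φ X} (≈ᴹ-sym (vec-g z))
        (cone-map {representatives Φ Y} {representatives Φ X} G G-cong G-+ G-*
          (λ { (r , (y , (x , x∈X , y∼fx) , r∼y) , a≈r) →
            let c , 0<c , r≈ = ∼-trans {r} {y} {f x} r∼y y∼fx
            in cone-resp {representatives Φ X}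
              (≈ᴹ-sym (≈ᴹ-trans (G-cong (≈ᴹ-trans a≈r (≈ᴹ-trans r≈ (*ₗ-congˡ (vec-f x)))))
                (≈ᴹ-trans (G-* c (F (vec x))) (*ₗ-congˡ (G∘F (vec x))))))
              (cone-* {representatives Φ X} (proj₁ 0<c) (cone∈-generator X x x∈X)) })
          (coneΦ⁻ Y z z∈))

  neg-symmetry : Symmetry (neg Φ)
  neg-symmetry = record
    { F = -ᴹ_ ; G = -ᴹ_ ; F-cong = -ᴹ‿cong ; G-cong = -ᴹ‿cong
    ; F-+ = neg-+ ; G-+ = neg-+ ; F-* = neg-* ; G-* = neg-*
    ; G∘F = -ᴹ-involutive ; F∘G = -ᴹ-involutive ; g = neg Φ
    ; vec-f = λ _ → ≈ᴹ-refl ; vec-g = λ _ → ≈ᴹ-refl }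
    where
    -ᴹ-involutive : ∀ v → -ᴹ (-ᴹ v) ≈ᴹ v
    -ᴹ-involutive v = by-coefficients (⊝ ⊝ var zero) (var zero) (v ∷ [])
      (λ { zero → solve 0 (:- (:- con 1ℤ) := con 1ℤ) refl })
    neg-+ : ∀ u v → -ᴹ (u +ᴹ v) ≈ᴹ -ᴹ u +ᴹ -ᴹ v
    neg-+ u v = by-coefficients (⊝ (var zero ⊕ var (suc zero))) (⊝ var zero ⊕ ⊝ var (suc zero)) (u ∷ v ∷ [])
      (λ { zero → solve 0 (:- (con 1ℤ :+ con 0ℤ) := :- con 1ℤ :+ :- con 0ℤ) refl
         ; (suc zero) → solve 0 (:- (con 0ℤ :+ con 1ℤ) := :- con 0ℤ :+ :- con 1ℤ) refl })
    neg-* : ∀ c v → -ᴹ (c *ₗ v) ≈ᴹ c *ₗ (-ᴹ v)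
    neg-* c v = by-coefficients (⊝ (c ⊛ var zero)) (c ⊛ ⊝ var zero) (v ∷ [])
      (λ { zero → solve 1 (λ c → :- (c :* con 1ℤ) := c :* (:- con 1ℤ)) refl c })

  open Symmetry neg-symmetry using () renaming (F-+ to neg-+; F-* to neg-*; G∘F to -ᴹ-involutive) public

  ·-symmetry : ∀ w → Symmetry (_·_ Φ w)
  ·-symmetry w = record
    { F = act w ; G = act (reverse w) ; F-cong = act-cong w ; G-cong = act-cong (reverse w)
    ; F-+ = act-+ w ; G-+ = act-+ (reverse w) ; F-* = act-* w ; G-* = act-* (reverse w)
    ; G∘F = act-reverse w ; F∘G = act-reverse′ w ; g = _·_ Φ (reverse w)
    ; vec-f = λ _ → ≈ᴹ-refl ; vec-g = λ _ → ≈ᴹ-refl }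

  -- All summands on the ray of `z` are collected into one nonnegative coefficient.
  cone∈-insert : ∀ X z {v} → Cone∈ (X ∪ ⁅ z ⁆) v →
                 ∃₂ λ u c → Cone∈ X u × 0# ≤ c × v ≈ᴹ u +ᴹ c *ₗ vec z
  cone∈-insert X z = cone-elim {representatives Φ (X ∪ ⁅ z ⁆)} Q
    (λ { v≈v′ (u , c , Cu , 0≤c , v≈) → u , c , Cu , 0≤c , ≈ᴹ-trans (≈ᴹ-sym v≈v′) v≈ })
    (0ᴹ , 0# , cone-0 {representatives Φ X} , ≤-refl ,
      ≈ᴹ-sym (≈ᴹ-trans (+ᴹ-identityˡ _) (*ₗ-zeroˡ (vec z))))
    step
    where
    Q : Pred Carrierᴹ 0ℓ
    Q v = ∃₂ λ u c → Cone∈ X u × 0# ≤ c × v ≈ᴹ u +ᴹ c *ₗ vec z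

    step : ∀ {c a v} → 0# ≤ c → representatives Φ (X ∪ ⁅ z ⁆) a → Q v → Q (c *ₗ a +ᴹ v)
    step {c} {a} {v} 0≤c (r , inj₁ r∈X , a≈r) (u , d , Cu , 0≤d , v≈) =
      c *ₗ a +ᴹ u , d , cone-∷ {representatives Φ X} 0≤c (r , r∈X , a≈r) Cu , 0≤d ,
      ≈ᴹ-trans (+ᴹ-congˡ v≈) (≈ᴹ-sym (+ᴹ-assoc (c *ₗ a) u (d *ₗ vec z)))
    step {c} {a} {v} 0≤c (r , inj₂ (here (e , 0<e , r≈)) , a≈r) (u , d , Cu , 0≤d , v≈) =
      u , c * e + d , Cu , 0≤-+ (*-nonNeg 0≤c (proj₁ 0<e)) 0≤d ,
      ≈ᴹ-trans (+ᴹ-cong (*ₗ-congˡ (≈ᴹ-trans a≈r r≈)) v≈)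
        (by-coefficients (c ⊛ (e ⊛ var (suc zero)) ⊕ (var zero ⊕ d ⊛ var (suc zero)))
                         (var zero ⊕ (c * e + d) ⊛ var (suc zero)) (u ∷ vec z ∷ [])
          (λ { zero → solve 3 (λ c e d → c :* (e :* con 0ℤ) :+ (con 1ℤ :+ d :* con 0ℤ)
                        := con 1ℤ :+ (c :* e :+ d) :* con 0ℤ) refl c e d
             ; (suc zero) → solve 3 (λ c e d → c :* (e :* con 1ℤ) :+ (con 0ℤ :+ d :* con 1ℤ)
                        := con 0ℤ :+ (c :* e :+ d) :* con 1ℤ) refl c e d }))

  cone∈-remove : ∀ X y {v} → Cone∈ X v → Cone∈ ((X ∖ ⁅ y ⁆) ∪ ⁅ y ⁆) v
  cone∈-remove X y = cone∈-mono X ((X ∖ ⁅ y ⁆) ∪ ⁅ y ⁆) (λ {x} x∈X → split x x∈X em)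
    where
    split : ∀ x → x ∈ X → Dec (x ∈ ⁅ y ⁆) → x ∈ (X ∖ ⁅ y ⁆) ∪ ⁅ y ⁆
    split x x∈X (yes p) = inj₂ p
    split x x∈X (no ¬p) = inj₁ (x∈X , ¬p)

  -- An equation x = u - c x with c ≥ 0 is solved by x = u / (1 + c).
  coneΦ-opposite : ∀ X x → x ∈ coneΦ Φ (X ∪ ⁅ neg Φ x ⁆) → x ∈ coneΦ Φ X
  coneΦ-opposite X x x∈ = solved (cone∈-insert X (neg Φ x) (coneΦ⁻ (X ∪ ⁅ neg Φ x ⁆) x x∈))
    where
    solved : (∃₂ λ u c → Cone∈ X u × 0# ≤ c × vec x ≈ᴹ u +ᴹ c *ₗ (-ᴹ vec x)) → x ∈ coneΦ Φ X
    solved (u , c , Cu , 0≤c , x≈) = coneΦ⁺ X x (cone-resp {representatives Φ X}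
      (≈ᴹ-sym (*ₗ-cancel 0<1+c (≈ᴹ-trans
        (by-coefficients ((1# + c) ⊛ var zero) (var zero ⊕ c ⊛ var zero) (vec x ∷ [])
          (λ { zero → solve 1 (λ c → (con 1ℤ :+ c) :* con 1ℤ := con 1ℤ :+ c :* con 1ℤ) refl c }))
        (≈ᴹ-trans (+ᴹ-congʳ x≈)
          (by-coefficients ((var zero ⊕ c ⊛ ⊝ var (suc zero)) ⊕ c ⊛ var (suc zero)) (var zero) (u ∷ vec x ∷ [])
            (λ { zero → solve 1 (λ c → (con 1ℤ :+ c :* (:- con 0ℤ)) :+ c :* con 0ℤ := con 1ℤ) refl c
               ; (suc zero) → solve 1 (λ c → (con 0ℤ :+ c :* (:- con 1ℤ)) :+ c :* con 1ℤ := con 0ℤ) refl c }))))))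
      (cone-* {representatives Φ X} (proj₁ (⁻¹-positive 0<1+c)) Cu))
      where
      0<1+c : 0# < 1# + c
      0<1+c = 0<-+ 0<1 0≤c

  private
    module Exchange (X : Subset) (x y : Root Φ) (x∉ : x ∉ coneΦ Φ X)
      (u : Carrierᴹ) (c : Carrier) (Cu : Cone∈ X u) (0≤c : 0# ≤ c)
      (x≈ : vec x ≈ᴹ u +ᴹ c *ₗ (-ᴹ vec y))
      (u′ : Carrierᴹ) (d : Carrier) (Cu′ : Cone∈ (X ∖ ⁅ y ⁆) u′)
      (u≈ : u ≈ᴹ u′ +ᴹ d *ₗ vec y) where
      Z = (X ∖ ⁅ y ⁆) ∪ ⁅ neg Φ x ⁆

      Cu′Z : Cone∈ Z u′
      Cu′Z = cone∈-mono (X ∖ ⁅ y ⁆) Z inj₁ Cu′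

      Cu′X : Cone∈ X u′
      Cu′X = cone∈-mono (X ∖ ⁅ y ⁆) X proj₁ Cu′

      x≈′ : vec x ≈ᴹ u′ +ᴹ (- (c + - d)) *ₗ vec y
      x≈′ = ≈ᴹ-trans x≈ (≈ᴹ-trans (+ᴹ-congʳ u≈)
        (by-coefficients ((var zero ⊕ d ⊛ var (suc zero)) ⊕ c ⊛ ⊝ var (suc zero))
                         (var zero ⊕ (- (c + - d)) ⊛ var (suc zero)) (u′ ∷ vec y ∷ [])
          (λ { zero → solve 2 (λ c d → (con 1ℤ :+ d :* con 0ℤ) :+ c :* (:- con 0ℤ)
                         := con 1ℤ :+ (:- (c :+ :- d)) :* con 0ℤ) refl c d
             ; (suc zero) → solve 2 (λ c d → (con 0ℤ :+ d :* con 1ℤ) :+ c :* (:- con 1ℤ)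
                         := con 0ℤ :+ (:- (c :+ :- d)) :* con 1ℤ) refl c d })))

      solved : 0# < c + - d → Cone∈ Z (vec y)
      solved 0<e = cone-resp {representatives Φ Z}
        (≈ᴹ-sym (*ₗ-cancel 0<e (≈ᴹ-trans
          (by-coefficients ((c + - d) ⊛ var (suc zero))
                           ((⊝ (var zero ⊕ (- (c + - d)) ⊛ var (suc zero))) ⊕ var zero) (u′ ∷ vec y ∷ [])
            (λ { zero → solve 1 (λ e → e :* con 0ℤ := (:- (con 1ℤ :+ (:- e) :* con 0ℤ)) :+ con 1ℤ) refl (c + - d)
               ; (suc zero) → solve 1 (λ e → e :* con 1ℤ := (:- (con 0ℤ :+ (:- e) :* con 1ℤ)) :+ con 0ℤ) refl (c + - d) }))
          (+ᴹ-congʳ (-ᴹ‿cong (≈ᴹ-sym x≈′))))))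
        (cone-* {representatives Φ Z} (proj₁ (⁻¹-positive 0<e))
          (cone-+ {representatives Φ Z}
            (cone∈-generator Z (neg Φ x) (inj₂ (here (∼-refl {neg Φ x})))) Cu′Z))

      -- Here x = u′ - (c - d) y, with `u′` generated away from `y`. For c > d this is solved for
      -- `y`. For c = d, or c < d with `y` in `X`, it would put `x` into the cone of `X`. If `y` is
      -- not in `X`, its deletion changes nothing, and x = u - c y is solved for `y` instead.
      conclude : Dec (y ∈ X) → 0# < c + - d ⊎ c + - d ≈ 0# ⊎ 0# < - (c + - d) → y ∈ coneΦ Φ Z
      conclude _ (inj₁ 0<e) = coneΦ⁺ Z y (solved 0<e)
      conclude _ (inj₂ (inj₁ e≈0)) = ⊥-elim (x∉ (coneΦ⁺ X x (cone-resp {representatives Φ X}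
        (≈ᴹ-sym (≈ᴹ-trans x≈′ (≈ᴹ-trans (+ᴹ-congˡ (≈ᴹ-trans
          (*ₗ-congʳ (trans (-‿cong e≈0) (solve 0 (:- con 0ℤ := con 0ℤ) refl))) (*ₗ-zeroˡ (vec y))))
          (+ᴹ-identityʳ u′)))) Cu′X)))
      conclude (yes y∈X) (inj₂ (inj₂ 0<-e)) = ⊥-elim (x∉ (coneΦ⁺ X x (cone-resp {representatives Φ X}
        (≈ᴹ-sym x≈′) (cone-+ {representatives Φ X} Cu′X
          (cone-* {representatives Φ X} (proj₁ 0<-e) (cone∈-generator X y y∈X))))))
      conclude (no y∉X) (inj₂ (inj₂ 0<-e)) with 0≤-split 0≤c
      ... | inj₁ c≈0 = ⊥-elim (x∉ (coneΦ⁺ X x (cone-resp {representatives Φ X}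
        (≈ᴹ-sym (≈ᴹ-trans x≈ (≈ᴹ-trans (+ᴹ-congˡ (≈ᴹ-trans (*ₗ-congʳ c≈0) (*ₗ-zeroˡ _))) (+ᴹ-identityʳ u)))) Cu)))
      ... | inj₂ 0<c = coneΦ⁺ Z y (cone-resp {representatives Φ Z}
        (≈ᴹ-sym (*ₗ-cancel 0<c (≈ᴹ-trans
          (by-coefficients (c ⊛ var (suc zero))
                           ((⊝ (var zero ⊕ c ⊛ ⊝ var (suc zero))) ⊕ var zero) (u ∷ vec y ∷ [])
            (λ { zero → solve 1 (λ e → e :* con 0ℤ := (:- (con 1ℤ :+ e :* (:- con 0ℤ))) :+ con 1ℤ) refl c
               ; (suc zero) → solve 1 (λ e → e :* con 1ℤ := (:- (con 0ℤ :+ e :* (:- con 1ℤ))) :+ con 0ℤ) refl c }))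
          (+ᴹ-congʳ (-ᴹ‿cong (≈ᴹ-sym x≈))))))
        (cone-* {representatives Φ Z} (proj₁ (⁻¹-positive 0<c))
          (cone-+ {representatives Φ Z}
            (cone∈-generator Z (neg Φ x) (inj₂ (here (∼-refl {neg Φ x}))))
            (cone∈-mono X Z (λ {r} r∈X → inj₁ (r∈X , λ { (here r∼y) → y∉X (resp X {r} {y} r∼y r∈X) })) Cu))))

  coneΦ-exchange : ∀ X x y → x ∈ coneΦ Φ (X ∪ ⁅ neg Φ y ⁆) → x ∉ coneΦ Φ X →
                   y ∈ coneΦ Φ ((X ∖ ⁅ y ⁆) ∪ ⁅ neg Φ x ⁆)
  coneΦ-exchange X x y x∈ x∉ =
    let u , c , Cu , 0≤c , x≈ = cone∈-insert X (neg Φ y) (coneΦ⁻ (X ∪ ⁅ neg Φ y ⁆) x x∈)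
        u′ , d , Cu′ , 0≤d , u≈ = cone∈-insert (X ∖ ⁅ y ⁆) y (cone∈-remove X y Cu)
    in Exchange.conclude X x y x∉ u c Cu 0≤c x≈ u′ d Cu′ u≈ em (sign (c + - d))

  coneΦ-finitary : ∀ X x → x ∈ coneΦ Φ X → ∃[ ys ] (fromList ys ⊆ X × x ∈ coneΦ Φ (fromList ys))
  coneΦ-finitary X x x∈ = conclude (cone-elim {representatives Φ X}
    (λ v → ∃[ ys ] (fromList ys ⊆ X × Cone∈ (fromList ys) v))
    (λ { u≈v (ys , ys⊆ , C) → ys , (λ {z} → ys⊆ {z}) , cone-resp {representatives Φ (fromList ys)} u≈v C })
    ([] , (λ ()) , cone-0 {representatives Φ ∅})
    (λ { {c} {a} 0≤c (r , r∈X , a≈r) (ys , ys⊆ , C) → r ∷ ys ,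
         (λ { {z} (here z∼r) → resp X {r} {z} (∼-sym {z} {r} z∼r) r∈X ; {z} (there p) → ys⊆ {z} p }) ,
         cone-∷ {representatives Φ (fromList (r ∷ ys))} 0≤c (r , here (∼-refl {r}) , a≈r)
           (cone∈-mono (fromList ys) (fromList (r ∷ ys)) there C) })
    (coneΦ⁻ X x x∈))
    where
    conclude : ∃[ ys ] (fromList ys ⊆ X × Cone∈ (fromList ys) (vec x)) →
               ∃[ ys ] (fromList ys ⊆ X × x ∈ coneΦ Φ (fromList ys))
    conclude (ys , ys⊆ , C) = ys , (λ {z} → ys⊆ {z}) , coneΦ⁺ (fromList ys) x C

  neg-fixedPointFree : ∀ x → ¬ (_∼_ Φ (neg Φ x) x)
  neg-fixedPointFree x (c , 0<c , -x≈cx) = root≉0 x (*ₗ-cancel-0 (0<⇒≉0 (0<-+ 0<1 (proj₁ 0<c)))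
    (≈ᴹ-trans (*ₗ-distribʳ (vec x) 1# c) (≈ᴹ-trans
      (+ᴹ-cong (*ₗ-identityˡ (vec x)) (≈ᴹ-sym -x≈cx)) (-ᴹ‿inverseʳ (vec x)))))

  coneΦ-isOrientedMatroid : IsOrientedMatroid (neg Φ) (coneΦ Φ)
  coneΦ-isOrientedMatroid = record
    { *-cong            = λ { {x} {y} (c , 0<c , x≈cy) →
        c , 0<c , ≈ᴹ-trans (-ᴹ‿cong x≈cy) (neg-* c (vec y)) }
    ; *-involutive      = λ x → 1# , 0<1 , ≈ᴹ-trans (-ᴹ-involutive (vec x)) (≈ᴹ-sym (*ₗ-identityˡ (vec x)))
    ; *-fixedPointFree  = neg-fixedPointFree
    ; isClosureOperator = coneΦ-isClosureOperator
    ; cx-*              = image-coneΦ neg-symmetry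
    ; cx-opposite       = coneΦ-opposite
    ; cx-exchange       = coneΦ-exchange
    ; cx-finitary       = coneΦ-finitary
    }

  coneΦ-isReduced : IsReduced (coneΦ Φ)
  coneΦ-isReduced = record
    { cx-∅  = (λ {x} x∈ → ⊥-elim (root≉0 x (cone-elim {representatives Φ ∅} (_≈ᴹ 0ᴹ)
        (λ u≈v u≈0 → ≈ᴹ-trans (≈ᴹ-sym u≈v) u≈0) ≈ᴹ-refl (λ { _ (_ , () , _) _ }) (coneΦ⁻ ∅ x x∈)))) ,
        (λ ())
    ; cx-⁅⁆ = λ x → (λ {y} y∈ → ray x y (coneΦ⁻ ⁅ x ⁆ y y∈)) ,
        (λ {y} y∈ → coneΦ⁺ ⁅ x ⁆ y (cone∈-generator ⁅ x ⁆ y y∈))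
    }
    where
    ray : ∀ x y → Cone∈ ⁅ x ⁆ (vec y) → y ∈ ⁅ x ⁆
    ray x y C = conclude (cone-elim {representatives Φ ⁅ x ⁆} (λ v → ∃[ c ] (0# ≤ c × v ≈ᴹ c *ₗ vec x))
      (λ { u≈v (c , 0≤c , u≈) → c , 0≤c , ≈ᴹ-trans (≈ᴹ-sym u≈v) u≈ })
      (0# , ≤-refl , ≈ᴹ-sym (*ₗ-zeroˡ (vec x)))
      (λ { {c} {a} {v} 0≤c (r , here (e , 0<e , r≈) , a≈r) (d , 0≤d , v≈) →
           c * e + d , 0≤-+ (*-nonNeg 0≤c (proj₁ 0<e)) 0≤d ,
           ≈ᴹ-trans (+ᴹ-cong (≈ᴹ-trans (*ₗ-congˡ (≈ᴹ-trans a≈r r≈)) (≈ᴹ-sym (*ₗ-assoc c e (vec x)))) v≈)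
                    (≈ᴹ-sym (*ₗ-distribʳ (vec x) (c * e) d)) })
      C)
      where
      conclude : ∃[ c ] (0# ≤ c × vec y ≈ᴹ c *ₗ vec x) → y ∈ ⁅ x ⁆
      conclude (c , 0≤c , y≈) with 0≤-split 0≤c
      ... | inj₁ c≈0 = ⊥-elim (root≉0 y (≈ᴹ-trans y≈ (≈ᴹ-trans (*ₗ-congʳ c≈0) (*ₗ-zeroˡ (vec x)))))
      ... | inj₂ 0<c = here (c , 0<c , y≈)

  coneΦ-isOMRS : IsOMRS Φ (coneΦ Φ)
  coneΦ-isOMRS = record
    { isOrientedMatroid = coneΦ-isOrientedMatroid
    ; isReduced         = coneΦ-isReduced
    ; equivariant       = λ w X → let p , q = image-coneΦ (·-symmetry w) X
                                  in (λ {z} → q {z}) , (λ {z} → p {z})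
    ; d-Φ̄⁺              = (λ {x} x∈ → x , cone-bind {representatives Φ (Φ̄⁺ Φ)} {Π}
        (λ { (r , (y , Cy , c , 0<c , r≈) , a≈r) →
             cone-resp {Π} (≈ᴹ-sym (≈ᴹ-trans a≈r r≈)) (cone-* {Π} (proj₁ 0<c) Cy) })
        (coneΦ⁻ (Φ̄⁺ Φ) x x∈) , ∼-refl {x}) ,
        (λ {x} x∈ → coneΦ⁺ (Φ̄⁺ Φ) x (cone∈-generator (Φ̄⁺ Φ) x x∈))
    ; d-planar          = λ X k k≤2 _ → (λ x∈ → x∈) , (λ x∈ → x∈)
    }

-- Uniqueness for root systems with integral coordinates.

module Uniqueness (em : ExcludedMiddle 0ℓ) {K : CompleteOrderedField} {T : Trigonometry K}
                  {V : Module (CompleteOrderedField.commutativeRing K) 0ℓ 0ℓ}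
                  {rank : ℕ} (Φ : RootSystem T V rank) where
  open CompleteOrderedField K hiding (zero)
  open OrderedFieldProperties K
  open IntegerEmbedding K
  open Solver using (solve; _:=_; _:+_; _:*_; :-_; _:-_; con)
  open OrderedField em K
  open Module V
  open LinearAlgebra K V
  open LinearExpressions K V
  open Cones em K V
  open RootSystem Φ
  open Roots em Φ
  open Root using (vec)
  open Subsets (Φ̄ Φ)
  open Setoid (Φ̄ Φ) using () renaming (refl to ∼-refl; sym to ∼-sym; trans to ∼-trans)

  private
    infix 4 _∼′_
    _∼′_ = _∼_ Φ

  module Triples (e₁ e₂ δ : Carrierᴹ) where
    lin : Carrier → Carrier → Carrier → Carrierᴹ
    lin x y z = x *ₗ e₁ +ᴹ (y *ₗ e₂ +ᴹ z *ₗ δ)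

    lin-cong : ∀ {x y z x′ y′ z′} → x ≈ x′ → y ≈ y′ → z ≈ z′ → lin x y z ≈ᴹ lin x′ y′ z′
    lin-cong p q r = +ᴹ-cong (*ₗ-congʳ p) (+ᴹ-cong (*ₗ-congʳ q) (*ₗ-congʳ r))

    lin-+ : ∀ x y z x′ y′ z′ → lin (x + x′) (y + y′) (z + z′) ≈ᴹ lin x y z +ᴹ lin x′ y′ z′
    lin-+ x y z x′ y′ z′ = ≈ᴹ-trans
      (+ᴹ-cong (*ₗ-distribʳ e₁ x x′) (+ᴹ-cong (*ₗ-distribʳ e₂ y y′) (*ₗ-distribʳ δ z z′)))
      (≈ᴹ-trans (+ᴹ-congˡ (interchange _ _ _ _)) (interchange _ _ _ _))

    lin-* : ∀ c x y z → lin (c * x) (c * y) (c * z) ≈ᴹ c *ₗ lin x y z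
    lin-* c x y z = ≈ᴹ-sym (≈ᴹ-trans (*ₗ-distribˡ c _ _)
      (+ᴹ-cong (≈ᴹ-sym (*ₗ-assoc c x e₁)) (≈ᴹ-trans (*ₗ-distribˡ c _ _)
        (+ᴹ-cong (≈ᴹ-sym (*ₗ-assoc c y e₂)) (≈ᴹ-sym (*ₗ-assoc c z δ))))))

    lin-0 : lin 0# 0# 0# ≈ᴹ 0ᴹ
    lin-0 = ≈ᴹ-trans (+ᴹ-cong (*ₗ-zeroˡ e₁) (≈ᴹ-trans (+ᴹ-cong (*ₗ-zeroˡ e₂) (*ₗ-zeroˡ δ)) (+ᴹ-identityˡ 0ᴹ)))
      (+ᴹ-identityˡ 0ᴹ)

    lin-neg : ∀ x y z → lin (- x) (- y) (- z) ≈ᴹ -ᴹ lin x y z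
    lin-neg x y z = inverseʳ-uniqueᴹ (lin x y z) (lin (- x) (- y) (- z)) (≈ᴹ-trans
      (≈ᴹ-sym (lin-+ x y z (- x) (- y) (- z)))
      (≈ᴹ-trans (lin-cong (-‿inverseʳ x) (-‿inverseʳ y) (-‿inverseʳ z)) lin-0))
      where open import Algebra.Module.Properties V using (inverseʳ-uniqueᴹ)

  -- By `el` and `cover` the rays of roots are those of the integral elements. The scalars ρ remain
  -- because the representatives of rays are not normalised.
  record Coordinates (D : Directions) : Set where
    open Directions D using (Element; X; Y; Z)
    field
      e₁ e₂ δ     : Carrierᴹ

    open Triples e₁ e₂ δ public

    C : Element → Carrierᴹ
    C p = lin (ι (X p)) (ι (Y p)) (ι (Z p))

    field
      independent : ∀ x y z → lin x y z ≈ᴹ 0ᴹ → x ≈ 0# × y ≈ 0# × z ≈ 0#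
      el          : Element → Root Φ
      el-vec      : ∀ p → ∃[ ρ ] (0# < ρ × vec (el p) ≈ᴹ ρ *ₗ C p)
      cover       : ∀ (r : Root Φ) → ∃₂ λ p ρ → 0# < ρ × vec r ≈ᴹ ρ *ₗ C p

  module InCoordinates {D : Directions} (coordinates : Coordinates D) where
    open Directions D renaming (neg to negᴱ)
    open Coordinates coordinates
    open Comparison D
    lin-injective : ∀ {x y z x′ y′ z′} → lin x y z ≈ᴹ lin x′ y′ z′ → x ≈ x′ × y ≈ y′ × z ≈ z′
    lin-injective {x} {y} {z} {x′} {y′} {z′} eq =
      let p , q , r = independent (x + - x′) (y + - y′) (z + - z′)
            (≈ᴹ-trans (lin-+ x y z (- x′) (- y′) (- z′))
              (≈ᴹ-trans (+ᴹ-cong eq (lin-neg x′ y′ z′)) (-ᴹ‿inverseʳ _)))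
      in close p , close q , close r
      where
      close : ∀ {a b} → a + - b ≈ 0# → a ≈ b
      close {a} {b} e = trans (solve 2 (λ a b → a := (a :+ :- b) :+ b) refl a b)
        (trans (+-congʳ e) (+-identityˡ b))

    C-neg : ∀ p → C (negᴱ p) ≈ᴹ -ᴹ C p
    C-neg p@(i , k) = ≈ᴹ-trans (lin-cong (trans (reflexive (≡.cong ι (dx-opp i))) (ι-neg (X p)))
                                 (trans (reflexive (≡.cong ι (dy-opp i))) (ι-neg (Y p))) (ι-neg k))
                       (lin-neg (ι (X p)) (ι (Y p)) (ι (Z p)))

    C-el : ∀ p → ∃[ ρ ] (0# < ρ × C p ≈ᴹ ρ *ₗ vec (el p))
    C-el p = let ρ , 0<ρ , eq = el-vec p in ρ ⁻¹ , ⁻¹-positive 0<ρ , *ₗ-cancel 0<ρ (≈ᴹ-sym eq)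

    ∼-el : ∀ {r p ρ} → 0# < ρ → vec r ≈ᴹ ρ *ₗ C p → r ∼′ el p
    ∼-el {r} {p} {ρ} 0<ρ eq = let σ , 0<σ , eq′ = C-el p in
      ρ * σ , *-positive 0<ρ 0<σ , ≈ᴹ-trans eq (≈ᴹ-trans (*ₗ-congˡ eq′) (≈ᴹ-sym (*ₗ-assoc ρ σ _)))

    el-neg : ∀ p → neg Φ (el p) ∼′ el (negᴱ p)
    el-neg p = let ρ , 0<ρ , eq = el-vec p in
      ∼-el {neg Φ (el p)} {negᴱ p} 0<ρ (≈ᴹ-trans (-ᴹ‿cong eq)
        (≈ᴹ-trans (neg-* ρ (C p)) (*ₗ-congˡ (≈ᴹ-sym (C-neg p)))))

    set : List Element → Subset
    set L = fromList (map el L)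

    set⁺ : ∀ L q → q ListMem.∈ L → el q ∈ set L
    set⁺ (_ ∷ _) q (here ≡.refl) = here (∼-refl {el q})
    set⁺ (_ ∷ L) q (there q∈L)   = there (set⁺ L q q∈L)

    set⁻ : ∀ L r → r ∈ set L → ∃[ q ] (q ListMem.∈ L × r ∼′ el q)
    set⁻ (q ∷ L) r (here r∼q)  = q , here ≡.refl , r∼q
    set⁻ (q ∷ L) r (there r∈L) = let q′ , q′∈L , r∼q′ = set⁻ L r r∈L in q′ , there q′∈L , r∼q′

    module _ {cx : Operator} (M : IsOrientedMatroid (neg Φ) cx) where
      open IsOrientedMatroid M hiding (*-cong)
      open IsClosureOperator isClosureOperator

      -- Each axiom transfers by monotonicity, once negation, insertion and deletion on lists are
      -- compared with the corresponding operations on sets of rays.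
      entailment : Entailment Element negᴱ
      entailment = record
        { _⊢_      = λ L p → el p ∈ cx (set L)
        ; ⊢-∈      = λ {L} {p} p∈L → extensive (set L) (set⁺ L p p∈L)
        ; ⊢-cut    = λ {L} {M} {p} f h → proj₁ (idempotent (set L)) (monotone {set M} {cx (set L)}
            (λ {r} r∈M → let q , q∈M , r∼q = set⁻ M r r∈M
                         in resp (cx (set L)) {el q} {r} (∼-sym {r} {el q} r∼q) (f q∈M)) h)
        ; ⊢-neg    = λ {L} {p} h → resp (cx (set (map negᴱ L))) {neg Φ (el p)} {el (negᴱ p)} (el-neg p)
            (monotone {image (neg Φ) (set L)} {set (map negᴱ L)} (λ {r} → image-neg L {r})
              (proj₁ (cx-* (set L)) (neg Φ (el p) , (el p , h , ∼-refl {neg Φ (el p)}) , ∼-refl {neg Φ (el p)})))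
        ; ⊢-opp    = λ {L} {p} h → cx-opposite (set L) (el p)
            (monotone {set (negᴱ p ∷ L)} {set L ∪ ⁅ neg Φ (el p) ⁆} (λ {r} → insert L p {r}) h)
        ; ⊢-exch   = λ {L} {Q} {x} {y} f h ¬h → monotone
            {(set L ∖ ⁅ el y ⁆) ∪ ⁅ neg Φ (el x) ⁆} {set (negᴱ x ∷ Q)} (λ {r} → removed L Q x y f {r})
            (cx-exchange (set L) (el x) (el y)
              (monotone {set (negᴱ y ∷ L)} {set L ∪ ⁅ neg Φ (el y) ⁆} (λ {r} → insert L y {r}) h) ¬h)
        ; neg-invo = neg-neg
        ; ⊢-dec    = λ L p → em
        }
        where
        neg-cong : ∀ {x y} → x ∼′ y → neg Φ x ∼′ neg Φ y
        neg-cong {x} {y} = IsOrientedMatroid.*-cong M {x} {y}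

        image-neg : ∀ L → image (neg Φ) (set L) ⊆ set (map negᴱ L)
        image-neg L {z} (y , (x , x∈L , y∼-x) , z∼y) = found
          where
          q = proj₁ (set⁻ L x x∈L)
          z∼q : z ∼′ el (negᴱ q)
          z∼q = ∼-trans {z} {y} {el (negᴱ q)} z∼y (∼-trans {y} {neg Φ x} {el (negᴱ q)} y∼-x
            (∼-trans {neg Φ x} {neg Φ (el q)} {el (negᴱ q)} (neg-cong {x} {el q} (proj₂ (proj₂ (set⁻ L x x∈L)))) (el-neg q)))
          found : z ∈ set (map negᴱ L)
          found = resp (set (map negᴱ L)) {el (negᴱ q)} {z} (∼-sym {z} {el (negᴱ q)} z∼q)
            (set⁺ (map negᴱ L) (negᴱ q) (∈-map⁺ negᴱ (proj₁ (proj₂ (set⁻ L x x∈L)))))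

        insert : ∀ L p → set (negᴱ p ∷ L) ⊆ set L ∪ ⁅ neg Φ (el p) ⁆
        insert L p {r} (here r∼)  = inj₂ (here (∼-trans {r} {el (negᴱ p)} {neg Φ (el p)} r∼
          (∼-sym {neg Φ (el p)} {el (negᴱ p)} (el-neg p))))
        insert L p (there r∈) = inj₁ r∈

        removed : ∀ L Q x y → (∀ {q} → q ListMem.∈ L → q ≡ y ⊎ q ListMem.∈ Q) →
                  (set L ∖ ⁅ el y ⁆) ∪ ⁅ neg Φ (el x) ⁆ ⊆ set (negᴱ x ∷ Q)
        removed L Q x y f {r} (inj₂ (here r∼)) = here (∼-trans {r} {neg Φ (el x)} {el (negᴱ x)} r∼ (el-neg x))
        removed L Q x y f {r} (inj₁ (r∈L , r∉y)) = keep (set⁻ L r r∈L)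
          where
          keep : ∃[ q ] (q ListMem.∈ L × r ∼′ el q) → r ∈ set (negᴱ x ∷ Q)
          keep (q , q∈L , r∼q) with f q∈L
          ... | inj₁ ≡.refl = ⊥-elim (r∉y (here r∼q))
          ... | inj₂ q∈Q    = there (resp (set Q) {el q} {r} (∼-sym {r} {el q} r∼q) (set⁺ Q q q∈Q))

    private
      combo : List (ℤ × Element) → Carrierᴹ
      combo ps = lin (ι (weighted X ps)) (ι (weighted Y ps)) (ι (weighted Z ps))

      combo-∷ : ∀ n q ps → combo ((n , q) ∷ ps) ≈ᴹ ι n *ₗ C q +ᴹ combo ps
      combo-∷ n q ps = ≈ᴹ-trans (lin-cong (expand (X q) (weighted X ps)) (expand (Y q) (weighted Y ps)) (expand (Z q) (weighted Z ps)))
        (≈ᴹ-trans (lin-+ _ _ _ _ _ _) (+ᴹ-congʳ (lin-* (ι n) _ _ _)))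
        where
        expand : ∀ x w → ι (n Int.* x Int.+ w) ≈ ι n * ι x + ι w
        expand x w = trans (ι-+ (n Int.* x) w) (+-congʳ (ι-* n x))

      cone-C : ∀ {L q c} → 0# ≤ c → q ListMem.∈ L → Cone∈ (set L) (c *ₗ C q)
      cone-C {L} {q} {c} 0≤c q∈L = let ρ , 0<ρ , eq = C-el q in
        cone-resp {representatives Φ (set L)} (*ₗ-congˡ (≈ᴹ-sym eq))
          (cone-* {representatives Φ (set L)} 0≤c (cone-* {representatives Φ (set L)} (proj₁ 0<ρ)
            (cone∈-generator (set L) (el q) (set⁺ L q q∈L))))

      cone-combo : ∀ ps → Cone∈ (set (map orient ps)) (combo ps)
      cone-combo [] = cone-resp {representatives Φ ∅} (≈ᴹ-sym lin-0) (cone-0 {representatives Φ ∅})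
      cone-combo (p@(n , q) ∷ ps) = cone-resp {representatives Φ S} (≈ᴹ-sym (combo-∷ n q ps))
        (cone-+ {representatives Φ S} (first n)
          (cone∈-mono (set (map orient ps)) S there (cone-combo ps)))
        where
        S = set (map orient (p ∷ ps))
        first : ∀ n → Cone∈ (set (map orient ((n , q) ∷ ps))) (ι n *ₗ C q)
        first n@(+ _)    = cone-C {map orient ((n , q) ∷ ps)} (0≤ι {n} (Int.+≤+ ℕ.z≤n)) (here ≡.refl)
        first n@(-[1+ k ]) = cone-resp {representatives Φ (set (map orient ((n , q) ∷ ps)))}
          (≈ᴹ-trans (*ₗ-congˡ (C-neg q)) (by-coefficients (ι (+ suc k) ⊛ ⊝ var zero) (ι n ⊛ var zero) (C q ∷ [])
            (λ { zero → solve 1 (λ c → c :* (:- con 1ℤ) := (:- c) :* con 1ℤ) refl (ι (+ suc k)) })))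
          (cone-C {map orient ((n , q) ∷ ps)} (0≤ι {+ suc k} (Int.+≤+ ℕ.z≤n)) (here ≡.refl))

    𝓒 : Entailment Element negᴱ
    𝓒 = entailment coneΦ-isOrientedMatroid

    generated : Generated 𝓒
    generated n p ps 0<n (relation eX eY eZ) = coneΦ⁺ (set (map orient ps)) (el p)
      (cone-resp {representatives Φ (set (map orient ps))}
        (≈ᴹ-sym (≈ᴹ-trans (proj₂ (proj₂ (el-vec p))) (*ₗ-congˡ (*ₗ-cancel 0<ιn scaled))))
        (cone-* {representatives Φ (set (map orient ps))} (proj₁ (proj₁ (proj₂ (el-vec p))))
          (cone-* {representatives Φ (set (map orient ps))} (proj₁ (⁻¹-positive 0<ιn)) (cone-combo ps))))
      where
      0<ιn : 0# < ι n
      0<ιn = 0<ι 0<n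
      at : ∀ {x w} → n Int.* x ≡ w → ι n * ι x ≈ ι w
      at {x} e = trans (sym (ι-* n x)) (reflexive (≡.cong ι e))
      scaled : ι n *ₗ C p ≈ᴹ combo ps
      scaled = ≈ᴹ-trans (≈ᴹ-sym (lin-* (ι n) _ _ _)) (lin-cong (at eX) (at eY) (at eZ))

    -- The functional is extended to real coordinates and accumulated along the conical combination.
    -- Independence identifies the resulting coordinates with those of `p` up to the positive scale
    -- of its representative.
    dual : ∀ f L p → (∀ {q} → q ListMem.∈ L → 0ℤ Int.≤ evaluate f q) →
           Entailment._⊢_ 𝓒 L p → 0ℤ Int.≤ evaluate f p
    dual f@(f₁ , f₂ , f₃) L p 0≤L h = conclude (cone-elim {representatives Φ (set L)} Q
      (λ { u≈v (x , y , z , u≈ , 0≤) → x , y , z , ≈ᴹ-trans (≈ᴹ-sym u≈v) u≈ , 0≤ })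
      (0# , 0# , 0# , ≈ᴹ-sym lin-0 , ≤-reflexive (solve 3 (λ a b c →
        con 0ℤ := a :* con 0ℤ :+ b :* con 0ℤ :+ c :* con 0ℤ) refl (ι f₁) (ι f₂) (ι f₃)))
      step (coneΦ⁻ (set L) (el p) h))
      where
      value : Carrier → Carrier → Carrier → Carrier
      value x y z = ι f₁ * x + ι f₂ * y + ι f₃ * z

      value-cong : ∀ {x y z x′ y′ z′} → x ≈ x′ → y ≈ y′ → z ≈ z′ → value x y z ≈ value x′ y′ z′
      value-cong a b c = +-cong (+-cong (*-congˡ a) (*-congˡ b)) (*-congˡ c)

      value-* : ∀ c x y z → value (c * x) (c * y) (c * z) ≈ c * value x y z
      value-* = solve 7 (λ f g h c x y z → f :* (c :* x) :+ g :* (c :* y) :+ h :* (c :* z)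
        := c :* (f :* x :+ g :* y :+ h :* z)) refl (ι f₁) (ι f₂) (ι f₃)

      value-+ : ∀ x y z x′ y′ z′ → value (x + x′) (y + y′) (z + z′) ≈ value x y z + value x′ y′ z′
      value-+ = solve 9 (λ f g h x y z x′ y′ z′ → f :* (x :+ x′) :+ g :* (y :+ y′) :+ h :* (z :+ z′)
        := (f :* x :+ g :* y :+ h :* z) :+ (f :* x′ :+ g :* y′ :+ h :* z′)) refl (ι f₁) (ι f₂) (ι f₃)

      value-ι : ∀ q → value (ι (X q)) (ι (Y q)) (ι (Z q)) ≈ ι (evaluate f q)
      value-ι q = sym (trans (ι-+ (f₁ Int.* X q Int.+ f₂ Int.* Y q) (f₃ Int.* Z q))
        (+-cong (trans (ι-+ (f₁ Int.* X q) (f₂ Int.* Y q)) (+-cong (ι-* f₁ (X q)) (ι-* f₂ (Y q)))) (ι-* f₃ (Z q))))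

      Q : Pred Carrierᴹ 0ℓ
      Q v = ∃[ x ] ∃₂ λ y z → v ≈ᴹ lin x y z × 0# ≤ value x y z

      step : ∀ {c a v} → 0# ≤ c → representatives Φ (set L) a → Q v → Q (c *ₗ a +ᴹ v)
      step {c} {a} {v} 0≤c (r , r∈L , a≈r) (x , y , z , v≈ , 0≤v) =
        k * ι (X q) + x , k * ι (Y q) + y , k * ι (Z q) + z ,
        ≈ᴹ-trans (+ᴹ-cong (≈ᴹ-trans (*ₗ-congˡ a≈) (≈ᴹ-trans (≈ᴹ-sym (*ₗ-assoc c (e * ρ) (C q)))
          (≈ᴹ-sym (lin-* k (ι (X q)) (ι (Y q)) (ι (Z q)))))) v≈) (≈ᴹ-sym (lin-+ _ _ _ _ _ _)) ,
        0≤-resp (sym (trans (value-+ _ _ _ _ _ _) (+-congʳ (trans (value-* k _ _ _) (*-congˡ (value-ι q))))))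
          (0≤-+ (*-nonNeg (*-nonNeg 0≤c (*-nonNeg (proj₁ 0<e) (proj₁ 0<ρ))) (0≤ι (0≤L q∈L))) 0≤v)
        where
        q   = proj₁ (set⁻ L r r∈L)
        q∈L = proj₁ (proj₂ (set⁻ L r r∈L))
        e   = proj₁ (proj₂ (proj₂ (set⁻ L r r∈L)))
        0<e = proj₁ (proj₂ (proj₂ (proj₂ (set⁻ L r r∈L))))
        ρ   = proj₁ (el-vec q)
        0<ρ = proj₁ (proj₂ (el-vec q))
        k   = c * (e * ρ)
        a≈ : a ≈ᴹ (e * ρ) *ₗ C q
        a≈ = ≈ᴹ-trans a≈r (≈ᴹ-trans (proj₂ (proj₂ (proj₂ (proj₂ (set⁻ L r r∈L)))))
          (≈ᴹ-trans (*ₗ-congˡ (proj₂ (proj₂ (el-vec q)))) (≈ᴹ-sym (*ₗ-assoc e ρ (C q)))))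

      conclude : Q (vec (el p)) → 0ℤ Int.≤ evaluate f p
      conclude (x , y , z , p≈ , 0≤) = 0≤ι⁻ (0≤-cancel (proj₁ (proj₂ (el-vec p)))
        (0≤-resp (trans (value-cong (sym ex) (sym ey) (sym ez)) (trans (value-* ρ _ _ _) (*-congˡ (value-ι p)))) 0≤))
        where
        ρ = proj₁ (el-vec p)
        eqs : ρ * ι (X p) ≈ x × ρ * ι (Y p) ≈ y × ρ * ι (Z p) ≈ z
        eqs = lin-injective (≈ᴹ-trans (lin-* ρ _ _ _) (≈ᴹ-trans (≈ᴹ-sym (proj₂ (proj₂ (el-vec p)))) p≈))
        ex = proj₁ eqs
        ey = proj₁ (proj₂ eqs)
        ez = proj₂ (proj₂ eqs)

    nonzero : ∀ a → 0ℤ Int.< dot a a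
    nonzero a with Sign.sum-of-squares (X a) (Y a) (Z a)
    ... | inj₂ 0<dot = 0<dot
    ... | inj₁ (x≡0 , y≡0 , z≡0) = ⊥-elim (root≉0 (el a) (≈ᴹ-trans (proj₂ (proj₂ (el-vec a)))
      (≈ᴹ-trans (*ₗ-congˡ (≈ᴹ-trans (lin-cong (zeros x≡0) (zeros y≡0) (zeros z≡0)) lin-0)) (*ₗ-zeroʳ _))))
      where
      zeros : ∀ {n} → n ≡ 0ℤ → ι n ≈ 0#
      zeros ≡.refl = refl

    module Plane (q r : Element) where
      private
        u v : Carrierᴹ
        u = vec (el q)
        v = vec (el r)

      Spanned : Pred Carrierᴹ 0ℓ
      Spanned w = ∃₂ λ c d → w ≈ᴹ c *ₗ u +ᴹ d *ₗ v

      private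
        spanned-+ : ∀ {c w w′} → Spanned w → Spanned w′ → Spanned (c *ₗ w +ᴹ w′)
        spanned-+ {c} (a , b , w≈) (a′ , b′ , w′≈) = c * a + a′ , c * b + b′ ,
          ≈ᴹ-trans (+ᴹ-cong (*ₗ-congˡ w≈) w′≈)
            (by-coefficients (c ⊛ (a ⊛ var zero ⊕ b ⊛ var (suc zero)) ⊕ (a′ ⊛ var zero ⊕ b′ ⊛ var (suc zero)))
                             ((c * a + a′) ⊛ var zero ⊕ (c * b + b′) ⊛ var (suc zero)) (u ∷ v ∷ [])
              (λ { zero → solve 5 (λ c a b a′ b′ → c :* (a :* con 1ℤ :+ b :* con 0ℤ) :+ (a′ :* con 1ℤ :+ b′ :* con 0ℤ)
                            := (c :* a :+ a′) :* con 1ℤ :+ (c :* b :+ b′) :* con 0ℤ) refl c a b a′ b′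
                 ; (suc zero) → solve 5 (λ c a b a′ b′ → c :* (a :* con 0ℤ :+ b :* con 1ℤ) :+ (a′ :* con 0ℤ :+ b′ :* con 1ℤ)
                            := (c :* a :+ a′) :* con 0ℤ :+ (c :* b :+ b′) :* con 1ℤ) refl c a b a′ b′ }))

        spanned-0 : Spanned 0ᴹ
        spanned-0 = 0# , 0# , ≈ᴹ-sym (≈ᴹ-trans (+ᴹ-cong (*ₗ-zeroˡ u) (*ₗ-zeroˡ v)) (+ᴹ-identityˡ 0ᴹ))

        spanned-C : ∀ {n m k l} → 0ℤ Int.< n → Combination n m k q l r → Spanned (C m)
        spanned-C {n} {m} {k} {l} 0<n (eX , eY , eZ) = conclude (C-el q) (C-el r)
          where
          at : ∀ x y z → n Int.* x ≡ k Int.* y Int.+ l Int.* z → ι n * ι x ≈ ι k * ι y + ι l * ι z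
          at x y z e = trans (sym (ι-* n x)) (trans (reflexive (≡.cong ι e))
            (trans (ι-+ (k Int.* y) (l Int.* z)) (+-cong (ι-* k y) (ι-* l z))))
          scaled : ι n *ₗ C m ≈ᴹ ι k *ₗ C q +ᴹ ι l *ₗ C r
          scaled = ≈ᴹ-trans (≈ᴹ-sym (lin-* (ι n) _ _ _)) (≈ᴹ-trans
            (lin-cong (at (X m) (X q) (X r) eX) (at (Y m) (Y q) (Y r) eY) (at (Z m) (Z q) (Z r) eZ))
            (≈ᴹ-trans (lin-+ _ _ _ _ _ _) (+ᴹ-cong (lin-* (ι k) _ _ _) (lin-* (ι l) _ _ _))))
          conclude : ∃[ ρ ] (0# < ρ × C q ≈ᴹ ρ *ₗ u) → ∃[ ρ ] (0# < ρ × C r ≈ᴹ ρ *ₗ v) → Spanned (C m)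
          conclude (ρ , _ , q≈) (σ , _ , r≈) = ι n ⁻¹ * (ι k * ρ) , ι n ⁻¹ * (ι l * σ) ,
            ≈ᴹ-trans (*ₗ-cancel (0<ι 0<n) scaled) (≈ᴹ-trans
              (*ₗ-congˡ (+ᴹ-cong (*ₗ-congˡ q≈) (*ₗ-congˡ r≈)))
              (by-coefficients (ι n ⁻¹ ⊛ (ι k ⊛ (ρ ⊛ var zero) ⊕ ι l ⊛ (σ ⊛ var (suc zero))))
                ((ι n ⁻¹ * (ι k * ρ)) ⊛ var zero ⊕ (ι n ⁻¹ * (ι l * σ)) ⊛ var (suc zero)) (u ∷ v ∷ [])
                (λ { zero → solve 5 (λ n k l ρ σ → n :* (k :* (ρ :* con 1ℤ) :+ l :* (σ :* con 0ℤ))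
                       := (n :* (k :* ρ)) :* con 1ℤ :+ (n :* (l :* σ)) :* con 0ℤ) refl (ι n ⁻¹) (ι k) (ι l) ρ σ
                   ; (suc zero) → solve 5 (λ n k l ρ σ → n :* (k :* (ρ :* con 0ℤ) :+ l :* (σ :* con 1ℤ))
                       := (n :* (k :* ρ)) :* con 0ℤ :+ (n :* (l :* σ)) :* con 1ℤ) refl (ι n ⁻¹) (ι k) (ι l) ρ σ })))

      module _ (L : List Element) (q∈L : q ListMem.∈ L) (r∈L : r ListMem.∈ L)
               (⊆plane : ∀ {m} → m ListMem.∈ L → ∃[ n ] (0ℤ Int.< n × ∃₂ λ k l → Combination n m k q l r)) where
        private
          P : Pred Carrierᴹ 0ℓ
          P = representatives Φ (set L)

          spanned-generator : ∀ {a} → P a → Spanned a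
          spanned-generator {a} (x , x∈L , a≈x) = conclude (set⁻ L x x∈L)
            where
            conclude : ∃[ m ] (m ListMem.∈ L × x ∼′ el m) → Spanned a
            conclude (m , m∈L , e , _ , x≈) =
              let n , 0<n , k , l , comb = ⊆plane m∈L
                  ρ , _ , m≈ = el-vec m
                  c , d , eq = spanned-+ {e * ρ} (spanned-C {n} {m} {k} {l} 0<n comb) spanned-0
              in c , d , ≈ᴹ-trans (≈ᴹ-trans a≈x (≈ᴹ-trans x≈ (≈ᴹ-trans (*ₗ-congˡ m≈)
                (≈ᴹ-trans (≈ᴹ-sym (*ₗ-assoc e ρ (C m))) (≈ᴹ-sym (+ᴹ-identityʳ _)))))) eq

          spanned : ∀ n (c : Vector Carrier n) (a : Vector Carrierᴹ n) → (∀ i → P (a i)) → Spanned (linComb c a)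
          spanned zero    c a Pa = spanned-0
          spanned (suc n) c a Pa = spanned-+ (spanned-generator (Pa zero)) (spanned n (c ∘ suc) (a ∘ suc) (Pa ∘ suc))

          span-generator : ∀ {m} → m ListMem.∈ L → Span P (vec (el m))
          span-generator {m} m∈L = 1 , (λ _ → 1#) , (λ _ → vec (el m)) ,
            (λ _ → el m , set⁺ L m m∈L , ≈ᴹ-refl) ,
            ≈ᴹ-sym (≈ᴹ-trans (+ᴹ-identityʳ _) (*ₗ-identityˡ _))

        -- Planarity asks for a basis of the span. When `q` and `r` are parallel, the first of them
        -- alone is one.
        line-dimension : Collinear q r → HasDimension 1 (Span P)
        line-dimension col = (λ _ → u) , (λ _ → span-generator q∈L) ,
          (λ { c cu≈0 zero → decide c cu≈0 (c zero ≟ 0#) }) ,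
          (λ { w (n , c , a , Pa , w≈) → on-line w (let x , y , eq = spanned n c a Pa in x , y , ≈ᴹ-trans w≈ eq) })
          where
          decide : ∀ c → linComb {1} c (λ _ → u) ≈ᴹ 0ᴹ → Dec (c zero ≈ 0#) → c zero ≈ 0#
          decide c cu≈0 (yes p) = p
          decide c cu≈0 (no c≉0) = ⊥-elim (root≉0 (el q) (*ₗ-cancel-0 c≉0
            (≈ᴹ-trans (≈ᴹ-sym (+ᴹ-identityʳ _)) cu≈0)))
          parallel-by : Relation (dot q q) r ((dot q r , q) ∷ []) → ∃[ t ] v ≈ᴹ t *ₗ u
          parallel-by (relation eX eY eZ) = scale (C-el q) (el-vec r)
            where
            at : ∀ x y → dot q q Int.* x ≡ dot q r Int.* y Int.+ 0ℤ → ι (dot q q) * ι x ≈ ι (dot q r) * ι y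
            at x y e = trans (sym (ι-* (dot q q) x)) (trans (reflexive (≡.cong ι (≡.trans e (ℤP.+-identityʳ (dot q r Int.* y)))))
              (ι-* (dot q r) y))
            scaled : ι (dot q q) *ₗ C r ≈ᴹ ι (dot q r) *ₗ C q
            scaled = ≈ᴹ-trans (≈ᴹ-sym (lin-* (ι (dot q q)) _ _ _)) (≈ᴹ-trans
              (lin-cong (at (X r) (X q) eX) (at (Y r) (Y q) eY) (at (Z r) (Z q) eZ)) (lin-* (ι (dot q r)) _ _ _))
            scale : ∃[ ρ ] (0# < ρ × C q ≈ᴹ ρ *ₗ u) → ∃[ ρ ] (0# < ρ × v ≈ᴹ ρ *ₗ C r) → ∃[ t ] v ≈ᴹ t *ₗ u
            scale (ρ , _ , q≈) (σ , _ , v≈) = σ * (ι (dot q q) ⁻¹ * (ι (dot q r) * ρ)) ,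
              ≈ᴹ-trans v≈ (≈ᴹ-trans (*ₗ-congˡ (≈ᴹ-trans (*ₗ-cancel (0<ι (nonzero q)) scaled)
                (*ₗ-congˡ (*ₗ-congˡ q≈))))
                (≈ᴹ-sym (≈ᴹ-trans (*ₗ-assoc σ _ u) (*ₗ-congˡ (≈ᴹ-trans (*ₗ-assoc _ _ u) (*ₗ-congˡ (*ₗ-assoc _ ρ u)))))))
          v∥u : ∃[ t ] v ≈ᴹ t *ₗ u
          v∥u = parallel-by (collinear-relation q r col)
          on-line : ∀ w → Spanned w → ∃[ c ] w ≈ᴹ linComb {1} c (λ _ → u)
          on-line w (a , b , w≈) = let t , v≈ = v∥u in (λ _ → a + b * t) ,
            ≈ᴹ-trans w≈ (≈ᴹ-trans (+ᴹ-congˡ (≈ᴹ-trans (*ₗ-congˡ v≈) (≈ᴹ-sym (*ₗ-assoc b t u))))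
              (≈ᴹ-trans (≈ᴹ-sym (*ₗ-distribʳ u a (b * t))) (≈ᴹ-sym (+ᴹ-identityʳ _))))

        plane-dimension : 0ℤ Int.< norm² q r → HasDimension 2 (Span P)
        plane-dimension 0<n = basis ,
          (λ { zero → span-generator q∈L ; (suc zero) → span-generator r∈L }) ,
          (λ c cb≈0 → let e , f = linearly-independent (c zero) (c (suc zero))
                                    (≈ᴹ-trans (+ᴹ-congˡ (≈ᴹ-sym (+ᴹ-identityʳ _))) cb≈0)
                      in λ { zero → e ; (suc zero) → f }) ,
          (λ { w (n , c , a , Pa , w≈) → let x , y , eq = spanned n c a Pa in
               (λ { zero → x ; (suc zero) → y }) ,
               ≈ᴹ-trans w≈ (≈ᴹ-trans eq (+ᴹ-congˡ (≈ᴹ-sym (+ᴹ-identityʳ _)))) })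
          where
          basis : Vector Carrierᴹ 2
          basis zero       = u
          basis (suc zero) = v

          N = norm² q r

          ι-minor : ∀ a b c d → ι (a Int.* b Int.- c Int.* d) ≈ ι a * ι b + - (ι c * ι d)
          ι-minor a b c d = trans (ι-+ (a Int.* b) (Int.- (c Int.* d)))
            (+-cong (ι-* a b) (trans (ι-neg (c Int.* d)) (-‿cong (ι-* c d))))

          ι-norm² : ∀ x y z → ι (x Int.* x Int.+ y Int.* y Int.+ z Int.* z) ≈ ι x * ι x + ι y * ι y + ι z * ι z
          ι-norm² x y z = trans (ι-+ (x Int.* x Int.+ y Int.* y) (z Int.* z))
            (+-cong (trans (ι-+ (x Int.* x) (y Int.* y)) (+-cong (ι-* x x) (ι-* y y))) (ι-* z z))

          -- A q + B r = 0 gives A (q × r) = 0 = B (q × r).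
          cross : ∀ A B → A * ι (X q) + B * ι (X r) ≈ 0# → A * ι (Y q) + B * ι (Y r) ≈ 0# →
                  A * ι (Z q) + B * ι (Z r) ≈ 0# → A ≈ 0# × B ≈ 0#
          cross A B eX eY eZ =
            *-cancelˡ-0 ιN≉0 (trans (*-congʳ ιN≈) (trans
              (solve 8 (λ A B x y z x′ y′ z′ →
                (((y :* z′ :- z :* y′) :* (y :* z′ :- z :* y′) :+ (z :* x′ :- x :* z′) :* (z :* x′ :- x :* z′)) :+ (x :* y′ :- y :* x′) :* (x :* y′ :- y :* x′)) :* A :=
                ((y :* z′ :- z :* y′) :* ((A :* y :+ B :* y′) :* z′ :- (A :* z :+ B :* z′) :* y′) :+
                 (z :* x′ :- x :* z′) :* ((A :* z :+ B :* z′) :* x′ :- (A :* x :+ B :* x′) :* z′)) :+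
                 (x :* y′ :- y :* x′) :* ((A :* x :+ B :* x′) :* y′ :- (A :* y :+ B :* y′) :* x′))
                refl A B (ι (X q)) (ι (Y q)) (ι (Z q)) (ι (X r)) (ι (Y r)) (ι (Z r)))
              (vanish (ι (X r)) (ι (Y r)) (ι (Z r))))) ,
            *-cancelˡ-0 ιN≉0 (trans (*-congʳ ιN≈) (trans
              (solve 8 (λ A B x y z x′ y′ z′ →
                (((y :* z′ :- z :* y′) :* (y :* z′ :- z :* y′) :+ (z :* x′ :- x :* z′) :* (z :* x′ :- x :* z′)) :+ (x :* y′ :- y :* x′) :* (x :* y′ :- y :* x′)) :* B :=
                ((y :* z′ :- z :* y′) :* ((A :* y :+ B :* y′) :* (:- z) :- (A :* z :+ B :* z′) :* (:- y)) :+
                 (z :* x′ :- x :* z′) :* ((A :* z :+ B :* z′) :* (:- x) :- (A :* x :+ B :* x′) :* (:- z))) :+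
                 (x :* y′ :- y :* x′) :* ((A :* x :+ B :* x′) :* (:- y) :- (A :* y :+ B :* y′) :* (:- x)))
                refl A B (ι (X q)) (ι (Y q)) (ι (Z q)) (ι (X r)) (ι (Y r)) (ι (Z r)))
              (vanish (- ι (X q)) (- ι (Y q)) (- ι (Z q)))))
            where
            x = ι (X q); y = ι (Y q); z = ι (Z q)
            x′ = ι (X r); y′ = ι (Y r); z′ = ι (Z r)
            m₁ = y * z′ + - (z * y′)
            m₂ = z * x′ + - (x * z′)
            m₃ = x * y′ + - (y * x′)

            ιN≉0 : ¬ (ι N ≈ 0#)
            ιN≉0 = 0<⇒≉0 (0<ι 0<n)

            ιN≈ : ι N ≈ m₁ * m₁ + m₂ * m₂ + m₃ * m₃
            ιN≈ = trans (ι-norm² (n₁ q r) (n₂ q r) (n₃ q r)) (+-cong (+-cong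
              (*-cong (ι-minor (Y q) (Z r) (Z q) (Y r)) (ι-minor (Y q) (Z r) (Z q) (Y r)))
              (*-cong (ι-minor (Z q) (X r) (X q) (Z r)) (ι-minor (Z q) (X r) (X q) (Z r))))
              (*-cong (ι-minor (X q) (Y r) (Y q) (X r)) (ι-minor (X q) (Y r) (Y q) (X r))))

            vanish : ∀ s t w →
              m₁ * ((A * y + B * y′) * w + - ((A * z + B * z′) * t)) +
              m₂ * ((A * z + B * z′) * s + - ((A * x + B * x′) * w)) +
              m₃ * ((A * x + B * x′) * t + - ((A * y + B * y′) * s)) ≈ 0#
            vanish s t w = trans (+-cong (+-cong (pair m₁ w t eY eZ) (pair m₂ s w eZ eX)) (pair m₃ t s eX eY))
              (solve 0 (con 0ℤ :+ con 0ℤ :+ con 0ℤ := con 0ℤ) refl)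
              where
              pair : ∀ m a b {e f} → e ≈ 0# → f ≈ 0# → m * (e * a + - (f * b)) ≈ 0#
              pair m a b e≈0 f≈0 = trans (*-congˡ (+-cong (*-congʳ e≈0) (-‿cong (*-congʳ f≈0))))
                (solve 3 (λ m a b → m :* (con 0ℤ :* a :- con 0ℤ :* b) := con 0ℤ) refl m a b)

          linearly-independent : ∀ c d → c *ₗ u +ᴹ d *ₗ v ≈ᴹ 0ᴹ → c ≈ 0# × d ≈ 0#
          linearly-independent c d eq = conclude (el-vec q) (el-vec r)
            where
            conclude : ∃[ ρ ] (0# < ρ × u ≈ᴹ ρ *ₗ C q) → ∃[ ρ ] (0# < ρ × v ≈ᴹ ρ *ₗ C r) → c ≈ 0# × d ≈ 0#
            conclude (ρ , 0<ρ , u≈) (σ , 0<σ , v≈) =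
              let eX , eY , eZ = independent _ _ _ (≈ᴹ-trans (lin-+ _ _ _ _ _ _)
                    (≈ᴹ-trans (+ᴹ-cong
                      (≈ᴹ-trans (lin-* (c * ρ) _ _ _) (≈ᴹ-trans (*ₗ-assoc c ρ (C q)) (*ₗ-congˡ (≈ᴹ-sym u≈))))
                      (≈ᴹ-trans (lin-* (d * σ) _ _ _) (≈ᴹ-trans (*ₗ-assoc d σ (C r)) (*ₗ-congˡ (≈ᴹ-sym v≈))))) eq))
                  A≈0 , B≈0 = cross (c * ρ) (d * σ) eX eY eZ
              in *-cancelˡ-0 (0<⇒≉0 0<ρ) (trans (*-comm ρ c) A≈0) ,
                 *-cancelˡ-0 (0<⇒≉0 0<σ) (trans (*-comm σ d) B≈0)

    module _ {d : Operator} (d-OMRS : IsOMRS Φ d) where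
      open IsOMRS d-OMRS
      open IsOrientedMatroid isOrientedMatroid using (cx-finitary; isClosureOperator)
      open IsClosureOperator isClosureOperator using (monotone)

      private
        𝓓 : Entailment Element negᴱ
        𝓓 = entailment isOrientedMatroid

        planar : ∀ {q r L} → q ListMem.∈ L → r ListMem.∈ L →
                 (∀ {m} → m ListMem.∈ L → ∃[ n ] (0ℤ Int.< n × ∃₂ λ k l → Combination n m k q l r)) → ∀ p →
                 (Entailment._⊢_ 𝓒 L p → Entailment._⊢_ 𝓓 L p) ×
                 (Entailment._⊢_ 𝓓 L p → Entailment._⊢_ 𝓒 L p)
        planar {q} {r} {L} q∈L r∈L ⊆plane p = by-dimension (collinear? q r)
          where
          by-dimension : Collinear q r ⊎ 0ℤ Int.< norm² q r → _
          by-dimension (inj₁ col) = let f , g = d-planar (set L) 1 (ℕ.s≤s ℕ.z≤n) (Plane.line-dimension q r L q∈L r∈L ⊆plane col)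
                                    in g {el p} , f {el p}
          by-dimension (inj₂ 0<n) = let f , g = d-planar (set L) 2 (ℕ.s≤s (ℕ.s≤s ℕ.z≤n)) (Plane.plane-dimension q r L q∈L r∈L ⊆plane 0<n)
                                    in g {el p} , f {el p}

        open Agreement nonzero 𝓒 𝓓 generated dual planar
          (λ p h → ⊥-elim (¬Any[] (proj₁ (IsReduced.cx-∅ coneΦ-isReduced) {el p} h)))
          (λ p h → ⊥-elim (¬Any[] (proj₁ (IsReduced.cx-∅ isReduced) {el p} h)))

        points : ∀ ys → ∃[ L ] (fromList ys ≐ set L)
        points [] = [] , (λ ()) , (λ ())
        points (y ∷ ys) =
          let L , f , g = points ys
              p , ρ , 0<ρ , y≈ = cover y
              y∼p = ∼-el {y} {p} 0<ρ y≈
          in p ∷ L ,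
             (λ { {z} (here z∼y) → here (∼-trans {z} {y} {el p} z∼y y∼p) ; {z} (there z∈) → there (f {z} z∈) }) ,
             (λ { {z} (here z∼p) → here (∼-trans {z} {el p} {y} z∼p (∼-sym {y} {el p} y∼p)) ; {z} (there z∈) → there (g {z} z∈) })

        -- Finitarity replaces an arbitrary set by a finite one and `cover` replaces that by a list
        -- of integral elements, where the closures have been compared.
        transfer : ∀ {c c′ : Operator} → IsClosureOperator c → IsClosureOperator c′ →
                   (∀ X x → x ∈ c X → ∃[ ys ] (fromList ys ⊆ X × x ∈ c (fromList ys))) →
                   (∀ L p → el p ∈ c (set L) → el p ∈ c′ (set L)) → ∀ X → c X ⊆ c′ X
        transfer {c} {c′} cl cl′ finitary agree X {x} x∈ =
          let ys , ys⊆ , x∈′ = finitary X x x∈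
              L , f , g = points ys
              p , ρ , 0<ρ , x≈ = cover x
              x∼p = ∼-el {x} {p} 0<ρ x≈
          in resp (c′ X) {el p} {x} (∼-sym {x} {el p} x∼p)
               (IsClosureOperator.monotone cl′ {set L} {X} (λ {z} z∈ → ys⊆ {z} (g {z} z∈))
                 (agree L p (resp (c (set L)) {x} {el p} x∼p
                   (IsClosureOperator.monotone cl {fromList ys} {set L} (λ {z} → f {z}) x∈′))))

      coneΦ≗ : coneΦ Φ ≗ d
      coneΦ≗ X =
        (λ {x} → transfer {coneΦ Φ} {d} coneΦ-isClosureOperator isClosureOperator coneΦ-finitary 𝓒⊆𝓓 X {x}) ,
        (λ {x} → transfer {d} {coneΦ Φ} isClosureOperator coneΦ-isClosureOperator cx-finitary 𝓓⊆𝓒 X {x})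

-- Integral coordinates from rescaled simple roots.

module Framed (em : ExcludedMiddle 0ℓ) {K : CompleteOrderedField} {T : Trigonometry K}
              {V : Module (CompleteOrderedField.commutativeRing K) 0ℓ 0ℓ}
              (Φ : RootSystem T V 3) (𝓐 : AffineType) where
  open CompleteOrderedField K hiding (zero)
  open OrderedFieldProperties K
  open IntegerEmbedding K
  open Solver using (solve; _:=_; _:+_; _:*_; :-_; _:-_; con)
  open OrderedField em K
  open Module V
  open LinearAlgebra K V
  open LinearExpressions K V
  open RootSystem Φ
  open Roots em Φ
  open Uniqueness em Φ
  open Root using (vec)
  open AffineType 𝓐 renaming (neg to negᴱ)

  -- The permutation σ numbers the simple roots as in the table and `p` rescales them. Cartan
  -- integers are stated without division.
  record Frame : Set where
    field
      e       : Fin 3 → Carrierᴹ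
      σ π     : Fin 3 → Fin 3
      π-σ     : ∀ j → π (σ j) ≡ j
      σ-π     : ∀ i → σ (π i) ≡ i
      p       : Fin 3 → Carrier
      0<p     : ∀ j → 0# < p j
      e≈      : ∀ j → e j ≈ᴹ p j *ₗ α (σ j)
      cartan  : ∀ i j → 2# * ⟪ e i , e j ⟫ ≈ ι (A i j) * ⟪ e j , e j ⟫

  module _ (frame : Frame) where
    open Frame frame

    δ : Carrierᴹ
    δ = e (# 0) +ᴹ (ι m₁ *ₗ e (# 1) +ᴹ ι m₂ *ₗ e (# 2))

    open Triples (e (# 1)) (e (# 2)) δ

    -- The coroot of `α (σ j)` is `p j` times the coroot of the rescaled `e j`.
    κ-e : ∀ i j → κ (σ j) (e i) ≈ ι (A i j) * p j
    κ-e i j = begin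
      2# * ⟪ e i , a ⟫ * N ⁻¹           ≈⟨ *-congʳ (*-cancelˡ (0<⇒≉0 (0<p j)) scaled) ⟩
      (ι (A i j) * p j * N) * N ⁻¹      ≈⟨ *-assoc (ι (A i j) * p j) N (N ⁻¹) ⟩
      ι (A i j) * p j * (N * N ⁻¹)      ≈⟨ *-congˡ (⁻¹-inverse (0<⇒≉0 (α-positive (σ j)))) ⟩
      ι (A i j) * p j * 1#              ≈⟨ *-identityʳ _ ⟩
      ι (A i j) * p j                   ∎
      where
      open SetoidReasoning setoid
      a = α (σ j)
      N = ⟪ a , a ⟫
      right : ∀ v → ⟪ v , e j ⟫ ≈ p j * ⟪ v , a ⟫
      right v = trans (⟪⟫-cong ≈ᴹ-refl (e≈ j)) (trans (⟪⟫-sym v (p j *ₗ a))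
        (trans (⟪⟫-*ˡ (p j) a v) (*-congˡ (⟪⟫-sym a v))))
      scaled : p j * (2# * ⟪ e i , a ⟫) ≈ p j * (ι (A i j) * p j * N)
      scaled = begin
        p j * (2# * ⟪ e i , a ⟫)         ≈⟨ solve 3 (λ p t x → p :* (t :* x) := t :* (p :* x)) refl (p j) 2# ⟪ e i , a ⟫ ⟩
        2# * (p j * ⟪ e i , a ⟫)         ≈⟨ *-congˡ (right (e i)) ⟨
        2# * ⟪ e i , e j ⟫               ≈⟨ cartan i j ⟩
        ι (A i j) * ⟪ e j , e j ⟫        ≈⟨ *-congˡ (trans (right (e j)) (*-congˡ (trans (⟪⟫-cong (e≈ j) ≈ᴹ-refl) (⟪⟫-*ˡ (p j) a a)))) ⟩
        ι (A i j) * (p j * (p j * N))    ≈⟨ solve 3 (λ A p N → A :* (p :* (p :* N)) := p :* (A :* p :* N)) refl (ι (A i j)) (p j) N ⟩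
        p j * (ι (A i j) * p j * N)      ∎

    κ-lin : ∀ j x y z → κ (σ j) (lin x y z) ≈ (ι (A (# 1) j) * x + ι (A (# 2) j) * y) * p j
    κ-lin j x y z = begin
      k (lin x y z)                              ≈⟨ trans (κ-+ (σ j) _ _) (+-congˡ (κ-+ (σ j) _ _)) ⟩
      k (x *ₗ e₁) + (k (y *ₗ e₂) + k (z *ₗ δ))   ≈⟨ +-cong (term x (# 1)) (+-cong (term y (# 2)) (trans (κ-* (σ j) z δ) (*-congˡ κδ))) ⟩
      x * (a₁ * q) + (y * (a₂ * q) + z * 0#)     ≈⟨ solve 6 (λ x y z a b q → x :* (a :* q) :+ (y :* (b :* q) :+ z :* con 0ℤ)
                                                      := (a :* x :+ b :* y) :* q) refl x y z a₁ a₂ q ⟩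
      (a₁ * x + a₂ * y) * q                      ∎
      where
      open SetoidReasoning setoid
      k = κ (σ j)
      q = p j
      e₁ = e (# 1)
      e₂ = e (# 2)
      a₀ = ι (A (# 0) j)
      a₁ = ι (A (# 1) j)
      a₂ = ι (A (# 2) j)
      term : ∀ c i → k (c *ₗ e i) ≈ c * (ι (A i j) * q)
      term c i = trans (κ-* (σ j) c (e i)) (*-congˡ (κ-e i j))
      -- By `null` the vector δ is orthogonal to every simple root, so the third coordinate drops
      -- out.
      κδ : k δ ≈ 0#
      κδ = begin
        k δ                                                        ≈⟨ trans (κ-+ (σ j) _ _) (+-congˡ (κ-+ (σ j) _ _)) ⟩
        k (e (# 0)) + (k (ι m₁ *ₗ e₁) + k (ι m₂ *ₗ e₂))            ≈⟨ +-cong (κ-e (# 0) j) (+-cong (term (ι m₁) (# 1)) (term (ι m₂) (# 2))) ⟩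
        a₀ * q + (ι m₁ * (a₁ * q) + ι m₂ * (a₂ * q))               ≈⟨ solve 6 (λ a b c m n q → a :* q :+ (m :* (b :* q) :+ n :* (c :* q))
                                                                       := (a :+ m :* b :+ n :* c) :* q) refl a₀ a₁ a₂ (ι m₁) (ι m₂) q ⟩
        (a₀ + ι m₁ * a₁ + ι m₂ * a₂) * q                           ≈⟨ *-congʳ ι-null ⟨
        ι (A (# 0) j Int.+ m₁ Int.* A (# 1) j Int.+ m₂ Int.* A (# 2) j) * q  ≡⟨ ≡.cong (λ n → ι n * q) (null j) ⟩
        0# * q                                                     ≈⟨ zeroˡ q ⟩
        0#                                                         ∎
        where
        ι-null : ι (A (# 0) j Int.+ m₁ Int.* A (# 1) j Int.+ m₂ Int.* A (# 2) j) ≈ a₀ + ι m₁ * a₁ + ι m₂ * a₂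
        ι-null = trans (ι-+ (A (# 0) j Int.+ m₁ Int.* A (# 1) j) (m₂ Int.* A (# 2) j)) (+-cong
          (trans (ι-+ (A (# 0) j) (m₁ Int.* A (# 1) j)) (+-congˡ (ι-* m₁ (A (# 1) j)))) (ι-* m₂ (A (# 2) j)))

    vector : Triple → Carrierᴹ
    vector (x , y , z) = lin (ι x) (ι y) (ι z)

    vector-simple : ∀ j → vector (simple j) ≈ᴹ e j
    vector-simple zero = ≈ᴹ-trans (lin-cong (ι-neg m₁) (ι-neg m₂) refl)
      (by-coefficients
        ((- ι m₁) ⊛ v₁ ⊕ ((- ι m₂) ⊛ v₂ ⊕ 1# ⊛ (v₀ ⊕ (ι m₁ ⊛ v₁ ⊕ ι m₂ ⊛ v₂)))) v₀
        (e (# 0) ∷ e (# 1) ∷ e (# 2) ∷ [])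
        (λ { zero → solve 2 (λ m n → (:- m) :* con 0ℤ :+ ((:- n) :* con 0ℤ :+ con 1ℤ :* (con 1ℤ :+ (m :* con 0ℤ :+ n :* con 0ℤ))) := con 1ℤ) refl (ι m₁) (ι m₂)
           ; (suc zero) → solve 2 (λ m n → (:- m) :* con 1ℤ :+ ((:- n) :* con 0ℤ :+ con 1ℤ :* (con 0ℤ :+ (m :* con 1ℤ :+ n :* con 0ℤ))) := con 0ℤ) refl (ι m₁) (ι m₂)
           ; (suc (suc zero)) → solve 2 (λ m n → (:- m) :* con 0ℤ :+ ((:- n) :* con 1ℤ :+ con 1ℤ :* (con 0ℤ :+ (m :* con 0ℤ :+ n :* con 1ℤ))) := con 0ℤ) refl (ι m₁) (ι m₂) }))
      where
      v₀ v₁ v₂ : Expr 3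
      v₀ = var zero
      v₁ = var (suc zero)
      v₂ = var (suc (suc zero))
    vector-simple (suc zero) = ≈ᴹ-trans
      (+ᴹ-cong (*ₗ-identityˡ _) (≈ᴹ-trans (+ᴹ-cong (*ₗ-zeroˡ _) (*ₗ-zeroˡ _)) (+ᴹ-identityˡ 0ᴹ))) (+ᴹ-identityʳ _)
    vector-simple (suc (suc zero)) = ≈ᴹ-trans
      (+ᴹ-cong (*ₗ-zeroˡ _) (≈ᴹ-trans (+ᴹ-cong (*ₗ-identityˡ _) (*ₗ-zeroˡ _)) (+ᴹ-identityʳ _))) (+ᴹ-identityˡ _)

    s-vector : ∀ j v → s (σ j) (vector v) ≈ᴹ vector (reflect j v)
    s-vector j v@(x , y , z) = begin
      s (σ j) (vector v)                                   ≈⟨ s≈ (σ j) (vector v) ⟩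
      vector v +ᴹ (- κ (σ j) (vector v)) *ₗ α (σ j)        ≈⟨ +ᴹ-congˡ (*ₗ-congʳ coefficient≈) ⟩
      vector v +ᴹ (- ι n * p j) *ₗ α (σ j)                 ≈⟨ +ᴹ-congˡ (≈ᴹ-trans (*ₗ-assoc (- ι n) (p j) _) (*ₗ-congˡ (≈ᴹ-trans (≈ᴹ-sym (e≈ j)) (≈ᴹ-sym (vector-simple j))))) ⟩
      vector v +ᴹ (- ι n) *ₗ vector (simple j)             ≈⟨ +ᴹ-congˡ (lin-* (- ι n) _ _ _) ⟨
      vector v +ᴹ lin (- ι n * ι x′) (- ι n * ι y′) (- ι n * ι z′)  ≈⟨ lin-+ _ _ _ _ _ _ ⟨
      lin (ι x + - ι n * ι x′) (ι y + - ι n * ι y′) (ι z + - ι n * ι z′)  ≈⟨ lin-cong (ι-sub x x′) (ι-sub y y′) (ι-sub z z′) ⟨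
      vector (reflect j v)                                 ∎
      where
      open SetoidReasoning ≈ᴹ-setoid
      n  = pairing j v
      x′ = proj₁ (simple j)
      y′ = proj₁ (proj₂ (simple j))
      z′ = height (simple j)
      ι-sub : ∀ a b → ι (a Int.- n Int.* b) ≈ ι a + - ι n * ι b
      ι-sub a b = trans (ι-+ a (Int.- (n Int.* b))) (+-congˡ (trans (ι-neg (n Int.* b))
        (trans (-‿cong (ι-* n b)) (solve 2 (λ n b → :- (n :* b) := (:- n) :* b) refl (ι n) (ι b)))))
      coefficient≈ : - κ (σ j) (vector v) ≈ - ι n * p j
      coefficient≈ = trans (-‿cong (trans (κ-lin j (ι x) (ι y) (ι z)) (*-congʳ
        (sym (trans (ι-+ (A (# 1) j Int.* x) (A (# 2) j Int.* y)) (+-cong (ι-* (A (# 1) j) x) (ι-* (A (# 2) j) y)))))))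
        (solve 2 (λ n p → :- (n :* p) := (:- n) :* p) refl (ι n) (p j))

    act-vector : ∀ w v → act (map σ w) (vector v) ≈ᴹ vector (run w v)
    act-vector []      v = ≈ᴹ-refl
    act-vector (j ∷ w) v = ≈ᴹ-trans (s-cong (σ j) (act-vector w v)) (s-vector j (run w v))

    private
      multiplicity : Fin 3 → ℤ
      multiplicity zero             = 1ℤ
      multiplicity (suc zero)       = m₁
      multiplicity (suc (suc zero)) = m₂

      0<multiplicity : ∀ j → 0# < ι (multiplicity j)
      0<multiplicity zero             = 0<1
      0<multiplicity (suc zero)       = 0<ι 0<m₁
      0<multiplicity (suc (suc zero)) = 0<ι 0<m₂

    -- δ is a combination of the simple roots with positive coefficients, so positive independence
    -- applies after renumbering.
    δ≉0 : ¬ (δ ≈ᴹ 0ᴹ)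
    δ≉0 δ≈0 = 0<⇒≉0 (0<c zero) (positivelyIndependent c (proj₁ ∘ 0<c) (≈ᴹ-trans sum≈ δ≈0) zero)
      where
      open Sum +ᴹ-commutativeMonoid using (sum; sum-permute; sum-cong-≋)

      c : Fin 3 → Carrier
      c i = ι (multiplicity (π i)) * p (π i)

      0<c : ∀ i → 0# < c i
      0<c i = *-positive (0<multiplicity (π i)) (0<p (π i))

      term : Fin 3 → Carrierᴹ
      term j = ι (multiplicity j) *ₗ e j

      sum≈ : linComb c α ≈ᴹ δ
      sum≈ = ≈ᴹ-trans (sum-cong-≋ (λ i → ≈ᴹ-trans (*ₗ-assoc (ι (multiplicity (π i))) (p (π i)) (α i))
          (*ₗ-congˡ (≈ᴹ-sym (≈ᴹ-trans (e≈ (π i)) (*ₗ-congˡ (≈ᴹ-reflexive (≡.cong α (σ-π i)))))))))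
        (≈ᴹ-trans (≈ᴹ-sym (sum-permute term (permutation π σ π-σ σ-π)))
        (+ᴹ-cong (*ₗ-identityˡ (e (# 0))) (+ᴹ-congˡ (+ᴹ-identityʳ _))))

    -- Pairing with the coroots belonging to e₁ and e₂ gives two equations in `x` and `y` whose
    -- determinant is that of the finite Cartan matrix, not zero by `regular`. What remains is a
    -- multiple of δ.
    independent : ∀ x y z → lin x y z ≈ᴹ 0ᴹ → x ≈ 0# × y ≈ 0# × z ≈ 0#
    independent x y z eq = x≈0 , y≈0 , z≈0
      where
      a b : Fin 3 → Carrier
      a j = ι (A (# 1) j)
      b j = ι (A (# 2) j)

      equation : ∀ j → a j * x + b j * y ≈ 0#
      equation j = *-cancelˡ-0 (0<⇒≉0 (0<p j)) (trans (*-comm (p j) _) (trans (sym (κ-lin j x y z))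
        (trans (κ-cong (σ j) (≈ᴹ-trans eq (≈ᴹ-sym (*ₗ-zeroˡ 0ᴹ)))) (trans (κ-* (σ j) 0# 0ᴹ) (zeroˡ _)))))

      Δ : Carrier
      Δ = a (# 1) * b (# 2) + - (a (# 2) * b (# 1))

      Δ≉0 : ¬ (Δ ≈ 0#)
      Δ≉0 Δ≈0 = regular (ι≈0 (trans (trans
        (ι-+ (A (# 1) (# 1) Int.* A (# 2) (# 2)) (Int.- (A (# 1) (# 2) Int.* A (# 2) (# 1))))
        (+-cong (ι-* (A (# 1) (# 1)) (A (# 2) (# 2))) (trans (ι-neg (A (# 1) (# 2) Int.* A (# 2) (# 1)))
          (-‿cong (ι-* (A (# 1) (# 2)) (A (# 2) (# 1))))))) Δ≈0))

      x≈0 : x ≈ 0#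
      x≈0 = *-cancelˡ-0 Δ≉0 (trans
        (solve 6 (λ a b c d x y → (a :* b :- c :* d) :* x := b :* (a :* x :+ d :* y) :- d :* (c :* x :+ b :* y)) refl
          (a (# 1)) (b (# 2)) (a (# 2)) (b (# 1)) x y)
        (trans (+-cong (*-congˡ (equation (# 1))) (-‿cong (*-congˡ (equation (# 2)))))
          (solve 2 (λ b d → b :* con 0ℤ :- d :* con 0ℤ := con 0ℤ) refl (b (# 2)) (b (# 1)))))

      y≈0 : y ≈ 0#
      y≈0 = *-cancelˡ-0 Δ≉0 (trans
        (solve 6 (λ a b c d x y → (a :* b :- c :* d) :* y := a :* (c :* x :+ b :* y) :- c :* (a :* x :+ d :* y)) refl
          (a (# 1)) (b (# 2)) (a (# 2)) (b (# 1)) x y)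
        (trans (+-cong (*-congˡ (equation (# 2))) (-‿cong (*-congˡ (equation (# 1)))))
          (solve 2 (λ b d → b :* con 0ℤ :- d :* con 0ℤ := con 0ℤ) refl (a (# 1)) (a (# 2)))))

      zδ≈0 : z *ₗ δ ≈ᴹ 0ᴹ
      zδ≈0 = ≈ᴹ-trans (≈ᴹ-sym (≈ᴹ-trans
        (+ᴹ-cong (≈ᴹ-trans (*ₗ-congʳ x≈0) (*ₗ-zeroˡ _)) (+ᴹ-congʳ (≈ᴹ-trans (*ₗ-congʳ y≈0) (*ₗ-zeroˡ _))))
        (≈ᴹ-trans (+ᴹ-identityˡ _) (+ᴹ-identityˡ _)))) eq

      z≈0 : z ≈ 0#
      z≈0 = decide (z ≟ 0#)
        where
        decide : Dec (z ≈ 0#) → z ≈ 0#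
        decide (yes z≈0) = z≈0
        decide (no z≉0)  = ⊥-elim (δ≉0 (*ₗ-cancel-0 z≉0 zδ≈0))

    record Realised (v : Triple) : Set where
      constructor realised
      field
        root    : Root Φ
        scale   : Carrier
        0<scale : 0# < scale
        root≈   : vec root ≈ᴹ scale *ₗ vector v

    realise-simple : ∀ j → Realised (simple j)
    realise-simple j = realised (α (σ j) ,ʳ ([] , σ j , ≈ᴹ-refl)) (p j ⁻¹) (⁻¹-positive (0<p j))
      (*ₗ-cancel (0<p j) (≈ᴹ-trans (≈ᴹ-sym (e≈ j)) (≈ᴹ-sym (vector-simple j))))

    realise-run : ∀ w {v} → Realised v → Realised (run w v)
    realise-run w {v} (realised r c 0<c r≈) = realised (_·_ Φ (map σ w) r) c 0<c
      (≈ᴹ-trans (act-cong (map σ w) r≈) (≈ᴹ-trans (act-* (map σ w) c (vector v)) (*ₗ-congˡ (act-vector w v))))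

    realise-neg : ∀ i k → Realised (triple (i , k)) → Realised (triple (negᴱ (i , k)))
    realise-neg i k (realised r c 0<c r≈) = realised (neg Φ r) c 0<c (≈ᴹ-trans (-ᴹ‿cong r≈)
      (≈ᴹ-trans (neg-* c _) (*ₗ-congˡ (≈ᴹ-trans (≈ᴹ-sym (lin-neg _ _ _)) (≈ᴹ-sym (lin-cong
        (trans (reflexive (≡.cong ι (dx-opp i))) (ι-neg (dx i)))
        (trans (reflexive (≡.cong ι (dy-opp i))) (ι-neg (dy i)))
        (ι-neg k)))))))

    realise-nat : ∀ i n → Realised (triple (i , + n))
    realise-nat i 0 = let w , j , eq = reach₀ i in ≡.subst Realised eq (realise-run w (realise-simple j))
    realise-nat i 1 = let w , j , eq = reach₁ i in ≡.subst Realised eq (realise-run w (realise-simple j))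
    realise-nat i (suc (suc n)) = let w , eq = climb i in ≡.subst Realised
      (≡.trans (run-raiseBy w (+ n) (triple (i , 0ℤ))) (≡.cong (raiseBy (+ n)) eq))
      (realise-run w (≡.subst Realised (≡.cong (λ k → dx i , dy i , k) (≡.sym (ℤP.+-identityˡ (+ n)))) (realise-nat i n)))

    realise : ∀ q → Realised (triple q)
    realise (i , + n)      = realise-nat i n
    realise (i , -[1+ n ]) = ≡.subst (λ i′ → Realised (triple (i′ , -[1+ n ]))) (opp-opp i)
      (realise-neg (opp i) (+ suc n) (realise-nat (opp i) (suc n)))

    Listed : Triple → Set
    Listed v = ∃[ q ] triple q ≡ v

    listed-run : ∀ w {v} → Listed v → Listed (run w v)
    listed-run []      l = l
    listed-run (j ∷ w) {v} l = step (listed-run w l)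
      where
      step : ∀ {v} → Listed v → Listed (reflect j v)
      -- The table `closed` inspects height zero; the height `k` is added afterwards, since
      -- reflections commute with raising.
      step ((i , k) , ≡.refl) = let i′ , eq = closed j i in (i′ , _) ,
        ≡.trans (≡.cong (raiseBy k) eq) (≡.trans (≡.sym (reflect-raiseBy j k (triple (i , 0ℤ))))
          (≡.cong (λ k′ → reflect j (dx i , dy i , k′)) (ℤP.+-identityˡ k)))

    cover : ∀ (r : Root Φ) → ∃₂ λ q ρ → 0# < ρ × vec r ≈ᴹ ρ *ₗ vector (triple q)
    cover (v ,ʳ (w , i , v≈)) = conclude (listed-run (map π w) (let i′ , eq = listed (π i) in (i′ , _) , eq))
      where
      c = p (π i) ⁻¹
      α≈ : α i ≈ᴹ c *ₗ vector (simple (π i))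
      α≈ = *ₗ-cancel (0<p (π i)) (≈ᴹ-trans (*ₗ-congˡ (≈ᴹ-reflexive (≡.cong α (≡.sym (σ-π i)))))
        (≈ᴹ-trans (≈ᴹ-sym (e≈ (π i))) (≈ᴹ-sym (vector-simple (π i)))))
      σ∘π : ∀ w → map σ (map π w) ≡ w
      σ∘π []      = ≡.refl
      σ∘π (i ∷ w) = ≡.cong₂ _∷_ (σ-π i) (σ∘π w)
      v≈′ : v ≈ᴹ c *ₗ vector (run (map π w) (simple (π i)))
      v≈′ = begin
        v                                                     ≈⟨ v≈ ⟩
        act w (α i)                                           ≈⟨ act-cong w α≈ ⟩
        act w (c *ₗ vector (simple (π i)))                    ≈⟨ act-* w c _ ⟩
        c *ₗ act w (vector (simple (π i)))                    ≡⟨ ≡.cong (λ w′ → c *ₗ act w′ (vector (simple (π i)))) (σ∘π w) ⟨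
        c *ₗ act (map σ (map π w)) (vector (simple (π i)))    ≈⟨ *ₗ-congˡ (act-vector (map π w) (simple (π i))) ⟩
        c *ₗ vector (run (map π w) (simple (π i)))            ∎
        where open SetoidReasoning ≈ᴹ-setoid
      conclude : Listed (run (map π w) (simple (π i))) → _
      conclude (q , eq) = q , c , ⁻¹-positive (0<p (π i)) ,
        ≈ᴹ-trans v≈′ (*ₗ-congˡ (≈ᴹ-reflexive (≡.cong vector (≡.sym eq))))

    coordinates : Coordinates directions
    coordinates = record
      { e₁          = e (# 1)
      ; e₂          = e (# 2)
      ; δ           = δ
      ; independent = independent
      ; el          = λ q → Realised.root (realise q)
      ; el-vec      = λ q → Realised.scale (realise q) , Realised.0<scale (realise q) , Realised.root≈ (realise q)
      ; cover       = cover
      }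

-- Cosines of the angles π/m.

module Angles (em : ExcludedMiddle 0ℓ) {K : CompleteOrderedField} (T : Trigonometry K) where
  open CompleteOrderedField K hiding (zero)
  open OrderedFieldProperties K
  open IntegerEmbedding K
  open Solver using (solve; _:=_; _:+_; _:*_; :-_; _:-_; con)
  open OrderedField em K
  open Trigonometry T
  open RingProperties ring using (-‿involutive; -0#≈0#)
  open SetoidReasoning setoid

  private
    h : Carrier
    h = π / 2#

    0<2 : 0# < 2#
    0<2 = 0<-+ 0<1 0≤1

    h+h≈π : h + h ≈ π
    h+h≈π = begin
      π * 2# ⁻¹ + π * 2# ⁻¹   ≈⟨ solve 2 (λ p t → p :* t :+ p :* t := p :* ((con 1ℤ :+ con 1ℤ) :* t)) refl π (2# ⁻¹) ⟩
      π * (2# * 2# ⁻¹)        ≈⟨ *-congˡ (⁻¹-inverse (0<⇒≉0 0<2)) ⟩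
      π * 1#                  ≈⟨ *-identityʳ π ⟩
      π                       ∎

    square≈0 : ∀ {x} → x * x ≈ 0# → x ≈ 0#
    square≈0 {x} xx≈0 with x ≟ 0#
    ... | yes x≈0 = x≈0
    ... | no x≉0  = *-cancelˡ-0 x≉0 xx≈0

  cos²+sin² : ∀ x → cos x * cos x + sin x * sin x ≈ 1#
  cos²+sin² x = trans (sym (cos-‿- x x)) (trans (cos-cong (-‿inverseʳ x)) cos-0)

  private
    complement≈0 : ∀ {a b} → a * a ≈ 1# → a * a + b * b ≈ 1# → b ≈ 0#
    complement≈0 {a} {b} aa≈1 eq = square≈0 (begin
      b * b                    ≈⟨ solve 2 (λ a b → b :* b := (a :* a :+ b :* b) :- a :* a) refl a b ⟩
      (a * a + b * b) + - (a * a)  ≈⟨ +-cong eq (-‿cong aa≈1) ⟩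
      1# + - 1#                ≈⟨ -‿inverseʳ 1# ⟩
      0#                       ∎)

  sin-0 : sin 0# ≈ 0#
  sin-0 = complement≈0 (trans (*-cong cos-0 cos-0) (*-identityʳ 1#)) (cos²+sin² 0#)

  sin-π : sin π ≈ 0#
  sin-π = complement≈0 (trans (*-cong cos-π cos-π) (solve 0 ((:- con 1ℤ) :* (:- con 1ℤ) := con 1ℤ) refl)) (cos²+sin² π)

  cos-π/2 : cos h ≈ 0#
  cos-π/2 = complement≈0 (trans (*-cong sin-π/2 sin-π/2) (*-identityʳ 1#)) (trans (+-comm _ _) (cos²+sin² h))

  cos-even : ∀ x → cos (- x) ≈ cos x
  cos-even x = begin
    cos (- x)                          ≈⟨ cos-cong (+-identityˡ (- x)) ⟨
    cos (0# + - x)                     ≈⟨ cos-‿- x 0# ⟩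
    cos 0# * cos x + sin 0# * sin x    ≈⟨ +-cong (*-congʳ cos-0) (*-congʳ sin-0) ⟩
    1# * cos x + 0# * sin x            ≈⟨ solve 2 (λ c s → con 1ℤ :* c :+ con 0ℤ :* s := c) refl (cos x) (sin x) ⟩
    cos x                              ∎

  cos-x-π : ∀ x → cos (x + - π) ≈ - cos x
  cos-x-π x = begin
    cos (x + - π)                    ≈⟨ cos-‿- π x ⟩
    cos x * cos π + sin x * sin π    ≈⟨ +-cong (*-congˡ cos-π) (*-congˡ sin-π) ⟩
    cos x * - 1# + sin x * 0#        ≈⟨ solve 2 (λ c s → c :* (:- con 1ℤ) :+ s :* con 0ℤ := :- c) refl (cos x) (sin x) ⟩
    - cos x                          ∎

  cos-x-π/2 : ∀ x → cos (x + - h) ≈ sin x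
  cos-x-π/2 x = begin
    cos (x + - h)                    ≈⟨ cos-‿- h x ⟩
    cos x * cos h + sin x * sin h    ≈⟨ +-cong (*-congˡ cos-π/2) (*-congˡ sin-π/2) ⟩
    cos x * 0# + sin x * 1#          ≈⟨ solve 2 (λ c s → c :* con 0ℤ :+ s :* con 1ℤ := s) refl (cos x) (sin x) ⟩
    sin x                            ∎

  -- The addition formula at hand is that of the cosine of a difference, so the sine is reached as a
  -- cosine shifted by π/2; evenness of the cosine and its shift by π give the sign.
  sin-odd : ∀ x → sin (- x) ≈ - sin x
  sin-odd x = begin
    sin (- x)                 ≈⟨ cos-x-π/2 (- x) ⟨
    cos (- x + - h)           ≈⟨ cos-cong (solve 2 (λ x h → :- x :+ :- h := :- (x :+ h)) refl x h) ⟩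
    cos (- (x + h))           ≈⟨ cos-even (x + h) ⟩
    cos (x + h)               ≈⟨ -‿involutive _ ⟨
    - - cos (x + h)           ≈⟨ -‿cong (cos-x-π (x + h)) ⟨
    - cos (x + h + - π)       ≈⟨ -‿cong (cos-cong (trans (+-congˡ (-‿cong (sym h+h≈π)))
                                    (solve 2 (λ x h → (x :+ h) :+ :- (h :+ h) := x :+ :- h) refl x h))) ⟩
    - cos (x + - h)           ≈⟨ -‿cong (cos-x-π/2 x) ⟩
    - sin x                   ∎

  cos-double : ∀ x → cos (x + x) ≈ 2# * (cos x * cos x) + - 1#
  cos-double x = begin
    cos (x + x)                              ≈⟨ cos-cong (+-congˡ (-‿involutive x)) ⟨
    cos (x + - - x)                          ≈⟨ cos-‿- (- x) x ⟩
    cos x * cos (- x) + sin x * sin (- x)    ≈⟨ +-cong (*-congˡ (cos-even x)) (*-congˡ (sin-odd x)) ⟩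
    cos x * cos x + sin x * - sin x          ≈⟨ solve 2 (λ c s → c :* c :+ s :* (:- s)
                                                := (con 1ℤ :+ con 1ℤ) :* (c :* c) :- (c :* c :+ s :* s)) refl (cos x) (sin x) ⟩
    2# * (cos x * cos x) + - (cos x * cos x + sin x * sin x)  ≈⟨ +-congˡ (-‿cong (cos²+sin² x)) ⟩
    2# * (cos x * cos x) + - 1#              ∎

  private
    module _ (m : ℕ) where
      M x : Carrier
      M = m ×ℕ 1#
      x = π / M

      M≈ : M ≈ ι (+ m)
      M≈ = Mult.×ᵤ≈× semiring m 1#

    half-angle : ∀ m → 2 ℕ.≤ m → 0# < x m × x m * ι (+ m) ≈ π
    half-angle m 2≤m = *-positive 0<π (⁻¹-positive 0<M) , (begin
      π * M m ⁻¹ * ι (+ m)   ≈⟨ *-congˡ (M≈ m) ⟨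
      π * M m ⁻¹ * M m       ≈⟨ trans (*-assoc π _ _) (*-congˡ (trans (*-comm _ _) (⁻¹-inverse (0<⇒≉0 0<M)))) ⟩
      π * 1#                 ≈⟨ *-identityʳ π ⟩
      π                      ∎)
      where
      0<M : 0# < M m
      0<M = 0<-resp (sym (M≈ m)) (0<ι (Int.+<+ (ℕP.≤-trans (ℕ.s≤s ℕ.z≤n) 2≤m)))

    half-cancel : ∀ {a} → 0# ≤ a + a → 0# ≤ a
    half-cancel {a} 0≤2a = 0≤-cancel 0<2 (0≤-resp (solve 1 (λ a → a :+ a := (con 1ℤ :+ con 1ℤ) :* a) refl a) 0≤2a)

    x<h : ∀ {x} → 0# < x → 0# ≤ h + - (x + x) → x < h
    x<h {x} 0<x 0≤ = 0≤-⇒≤ (proj₁ 0<h-x) , λ x≈h → proj₂ 0<h-x (sym (trans (+-congʳ (sym x≈h)) (-‿inverseʳ x)))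
      where
      0<h-x : 0# < h + - x
      0<h-x = 0<-resp (solve 2 (λ x h → x :+ (h :- (x :+ x)) := h :- x) refl x h) (0<-+ 0<x 0≤)

    -- For m ≥ 4 the angle 2π/m is at most π/2, so 2 cos²(π/m) - 1 ≥ 0.
    cos-small : ∀ m → 4 ℕ.≤ m → 0# < cos (x m) × 1# ≤ 2# * (cos (x m) * cos (x m))
    cos-small m 4≤m = 0<cos 0<x (x<h 0<x 0≤h-2x) , 0≤-⇒≤ (0≤-resp (cos-double (x m)) (0≤cos-2x (0≤-split 0≤h-2x)))
      where
      0<x : 0# < x m
      0<x = proj₁ (half-angle m (ℕP.≤-trans (ℕ.s≤s (ℕ.s≤s ℕ.z≤n)) 4≤m))

      k : ℕ
      k = m ℕ.∸ 4

      π≈ : π ≈ x m * ι (+ k) + x m * ι (+ 4)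
      π≈ = begin
        π                                  ≈⟨ proj₂ (half-angle m (ℕP.≤-trans (ℕ.s≤s (ℕ.s≤s ℕ.z≤n)) 4≤m)) ⟨
        x m * ι (+ m)                      ≡⟨ ≡.cong (λ n → x m * ι (+ n)) (≡.sym (ℕP.m∸n+n≡m 4≤m)) ⟩
        x m * ι (+ k Int.+ + 4)            ≈⟨ *-congˡ (ι-+ (+ k) (+ 4)) ⟩
        x m * (ι (+ k) + ι (+ 4))          ≈⟨ distribˡ (x m) _ _ ⟩
        x m * ι (+ k) + x m * ι (+ 4)      ∎

      0≤h-2x : 0# ≤ h + - (x m + x m)
      0≤h-2x = half-cancel (0≤-resp (begin
        x m * ι (+ k)                                                 ≈⟨ solve 2 (λ x y → y := (y :+ x :* con (+ 4)) :- x :* con (+ 4)) refl (x m) (x m * ι (+ k)) ⟩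
        (x m * ι (+ k) + x m * ι (+ 4)) + - (x m * ι (+ 4))           ≈⟨ +-congʳ (trans (sym π≈) (sym h+h≈π)) ⟩
        (h + h) + - (x m * ι (+ 4))                                   ≈⟨ solve 2 (λ x h → (h :+ h) :- x :* con (+ 4) := (h :- (x :+ x)) :+ (h :- (x :+ x))) refl (x m) h ⟩
        (h + - (x m + x m)) + (h + - (x m + x m))                     ∎)
        (*-nonNeg (proj₁ 0<x) (0≤ι {+ k} (Int.+≤+ ℕ.z≤n))))

      0≤cos-2x : h + - (x m + x m) ≈ 0# ⊎ 0# < h + - (x m + x m) → 0# ≤ cos (x m + x m)
      0≤cos-2x (inj₁ e) = ≤-reflexive (sym (trans (cos-cong (begin
        x m + x m                        ≈⟨ solve 2 (λ x h → x := h :- (h :- x)) refl (x m + x m) h ⟩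
        h + - (h + - (x m + x m))        ≈⟨ +-congˡ (trans (-‿cong e) -0#≈0#) ⟩
        h + 0#                           ≈⟨ +-identityʳ h ⟩
        h                                ∎)) cos-π/2))
      0≤cos-2x (inj₂ 0<) = proj₁ (0<cos (0<-+ 0<x (proj₁ 0<x))
        (0≤-⇒≤ (proj₁ 0<) , λ 2x≈h → proj₂ 0< (sym (trans (+-congʳ (sym 2x≈h)) (-‿inverseʳ _)))))

    -- c = cos(π/3) satisfies 2c² - 1 = cos(2π/3) = - c.
    cos-third : 2# * cos (x 3) ≈ 1#
    cos-third = begin
      2# * c                    ≈⟨ solve 1 (λ c → (con 1ℤ :+ con 1ℤ) :* c := ((con 1ℤ :+ con 1ℤ) :* c :- con 1ℤ) :+ con 1ℤ) refl c ⟩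
      (2# * c + - 1#) + 1#      ≈⟨ +-congʳ (*-cancelˡ-0 (0<⇒≉0 0<c+1) factor) ⟩
      0# + 1#                   ≈⟨ +-identityˡ 1# ⟩
      1#                        ∎
      where
      c : Carrier
      c = cos (x 3)
      0<x : 0# < x 3
      0<x = proj₁ (half-angle 3 (ℕ.s≤s (ℕ.s≤s ℕ.z≤n)))
      3x≈π : x 3 * ι (+ 3) ≈ π
      3x≈π = proj₂ (half-angle 3 (ℕ.s≤s (ℕ.s≤s ℕ.z≤n)))
      0<h-x : 0# < h + - x 3
      0<h-x = 0<-cancel 0<2 (0<-resp (begin
        x 3                            ≈⟨ solve 1 (λ x → x := x :* con (+ 3) :- (x :+ x)) refl (x 3) ⟩
        x 3 * ι (+ 3) + - (x 3 + x 3)  ≈⟨ +-congʳ (trans 3x≈π (sym h+h≈π)) ⟩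
        (h + h) + - (x 3 + x 3)        ≈⟨ solve 2 (λ h x → (h :+ h) :- (x :+ x) := (con 1ℤ :+ con 1ℤ) :* (h :- x)) refl h (x 3) ⟩
        2# * (h + - x 3)               ∎) 0<x)
      0<c+1 : 0# < c + 1#
      0<c+1 = 0<-+ (0<cos 0<x (0≤-⇒≤ (proj₁ 0<h-x) ,
        λ x≈h → proj₂ 0<h-x (sym (trans (+-congʳ (sym x≈h)) (-‿inverseʳ _))))) 0≤1
      double : 2# * (c * c) + - 1# ≈ - c
      double = begin
        2# * (c * c) + - 1#        ≈⟨ cos-double (x 3) ⟨
        cos (x 3 + x 3)            ≈⟨ cos-cong (trans (solve 1 (λ x → x :+ x := :- (x :- x :* con (+ 3))) refl (x 3))
                                        (-‿cong (+-congˡ (-‿cong 3x≈π)))) ⟩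
        cos (- (x 3 + - π))        ≈⟨ cos-even _ ⟩
        cos (x 3 + - π)            ≈⟨ cos-x-π (x 3) ⟩
        - c                        ∎
      factor : (c + 1#) * (2# * c + - 1#) ≈ 0#
      factor = begin
        (c + 1#) * (2# * c + - 1#)     ≈⟨ solve 1 (λ c → (c :+ con 1ℤ) :* ((con 1ℤ :+ con 1ℤ) :* c :- con 1ℤ)
                                           := ((con 1ℤ :+ con 1ℤ) :* (c :* c) :- con 1ℤ) :+ c) refl c ⟩
        (2# * (c * c) + - 1#) + c      ≈⟨ +-congʳ double ⟩
        - c + c                        ≈⟨ -‿inverseˡ c ⟩
        0#                             ∎

  -- For m ≥ 4 the classification works with positivity and this lower bound. The exact values
  -- belonging to m = 4 and m = 6 come out of the Gram determinant.
  cos-cases : ∀ m → 2 ℕ.≤ m → let c = cos (π / (m ×ℕ 1#)) in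
              c ≈ 0# ⊎ 2# * c ≈ 1# ⊎ (0# < c × 1# ≤ 2# * (c * c))
  cos-cases 0 ()
  cos-cases 1 (ℕ.s≤s ())
  cos-cases 2 _ = inj₁ (trans (cos-cong (*-congˡ (⁻¹-cong (M≈ 2)))) cos-π/2)
  cos-cases 3 _ = inj₂ (inj₁ cos-third)
  cos-cases m@(suc (suc (suc (suc k)))) _ =
    inj₂ (inj₂ (cos-small m (ℕ.s≤s (ℕ.s≤s (ℕ.s≤s (ℕ.s≤s ℕ.z≤n))))))

  module _ {V : Module (CompleteOrderedField.commutativeRing K) 0ℓ 0ℓ} {rank : ℕ} (Φ : RootSystem T V rank) where
    open RootSystem Φ

    -- A bond with m = 3, or one with m ≥ 4 or infinite, expressed in Gram entries without square
    -- roots.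
    data Oblique (i j : Fin rank) : Set where
      third : 0# < - ⟪ α i , α j ⟫ →
              ι (+ 4) * (⟪ α i , α j ⟫ * ⟪ α i , α j ⟫) ≈ ⟪ α i , α i ⟫ * ⟪ α j , α j ⟫ → Oblique i j
      large : 0# < - ⟪ α i , α j ⟫ →
              ⟪ α i , α i ⟫ * ⟪ α j , α j ⟫ ≤ 2# * (⟪ α i , α j ⟫ * ⟪ α i , α j ⟫) → Oblique i j

    angle : ∀ i j → i ≢ j → ⟪ α i , α j ⟫ ≈ 0# ⊎ Oblique i j
    angle i j i≢j with α-angles i j i≢j
    ... | r , 0≤r , rr≈NN , quotient = by-quotient quotient
      where
      b NN : Carrier
      b  = ⟪ α i , α j ⟫
      NN = ⟪ α i , α i ⟫ * ⟪ α j , α j ⟫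

      0<r : 0# < r
      0<r = 0≤r , λ 0≈r → 0<⇒≉0 (*-positive (α-positive i) (α-positive j))
        (trans (sym rr≈NN) (trans (*-congʳ (sym 0≈r)) (zeroˡ r)))

      b≈ : ∀ {c} → b / r ≈ - c → b ≈ - (c * r)
      b≈ {c} e = begin
        b                  ≈⟨ *-identityʳ b ⟨
        b * 1#             ≈⟨ *-congˡ (trans (*-comm _ _) (⁻¹-inverse (0<⇒≉0 0<r))) ⟨
        b * (r ⁻¹ * r)     ≈⟨ *-assoc b _ _ ⟨
        b * r ⁻¹ * r       ≈⟨ *-congʳ e ⟩
        - c * r            ≈⟨ solve 2 (λ c r → (:- c) :* r := :- (c :* r)) refl c r ⟩
        - (c * r)          ∎

      negative : ∀ {c} → b / r ≈ - c → 0# < c → 0# < - b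
      negative e 0<c = 0<-resp (trans (sym (-‿involutive _)) (-‿cong (sym (b≈ e)))) (*-positive 0<c 0<r)

      bb≈ : ∀ {c} → b / r ≈ - c → b * b ≈ c * c * NN
      bb≈ {c} e = begin
        b * b                        ≈⟨ *-cong (b≈ e) (b≈ e) ⟩
        - (c * r) * - (c * r)        ≈⟨ solve 2 (λ c r → (:- (c :* r)) :* (:- (c :* r)) := c :* c :* (r :* r)) refl c r ⟩
        c * c * (r * r)              ≈⟨ *-congˡ rr≈NN ⟩
        c * c * NN                   ∎

      large′ : ∀ {c} → b / r ≈ - c → 0# < c → 1# ≤ 2# * (c * c) → Oblique i j
      large′ {c} e 0<c 1≤ = large (negative e 0<c) (0≤-⇒≤ (0≤-resp
        (trans (solve 2 (λ c n → n :* ((con 1ℤ :+ con 1ℤ) :* (c :* c) :- con 1ℤ) := (con 1ℤ :+ con 1ℤ) :* (c :* c :* n) :- n) refl c NN)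
               (+-congʳ (*-congˡ (sym (bb≈ e)))))
        (*-nonNeg (proj₁ (*-positive (α-positive i) (α-positive j))) (≤⇒0≤- 1≤))))

      by-cos : ∀ c → b / r ≈ - c → c ≈ 0# ⊎ 2# * c ≈ 1# ⊎ (0# < c × 1# ≤ 2# * (c * c)) → b ≈ 0# ⊎ Oblique i j
      by-cos c e (inj₁ c≈0) = inj₁ (trans (b≈ e) (trans (-‿cong (trans (*-congʳ c≈0) (zeroˡ r))) -0#≈0#))
      by-cos c e (inj₂ (inj₁ 2c≈1)) = inj₂ (third (negative e (0<-cancel 0<2 (0<-resp (sym 2c≈1) 0<1))) (begin
        ι (+ 4) * (b * b)              ≈⟨ *-congˡ (bb≈ e) ⟩
        ι (+ 4) * (c * c * NN)         ≈⟨ solve 2 (λ c n → con (+ 4) :* (c :* c :* n) := ((con 1ℤ :+ con 1ℤ) :* c) :* ((con 1ℤ :+ con 1ℤ) :* c) :* n) refl c NN ⟩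
        (2# * c) * (2# * c) * NN       ≈⟨ *-congʳ (*-cong 2c≈1 2c≈1) ⟩
        1# * 1# * NN                   ≈⟨ solve 1 (λ n → con 1ℤ :* con 1ℤ :* n := n) refl NN ⟩
        NN                             ∎))
      by-cos c e (inj₂ (inj₂ (0<c , 1≤))) = inj₂ (large′ e 0<c 1≤)

      by-quotient : (∃[ m ] (2 ℕ.≤ m × b / r ≈ - cos (π / (m ×ℕ 1#)))) ⊎ b / r ≤ - 1# → b ≈ 0# ⊎ Oblique i j
      by-quotient (inj₁ (m , 2≤m , e)) = by-cos _ e (cos-cases m 2≤m)
      by-quotient (inj₂ q≤-1) = inj₂ (large′ (sym (-‿involutive (b / r)))
        (0<-resp (solve 1 (λ d → con 1ℤ :+ (:- d :- con 1ℤ) := :- d) refl (b / r)) (0<-+ 0<1 0≤d))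
        -- With d = - b / r - 1 ≥ 0, the slack 2 (d + 1)² - 1 equals 1 + 4 d + 2 d².
        (0≤-⇒≤ (0≤-resp
          (trans (solve 1 (λ d → con 1ℤ :+ (con (+ 4) :* d :+ (con 1ℤ :+ con 1ℤ) :* (d :* d))
                     := (con 1ℤ :+ con 1ℤ) :* ((d :+ con 1ℤ) :* (d :+ con 1ℤ)) :- con 1ℤ) refl (- (b / r) + - 1#))
            (+-congʳ (*-congˡ (*-cong (cancel (- (b / r))) (cancel (- (b / r)))))))
          (0≤-+ 0≤1 (0≤-+ (*-nonNeg (0≤ι {+ 4} (Int.+≤+ ℕ.z≤n)) 0≤d) (*-nonNeg (proj₁ 0<2) (*-nonNeg 0≤d 0≤d)))))))
        where
        cancel : ∀ d → (d + - 1#) + 1# ≈ d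
        cancel = solve 1 (λ d → (d :- con 1ℤ) :+ con 1ℤ := d) refl
        0≤d : 0# ≤ - (b / r) + - 1#
        0≤d = 0≤-resp (solve 1 (λ q → :- con 1ℤ :- q := :- q :- con 1ℤ) refl (b / r)) (≤⇒0≤- q≤-1)

-- The Gram determinant and connectedness of the diagram.

module Classification (em : ExcludedMiddle 0ℓ) {K : CompleteOrderedField} {T : Trigonometry K}
                      {V : Module (CompleteOrderedField.commutativeRing K) 0ℓ 0ℓ}
                      (Φ : RootSystem T V 3) (affine : Affine Φ) where
  open CompleteOrderedField K hiding (zero)
  open OrderedFieldProperties K
  open IntegerEmbedding K
  open Solver using (solve; _:=_; _:+_; _:*_; :-_; _:-_; con)
  open OrderedField em K
  open RingProperties ring using (-‿involutive; -0#≈0#)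
  open Module V
  open LinearAlgebra K V
  open LinearExpressions K V
  open RootSystem Φ
  open Roots em Φ
  open Affine affine
  open Angles em T
  open Framed em Φ using (Frame)

  private
    b : Fin 3 → Fin 3 → Carrier
    b i j = ⟪ α i , α j ⟫

    N : Fin 3 → Carrier
    N i = b i i

    b-sym : ∀ i j → b i j ≈ b j i
    b-sym i j = ⟪⟫-sym (α i) (α j)

  -- The determinant of the Gram matrix of three simple roots.
  det : Fin 3 → Fin 3 → Fin 3 → Carrier
  det i j k = N i * N j * N k + 2# * (b i j * b j k * b i k)
              + - (N i * (b j k * b j k)) + - (N j * (b i k * b i k)) + - (N k * (b i j * b i j))

  det-swap₂₃ : ∀ i j k → det i j k ≈ det i k j
  det-swap₂₃ i j k = trans
    (solve 6 (λ n₁ n₂ n₃ x y z →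
      n₁ :* n₂ :* n₃ :+ (con 1ℤ :+ con 1ℤ) :* (x :* y :* z) :+ :- (n₁ :* (y :* y)) :+ :- (n₂ :* (z :* z)) :+ :- (n₃ :* (x :* x)) :=
      n₁ :* n₃ :* n₂ :+ (con 1ℤ :+ con 1ℤ) :* (z :* y :* x) :+ :- (n₁ :* (y :* y)) :+ :- (n₃ :* (x :* x)) :+ :- (n₂ :* (z :* z)))
      refl (N i) (N j) (N k) (b i j) (b j k) (b i k))
    (+-congʳ (+-congʳ (+-cong (+-congˡ (*-congˡ (*-congʳ (*-congˡ (b-sym j k))))) (-‿cong (*-congˡ (*-cong (b-sym j k) (b-sym j k)))))))

  det-swap₁₂ : ∀ i j k → det i j k ≈ det j i k
  det-swap₁₂ i j k = trans
    (solve 6 (λ n₁ n₂ n₃ x y z →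
      n₁ :* n₂ :* n₃ :+ (con 1ℤ :+ con 1ℤ) :* (x :* y :* z) :+ :- (n₁ :* (y :* y)) :+ :- (n₂ :* (z :* z)) :+ :- (n₃ :* (x :* x)) :=
      n₂ :* n₁ :* n₃ :+ (con 1ℤ :+ con 1ℤ) :* (x :* z :* y) :+ :- (n₂ :* (z :* z)) :+ :- (n₁ :* (y :* y)) :+ :- (n₃ :* (x :* x)))
      refl (N i) (N j) (N k) (b i j) (b j k) (b i k))
    (+-cong (+-congʳ (+-congʳ (+-congˡ (*-congˡ (*-congʳ (*-congʳ (b-sym i j))))))) (-‿cong (*-congˡ (*-cong (b-sym i j) (b-sym i j)))))

  private
    Combined : Pred Carrierᴹ 0ℓ
    Combined v = ∃ λ (x : Fin 3 → Carrier) → v ≈ᴹ linComb x α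

    unit : Fin 3 → Fin 3 → Carrier
    unit i = coefficient (var i)

    scaled-unit : ∀ c i → c *ₗ α i ≈ᴹ linComb (λ j → c * unit i j) α
    scaled-unit c i = ≈ᴹ-trans (*ₗ-congˡ (≈ᴹ-sym (lookup-α i)))
      (≈ᴹ-trans (normal-form (c ⊛ var i) as-vec)
        (linComb-cong {3} {λ j → c * unit i j} {λ j → c * unit i j} {lookup as-vec} {α} (λ _ → refl) lookup-α))
      where
      as-vec : Vec Carrierᴹ 3
      as-vec = α zero ∷ α (suc zero) ∷ α (suc (suc zero)) ∷ []

      lookup-α : ∀ i → lookup as-vec i ≈ᴹ α i
      lookup-α zero             = ≈ᴹ-refl
      lookup-α (suc zero)       = ≈ᴹ-refl
      lookup-α (suc (suc zero)) = ≈ᴹ-refl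

    span-combined : ∀ n (c : Vector Carrier n) (a : Vector Carrierᴹ n) → (∀ l → Π (a l)) → Combined (linComb c a)
    span-combined zero    c a Πa = (λ _ → 0#) , linComb-0 α
    span-combined (suc n) c a Πa =
      let i , a≈ = Πa zero
          x , v≈ = span-combined n (c ∘ suc) (a ∘ suc) (Πa ∘ suc)
      in (λ j → c zero * unit i j + x j) ,
         ≈ᴹ-trans (+ᴹ-cong (≈ᴹ-trans (*ₗ-congˡ a≈) (scaled-unit (c zero) i)) v≈)
                  (linComb-+ (λ j → c zero * unit i j) x α)

    -- A basis vector of the radical is written in the simple roots. Not all its coefficients
    -- vanish, and pairing it with each simple root shows that they form a null vector of the Gram
    -- matrix.
    singular-vector : ∃ λ (x : Fin 3 → Carrier) → ¬ (∀ i → x i ≈ 0#) ×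
      (∀ j → x zero * b zero j + (x (suc zero) * b (suc zero) j + x (suc (suc zero)) * b (suc (suc zero)) j) ≈ 0#)
    singular-vector = from-basis radicalDimension
      where
      from-basis : HasDimension 1 (Radical Φ) → _
      from-basis (basis , radical , independent , _) = from-span (proj₁ (radical zero))
        where
        v : Carrierᴹ
        v = basis zero

        v≉0 : ¬ (v ≈ᴹ 0ᴹ)
        v≉0 v≈0 = 0≉1 (sym (independent (λ _ → 1#) (≈ᴹ-trans (+ᴹ-identityʳ _) (≈ᴹ-trans (*ₗ-identityˡ v) v≈0)) zero))

        from-span : Span Π v → _
        from-span (n , c , a , Πa , v≈) = from-combined (span-combined n c a Πa)
          where
          from-combined : Combined (linComb c a) → _
          from-combined (x , eq) = x ,
            (λ x≈0 → v≉0 (≈ᴹ-trans v≈x (≈ᴹ-trans (linComb-cong {3} {x} {λ _ → 0#} {α} {α} x≈0 (λ _ → ≈ᴹ-refl)) (≈ᴹ-sym (linComb-0 α))))) ,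
            (λ j → trans (sym (pair j)) (proj₂ (radical zero) (α j)
              (1 , (λ _ → 1#) , (λ _ → α j) , (λ _ → j , ≈ᴹ-refl) , ≈ᴹ-sym (≈ᴹ-trans (+ᴹ-identityʳ _) (*ₗ-identityˡ _)))))
            where
            v≈x : v ≈ᴹ linComb x α
            v≈x = ≈ᴹ-trans v≈ eq
            pair : ∀ j → ⟪ v , α j ⟫ ≈ x zero * b zero j + (x (suc zero) * b (suc zero) j + x (suc (suc zero)) * b (suc (suc zero)) j)
            pair j = trans (⟪⟫-cong (≈ᴹ-trans v≈x (+ᴹ-congˡ (+ᴹ-congˡ (+ᴹ-identityʳ _)))) ≈ᴹ-refl)
              (trans (⟪⟫-+ˡ _ _ _) (+-cong (⟪⟫-*ˡ _ _ _) (trans (⟪⟫-+ˡ _ _ _) (+-cong (⟪⟫-*ˡ _ _ _) (⟪⟫-*ˡ _ _ _)))))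

  -- The adjugate of the Gram matrix times the null vector.
  det≈0 : det (# 0) (# 1) (# 2) ≈ 0#
  det≈0 = from singular-vector
    where
    n₀ = N (# 0)
    n₁ = N (# 1)
    n₂ = N (# 2)
    p = b (# 0) (# 1)
    q = b (# 1) (# 2)
    r = b (# 0) (# 2)
    D = det (# 0) (# 1) (# 2)

    from : (∃ λ (x : Fin 3 → Carrier) → ¬ (∀ i → x i ≈ 0#) ×
      (∀ j → x zero * b zero j + (x (suc zero) * b (suc zero) j + x (suc (suc zero)) * b (suc (suc zero)) j) ≈ 0#)) → D ≈ 0#
    from (x , x≢0 , eq) = decide (D ≟ 0#)
      where
      x₀ = x zero
      x₁ = x (suc zero)
      x₂ = x (suc (suc zero))
      E₀ : x₀ * n₀ + (x₁ * p + x₂ * r) ≈ 0#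
      E₀ = trans (+-congˡ (+-cong (*-congˡ (b-sym (# 0) (# 1))) (*-congˡ (b-sym (# 0) (# 2))))) (eq (# 0))
      E₁ : x₀ * p + (x₁ * n₁ + x₂ * q) ≈ 0#
      E₁ = trans (+-congˡ (+-congˡ (*-congˡ (b-sym (# 1) (# 2))))) (eq (# 1))
      E₂ : x₀ * r + (x₁ * q + x₂ * n₂) ≈ 0#
      E₂ = eq (# 2)

      zero-combination : ∀ {a c d e f g} → e ≈ 0# → f ≈ 0# → g ≈ 0# → a * e + c * f + d * g ≈ 0#
      zero-combination {a} {c} {d} e f g = trans (+-cong (+-cong (*-congˡ e) (*-congˡ f)) (*-congˡ g))
        (solve 3 (λ a c d → a :* con 0ℤ :+ c :* con 0ℤ :+ d :* con 0ℤ := con 0ℤ) refl a c d)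

      Dx : ∀ i → D * x i ≈ 0#
      Dx zero = trans (solve 9 (λ n₀ n₁ n₂ p q r x₀ x₁ x₂ →
        (n₀ :* n₁ :* n₂ :+ (con 1ℤ :+ con 1ℤ) :* (p :* q :* r) :+ :- (n₀ :* (q :* q)) :+ :- (n₁ :* (r :* r)) :+ :- (n₂ :* (p :* p))) :* x₀ :=
        (n₁ :* n₂ :- q :* q) :* (x₀ :* n₀ :+ (x₁ :* p :+ x₂ :* r)) :+ (q :* r :- p :* n₂) :* (x₀ :* p :+ (x₁ :* n₁ :+ x₂ :* q))
          :+ (p :* q :- n₁ :* r) :* (x₀ :* r :+ (x₁ :* q :+ x₂ :* n₂)))
        refl n₀ n₁ n₂ p q r x₀ x₁ x₂) (zero-combination E₀ E₁ E₂)
      Dx (suc zero) = trans (solve 9 (λ n₀ n₁ n₂ p q r x₀ x₁ x₂ →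
        (n₀ :* n₁ :* n₂ :+ (con 1ℤ :+ con 1ℤ) :* (p :* q :* r) :+ :- (n₀ :* (q :* q)) :+ :- (n₁ :* (r :* r)) :+ :- (n₂ :* (p :* p))) :* x₁ :=
        (q :* r :- p :* n₂) :* (x₀ :* n₀ :+ (x₁ :* p :+ x₂ :* r)) :+ (n₀ :* n₂ :- r :* r) :* (x₀ :* p :+ (x₁ :* n₁ :+ x₂ :* q))
          :+ (p :* r :- n₀ :* q) :* (x₀ :* r :+ (x₁ :* q :+ x₂ :* n₂)))
        refl n₀ n₁ n₂ p q r x₀ x₁ x₂) (zero-combination E₀ E₁ E₂)
      Dx (suc (suc zero)) = trans (solve 9 (λ n₀ n₁ n₂ p q r x₀ x₁ x₂ →
        (n₀ :* n₁ :* n₂ :+ (con 1ℤ :+ con 1ℤ) :* (p :* q :* r) :+ :- (n₀ :* (q :* q)) :+ :- (n₁ :* (r :* r)) :+ :- (n₂ :* (p :* p))) :* x₂ :=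
        (p :* q :- n₁ :* r) :* (x₀ :* n₀ :+ (x₁ :* p :+ x₂ :* r)) :+ (p :* r :- n₀ :* q) :* (x₀ :* p :+ (x₁ :* n₁ :+ x₂ :* q))
          :+ (n₀ :* n₁ :- p :* p) :* (x₀ :* r :+ (x₁ :* q :+ x₂ :* n₂)))
        refl n₀ n₁ n₂ p q r x₀ x₁ x₂) (zero-combination E₀ E₁ E₂)

      decide : Dec (D ≈ 0#) → D ≈ 0#
      decide (yes D≈0) = D≈0
      decide (no D≉0)  = ⊥-elim (x≢0 (λ i → *-cancelˡ-0 D≉0 (Dx i)))

  -- Each coroot functional vanishes on the other root, so both products subtract the same two
  -- multiples, in either order.
  orthogonal-commute : ∀ i j → b i j ≈ 0# → ∀ v → s i (s j v) ≈ᴹ s j (s i v)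
  orthogonal-commute i j b≈0 v = ≈ᴹ-trans (expand i j b≈0)
    (≈ᴹ-trans (≈ᴹ-trans (+ᴹ-assoc v _ _) (≈ᴹ-trans (+ᴹ-congˡ (+ᴹ-comm _ _)) (≈ᴹ-sym (+ᴹ-assoc v _ _))))
      (≈ᴹ-sym (expand j i (trans (b-sym j i) b≈0))))
    where
    expand : ∀ i j → b i j ≈ 0# → s i (s j v) ≈ᴹ (v +ᴹ (- κ j v) *ₗ α j) +ᴹ (- κ i v) *ₗ α i
    expand i j b≈0 = ≈ᴹ-trans (s≈ i (s j v)) (+ᴹ-cong (s≈ j v) (*ₗ-congʳ (-‿cong
      (trans (κ-cong i (s≈ j v)) (trans (κ-+ i v _) (trans (+-congˡ (trans (κ-* i (- κ j v) (α j)) (trans (*-congˡ κ≈0) (zeroʳ _)))) (+-identityʳ _)))))))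
      where
      κ≈0 : κ i (α j) ≈ 0#
      κ≈0 = trans (*-congʳ (trans (*-congˡ (trans (b-sym j i) b≈0)) (zeroʳ 2#))) (zeroˡ _)

  -- A simple root orthogonal to all others would form one part of a decomposition of S into
  -- commuting parts.
  connected : ∀ i k → i ≢ k → ¬ (∀ j → i ≢ j → b i j ≈ 0#)
  connected i k i≢k isolated = contradict (irreducible (_≡ i) (i , ≡.refl) (k , i≢k ∘ ≡.sym))
    where
    contradict : (∃₂ λ i′ j → i′ ≡ i × ¬ (j ≡ i) × ¬ (∀ v → s i′ (s j v) ≈ᴹ s j (s i′ v))) → ⊥
    contradict (_ , j , ≡.refl , j≢i , ¬commute) = ¬commute (orthogonal-commute i j (isolated j (j≢i ∘ ≡.sym)))

-- Classification by rescaling the simple roots.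

module Frames (em : ExcludedMiddle 0ℓ) {K : CompleteOrderedField} {T : Trigonometry K}
              {V : Module (CompleteOrderedField.commutativeRing K) 0ℓ 0ℓ}
              (Φ : RootSystem T V 3) (affine : Affine Φ) where
  open CompleteOrderedField K hiding (zero)
  open OrderedFieldProperties K
  open IntegerEmbedding K
  open Solver using (solve; _:=_; _:+_; _:*_; :-_; _:-_; con)
  open OrderedField em K
  open RingProperties ring using (-‿involutive; -0#≈0#)
  open Module V
  open RootSystem Φ
  open Angles em T
  open Classification em Φ affine
  open Framed em Φ using (Frame)
  open SetoidReasoning setoid

  private
    b : Fin 3 → Fin 3 → Carrier
    b i j = ⟪ α i , α j ⟫

    N : Fin 3 → Carrier
    N i = b i i

    b-sym : ∀ i j → b i j ≈ b j i
    b-sym i j = ⟪⟫-sym (α i) (α j)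

    0<2 : 0# < 2#
    0<2 = 0<-+ 0<1 0≤1

    0<N : ∀ i → 0# < N i
    0<N = α-positive

  -- The nodes of the Coxeter diagram, listed in some order.
  record Ordering : Set where
    field
      σ π : Fin 3 → Fin 3
      π-σ : ∀ j → π (σ j) ≡ j
      σ-π : ∀ i → σ (π i) ≡ i

  table : ℤ → ℤ → ℤ → ℤ → ℤ → ℤ → Fin 3 → Fin 3 → ℤ
  table g₀₀ g₀₁ g₀₂ g₁₁ g₁₂ g₂₂ i j = lookup (lookup
    ((g₀₀ ∷ g₀₁ ∷ g₀₂ ∷ []) ∷ (g₀₁ ∷ g₁₁ ∷ g₁₂ ∷ []) ∷ (g₀₂ ∷ g₁₂ ∷ g₂₂ ∷ []) ∷ []) i) j

  module _ (𝓞 : Ordering) (p : Fin 3 → Carrier) (0<p : ∀ j → 0# < p j) (u : Carrier) where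
    open Ordering 𝓞

    -- Scaled Gram entries are doubled and measured in a common unit `u`, which makes them integers
    -- in all three types.
    Gram : Fin 3 → Fin 3 → ℤ → Set
    Gram i j g = 2# * (p i * p j * b (σ i) (σ j)) ≈ ι g * u

    private
      Gram-sym : ∀ {i j g} → Gram i j g → Gram j i g
      Gram-sym {i} {j} eq = trans (*-congˡ (*-cong (*-comm (p j) (p i)) (b-sym (σ j) (σ i)))) eq

    -- The table of integers satisfies A i j g j j = 2 g i j, which is decided by evaluation;
    -- multiplied by the unit, this is the defining relation of the Cartan integers.
    frame : ∀ (𝓐 : AffineType) g₀₀ g₀₁ g₀₂ g₁₁ g₁₂ g₂₂ →
            let g = table g₀₀ g₀₁ g₀₂ g₁₁ g₁₂ g₂₂ in
            {_ : True (all? λ i → all? λ j → AffineType.A 𝓐 i j Int.* g j j ℤP.≟ + 2 Int.* g i j)} →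
            Gram (# 0) (# 0) g₀₀ → Gram (# 0) (# 1) g₀₁ → Gram (# 0) (# 2) g₀₂ →
            Gram (# 1) (# 1) g₁₁ → Gram (# 1) (# 2) g₁₂ → Gram (# 2) (# 2) g₂₂ → Frame 𝓐
    frame 𝓐 g₀₀ g₀₁ g₀₂ g₁₁ g₁₂ g₂₂ {integers} e₀₀ e₀₁ e₀₂ e₁₁ e₁₂ e₂₂ = record
      { e = λ j → p j *ₗ α (σ j) ; σ = σ ; π = π ; π-σ = π-σ ; σ-π = σ-π
      ; p = p ; 0<p = 0<p ; e≈ = λ _ → ≈ᴹ-refl ; cartan = cartan }
      where
      open AffineType 𝓐 using (A)
      g : Fin 3 → Fin 3 → ℤ
      g = table g₀₀ g₀₁ g₀₂ g₁₁ g₁₂ g₂₂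

      G : Fin 3 → Fin 3 → Carrier
      G i j = p i * p j * b (σ i) (σ j)

      gram : ∀ i j → Gram i j (g i j)
      gram zero             zero             = e₀₀
      gram zero             (suc zero)       = e₀₁
      gram zero             (suc (suc zero)) = e₀₂
      gram (suc zero)       zero             = Gram-sym {# 0} {# 1} {g₀₁} e₀₁
      gram (suc zero)       (suc zero)       = e₁₁
      gram (suc zero)       (suc (suc zero)) = e₁₂
      gram (suc (suc zero)) zero             = Gram-sym {# 0} {# 2} {g₀₂} e₀₂
      gram (suc (suc zero)) (suc zero)       = Gram-sym {# 1} {# 2} {g₁₂} e₁₂
      gram (suc (suc zero)) (suc (suc zero)) = e₂₂

      scaled : ∀ i j → ⟪ p i *ₗ α (σ i) , p j *ₗ α (σ j) ⟫ ≈ G i j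
      scaled i j = trans (⟪⟫-*ˡ (p i) _ _) (trans (*-congˡ (trans (⟪⟫-sym _ _) (trans (⟪⟫-*ˡ (p j) _ _) (*-congˡ (b-sym (σ j) (σ i))))))
        (sym (*-assoc (p i) (p j) _)))

      cartan : ∀ i j → 2# * ⟪ p i *ₗ α (σ i) , p j *ₗ α (σ j) ⟫ ≈ ι (A i j) * ⟪ p j *ₗ α (σ j) , p j *ₗ α (σ j) ⟫
      cartan i j = trans (*-congˡ (scaled i j)) (trans (*-cancelˡ (0<⇒≉0 0<2) (begin
        2# * (2# * G i j)              ≈⟨ *-congˡ (gram i j) ⟩
        2# * (ι (g i j) * u)           ≈⟨ *-assoc 2# _ u ⟨
        ι (+ 2) * ι (g i j) * u        ≈⟨ *-congʳ (ι-* (+ 2) (g i j)) ⟨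
        ι (+ 2 Int.* g i j) * u        ≡⟨ ≡.cong (λ n → ι n * u) (toWitness integers i j) ⟨
        ι (A i j Int.* g j j) * u      ≈⟨ trans (*-congʳ (ι-* (A i j) (g j j))) (*-assoc _ _ u) ⟩
        ι (A i j) * (ι (g j j) * u)    ≈⟨ *-congˡ (gram j j) ⟨
        ι (A i j) * (2# * G j j)       ≈⟨ solve 3 (λ a t x → a :* (t :* x) := t :* (a :* x)) refl (ι (A i j)) 2# (G j j) ⟩
        2# * (ι (A i j) * G j j)       ∎)) (*-congˡ (sym (scaled j j))))

  private
    quotient : ∀ {y z} → 0# < y → 0# < z → ∃[ p ] (0# < p × p * y ≈ z)
    quotient {y} {z} 0<y 0<z = z * y ⁻¹ , *-positive 0<z (⁻¹-positive 0<y) ,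
      trans (*-assoc z _ y) (trans (*-congˡ (trans (*-comm _ y) (⁻¹-inverse (0<⇒≉0 0<y)))) (*-identityʳ z))

    -- The scale `p` is fixed by a pairing, p t (- b) = n. Squaring this and inserting the known
    -- value of b² determines the norm p² m after one factor `n` is cancelled.
    norm : ∀ {p b n m} t k r → 0# < n → p * (ι t * - b) ≈ n → ι k * (ι t * ι t * (b * b)) ≈ ι r * (n * m) →
           ι r * (p * p * m) ≈ ι k * n
    norm {p} {b} {n} {m} t k r 0<n pb≈n bb≈ = *-cancelˡ (0<⇒≉0 0<n) (begin
      n * (ι r * (p * p * m))                        ≈⟨ solve 4 (λ n r p m → n :* (r :* (p :* p :* m)) := p :* p :* (r :* (n :* m))) refl n (ι r) p m ⟩
      p * p * (ι r * (n * m))                        ≈⟨ *-congˡ bb≈ ⟨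
      p * p * (ι k * (ι t * ι t * (b * b)))          ≈⟨ solve 4 (λ p k t b → p :* p :* (k :* (t :* t :* (b :* b)))
                                                        := k :* ((p :* (t :* :- b)) :* (p :* (t :* :- b)))) refl p (ι k) (ι t) b ⟩
      ι k * ((p * (ι t * - b)) * (p * (ι t * - b)))  ≈⟨ *-congˡ (*-cong pb≈n pb≈n) ⟩
      ι k * (n * n)                                  ≈⟨ solve 2 (λ k n → k :* (n :* n) := n :* (k :* n)) refl (ι k) n ⟩
      n * (ι k * n)                                  ∎)

    both-zero : ∀ {x y} → 0# ≤ x → 0# ≤ y → x + y ≈ 0# → x ≈ 0# × y ≈ 0#
    both-zero {x} {y} 0≤x 0≤y eq = x≈0 , trans (sym (+-identityˡ y)) (trans (+-congʳ (sym x≈0)) eq)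
      where
      x≈0 : x ≈ 0#
      x≈0 = antisym (≤0-neg (0≤-resp (trans (solve 2 (λ x y → y := (x :+ y) :- x) refl x y)
        (trans (+-congʳ eq) (+-identityˡ (- x)))) 0≤y)) 0≤x

    minus≈0 : ∀ {x y} → x + - y ≈ 0# → x ≈ y
    minus≈0 {x} {y} e = trans (solve 2 (λ x y → x := (x :- y) :+ y) refl x y) (trans (+-congʳ e) (+-identityˡ y))

  module Chain (𝓞 : Ordering) where
    open Ordering 𝓞
    private
      i j k : Fin 3
      i = σ (# 0)
      j = σ (# 1)
      k = σ (# 2)

    -- The scales make (e₀ , e₁) = (e₂ , e₁) = - (e₁ , e₁) / t.
    module _ (t : ℤ) (0<t : 0ℤ Int.< t) (bij<0 : 0# < - b i j) (bjk<0 : 0# < - b j k) (bik≈0 : b i k ≈ 0#) where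
      private
        scale₀ = quotient (*-positive (0<ι 0<t) bij<0) (0<N j)
        scale₂ = quotient (*-positive (0<ι 0<t) bjk<0) (0<N j)

      p : Fin 3 → Carrier
      p zero             = proj₁ scale₀
      p (suc zero)       = 1#
      p (suc (suc zero)) = proj₁ scale₂

      0<p : ∀ l → 0# < p l
      0<p zero             = proj₁ (proj₂ scale₀)
      0<p (suc zero)       = 0<1
      0<p (suc (suc zero)) = proj₁ (proj₂ scale₂)

      p₀b : p (# 0) * (ι t * - b i j) ≈ N j
      p₀b = proj₂ (proj₂ scale₀)

      p₂b : p (# 2) * (ι t * - b j k) ≈ N j
      p₂b = proj₂ (proj₂ scale₂)

      outer : ∀ u → Gram 𝓞 p 0<p u (# 0) (# 2) 0ℤ
      outer u = trans (*-congˡ (trans (*-congˡ bik≈0) (zeroʳ _))) (trans (zeroʳ 2#) (sym (zeroˡ u)))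

    -- With t = 1 and unit Nⱼ the middle root is the short one, and both ends acquire norm 2 Nⱼ.
    c-frame : 0# < - b i j → 0# < - b j k → b i k ≈ 0# →
              2# * (b i j * b i j) ≈ N i * N j → 2# * (b j k * b j k) ≈ N j * N k → Frame C̃₂.affineType
    c-frame bij<0 bjk<0 bik≈0 eij ejk = frame 𝓞 q 0<q (N j) C̃₂.affineType
      (+ 4) (-[1+ 1 ]) 0ℤ (+ 2) (-[1+ 1 ]) (+ 4)
      (end (norm 1ℤ (+ 2) 1ℤ (0<N j) (p₀b 1ℤ 0<1ℤ bij<0 bjk<0 bik≈0) (trans (unit (b i j)) (trans eij (trans (*-comm (N i) (N j)) (sym (*-identityˡ _)))))))
      (trans (solve 3 (λ p b n → (con 1ℤ :+ con 1ℤ) :* (p :* con 1ℤ :* b) := con (-[1+ 1 ]) :* (p :* (con 1ℤ :* :- b))) refl (q (# 0)) (b i j) (N j))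
             (*-congˡ (p₀b 1ℤ 0<1ℤ bij<0 bjk<0 bik≈0)))
      (outer 1ℤ 0<1ℤ bij<0 bjk<0 bik≈0 (N j))
      (solve 1 (λ n → (con 1ℤ :+ con 1ℤ) :* (con 1ℤ :* con 1ℤ :* n) := con (+ 2) :* n) refl (N j))
      (trans (solve 3 (λ p b n → (con 1ℤ :+ con 1ℤ) :* (con 1ℤ :* p :* b) := con (-[1+ 1 ]) :* (p :* (con 1ℤ :* :- b))) refl (q (# 2)) (b j k) (N j))
             (*-congˡ (p₂b 1ℤ 0<1ℤ bij<0 bjk<0 bik≈0)))
      (end (norm 1ℤ (+ 2) 1ℤ (0<N j) (p₂b 1ℤ 0<1ℤ bij<0 bjk<0 bik≈0) (trans (unit (b j k)) (trans ejk (sym (*-identityˡ _))))))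
      where
      0<1ℤ : 0ℤ Int.< 1ℤ
      0<1ℤ = Int.+<+ (ℕ.s≤s ℕ.z≤n)
      q : Fin 3 → Carrier
      q = p 1ℤ 0<1ℤ bij<0 bjk<0 bik≈0
      0<q : ∀ l → 0# < q l
      0<q = 0<p 1ℤ 0<1ℤ bij<0 bjk<0 bik≈0
      unit : ∀ b → ι (+ 2) * (1# * 1# * (b * b)) ≈ 2# * (b * b)
      unit b = solve 1 (λ b → con (+ 2) :* (con 1ℤ :* con 1ℤ :* (b :* b)) := (con 1ℤ :+ con 1ℤ) :* (b :* b)) refl b
      end : ∀ {x n} → 1# * x ≈ ι (+ 2) * n → 2# * x ≈ ι (+ 4) * n
      end {x} {n} e = trans (solve 1 (λ x → (con 1ℤ :+ con 1ℤ) :* x := con (+ 2) :* (con 1ℤ :* x)) refl x)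
        (trans (*-congˡ e) (solve 1 (λ n → con (+ 2) :* (con (+ 2) :* n) := con (+ 4) :* n) refl n))

    -- With t = 2 the first two roots have equal norm. The unit is the norm of the short end e₂, and
    -- 3 u = Nⱼ expresses the triple bond.
    g-frame : 0# < - b i j → 0# < - b j k → b i k ≈ 0# →
              ι (+ 4) * (b i j * b i j) ≈ N i * N j → ι (+ 4) * (b j k * b j k) ≈ ι (+ 3) * (N j * N k) → Frame G̃₂.affineType
    g-frame bij<0 bjk<0 bik≈0 eij ejk = frame 𝓞 q 0<q u G̃₂.affineType
      (+ 6) (-[1+ 2 ]) 0ℤ (+ 6) (-[1+ 2 ]) (+ 2)
      (trans (solve 1 (λ x → (con 1ℤ :+ con 1ℤ) :* x := con (+ 2) :* (con 1ℤ :* x)) refl (q (# 0) * q (# 0) * N i))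
        (trans (*-congˡ (norm (+ 2) 1ℤ 1ℤ (0<N j) p₀b′ (trans (four (b i j)) (trans eij (trans (*-comm (N i) (N j)) (sym (*-identityˡ _)))))))
        (trans (*-congˡ (*-congˡ (sym 3u≈N))) (solve 1 (λ u → con (+ 2) :* (con 1ℤ :* (con (+ 3) :* u)) := con (+ 6) :* u) refl u))))
      (trans (solve 2 (λ p b → (con 1ℤ :+ con 1ℤ) :* (p :* con 1ℤ :* b) := :- (p :* (con (+ 2) :* :- b))) refl (q (# 0)) (b i j))
        (trans (-‿cong (trans p₀b′ (sym 3u≈N))) (solve 1 (λ u → :- (con (+ 3) :* u) := con (-[1+ 2 ]) :* u) refl u)))
      (outer (+ 2) 0<2ℤ bij<0 bjk<0 bik≈0 u)
      (trans (solve 1 (λ n → (con 1ℤ :+ con 1ℤ) :* (con 1ℤ :* con 1ℤ :* n) := con (+ 2) :* n) refl (N j))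
        (trans (*-congˡ (sym 3u≈N)) (solve 1 (λ u → con (+ 2) :* (con (+ 3) :* u) := con (+ 6) :* u) refl u)))
      (trans (solve 2 (λ p b → (con 1ℤ :+ con 1ℤ) :* (con 1ℤ :* p :* b) := :- (p :* (con (+ 2) :* :- b))) refl (q (# 2)) (b j k))
        (trans (-‿cong (trans p₂b′ (sym 3u≈N))) (solve 1 (λ u → :- (con (+ 3) :* u) := con (-[1+ 2 ]) :* u) refl u)))
      refl
      where
      0<2ℤ : 0ℤ Int.< + 2
      0<2ℤ = Int.+<+ (ℕ.s≤s ℕ.z≤n)
      q : Fin 3 → Carrier
      q = p (+ 2) 0<2ℤ bij<0 bjk<0 bik≈0
      0<q : ∀ l → 0# < q l
      0<q = 0<p (+ 2) 0<2ℤ bij<0 bjk<0 bik≈0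
      u : Carrier
      u = q (# 2) * q (# 2) * N k
      p₀b′ : q (# 0) * (ι (+ 2) * - b i j) ≈ N j
      p₀b′ = p₀b (+ 2) 0<2ℤ bij<0 bjk<0 bik≈0
      p₂b′ : q (# 2) * (ι (+ 2) * - b j k) ≈ N j
      p₂b′ = p₂b (+ 2) 0<2ℤ bij<0 bjk<0 bik≈0
      four : ∀ b → 1# * (ι (+ 2) * ι (+ 2) * (b * b)) ≈ ι (+ 4) * (b * b)
      four b = solve 1 (λ b → con 1ℤ :* (con (+ 2) :* con (+ 2) :* (b :* b)) := con (+ 4) :* (b :* b)) refl b
      3u≈N : ι (+ 3) * u ≈ N j
      3u≈N = trans (norm (+ 2) 1ℤ (+ 3) (0<N j) p₂b′ (trans (four (b j k)) ejk)) (*-identityˡ (N j))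

  private
    identity swapped₁₂ swapped₀₁ : Ordering
    identity  = record { σ = id ; π = id ; π-σ = λ _ → ≡.refl ; σ-π = λ _ → ≡.refl }
    swapped₁₂ = record { σ = f ; π = f ; π-σ = f-f ; σ-π = f-f }
      where
      f : Fin 3 → Fin 3
      f zero             = zero
      f (suc zero)       = suc (suc zero)
      f (suc (suc zero)) = suc zero
      f-f : ∀ j → f (f j) ≡ j
      f-f zero             = ≡.refl
      f-f (suc zero)       = ≡.refl
      f-f (suc (suc zero)) = ≡.refl
    swapped₀₁ = record { σ = f ; π = f ; π-σ = f-f ; σ-π = f-f }
      where
      f : Fin 3 → Fin 3
      f zero             = suc zero
      f (suc zero)       = zero
      f (suc (suc zero)) = suc (suc zero)
      f-f : ∀ j → f (f j) ≡ j
      f-f zero             = ≡.refl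
      f-f (suc zero)       = ≡.refl
      f-f (suc (suc zero)) = ≡.refl

    reversed : Ordering → Ordering
    reversed 𝓞 = record
      { σ = σ ∘ f ; π = f ∘ π
      ; π-σ = λ j → ≡.trans (≡.cong f (π-σ (f j))) (f-f j)
      ; σ-π = λ i → ≡.trans (≡.cong σ (f-f (π i))) (σ-π i) }
      where
      open Ordering 𝓞
      f : Fin 3 → Fin 3
      f zero             = suc (suc zero)
      f (suc zero)       = suc zero
      f (suc (suc zero)) = zero
      f-f : ∀ j → f (f j) ≡ j
      f-f zero             = ≡.refl
      f-f (suc zero)       = ≡.refl
      f-f (suc (suc zero)) = ≡.refl

  Result : Set
  Result = ∃[ 𝓐 ] Frame 𝓐

  oblique-neg : ∀ {i j} → Oblique Φ i j → 0# < - b i j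
  oblique-neg (third n _) = n
  oblique-neg (large n _) = n

  oblique-sym : ∀ {i j} → Oblique Φ i j → Oblique Φ j i
  oblique-sym {i} {j} (third n e) = third (0<-resp (-‿cong (b-sym i j)) n)
    (trans (*-congˡ (*-cong (b-sym j i) (b-sym j i))) (trans e (*-comm (N i) (N j))))
  oblique-sym {i} {j} (large n e) = large (0<-resp (-‿cong (b-sym i j)) n)
    (≤-respʳ-≈ (*-congˡ (*-cong (b-sym i j) (b-sym i j))) (≤-respˡ-≈ (*-comm (N i) (N j)) e))

  -- With (eᵢ , eₖ) = 0 the Gram determinant is Nᵢ Nⱼ Nₖ - Nᵢ bⱼₖ² - Nₖ bᵢⱼ².
  chain : ∀ 𝓞 → let open Ordering 𝓞; i = σ (# 0); j = σ (# 1); k = σ (# 2) in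
          det i j k ≈ 0# → b i k ≈ 0# → Oblique Φ i j → Oblique Φ j k → Result
  chain 𝓞 det≈0 bik≈0 = cases
    where
    open Ordering 𝓞
    i j k : Fin 3
    i = σ (# 0)
    j = σ (# 1)
    k = σ (# 2)

    x y : Carrier
    x = b i j * b i j
    y = b j k * b j k

    balance : N i * y + N k * x ≈ N i * N j * N k
    balance = sym (minus≈0 (trans (trans
      (solve 6 (λ n m l p q c → n :* m :* l :- (n :* (q :* q) :+ l :* (p :* p)) :=
        (n :* m :* l :+ (con 1ℤ :+ con 1ℤ) :* (p :* q :* c) :+ :- (n :* (q :* q)) :+ :- (m :* (c :* c)) :+ :- (l :* (p :* p)))
          :+ c :* (m :* c :- (con 1ℤ :+ con 1ℤ) :* (p :* q))) refl (N i) (N j) (N k) (b i j) (b j k) (b i k))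
      (+-cong det≈0 (trans (*-congʳ bik≈0) (zeroˡ _)))) (+-identityˡ 0#)))

    0<P : 0# < N i * N j * N k
    0<P = *-positive (*-positive (0<N i) (0<N j)) (0<N k)

    cases : Oblique Φ i j → Oblique Φ j k → Result
    -- Two simple bonds would give the diagram A₃, whose Gram determinant is positive.
    cases (third _ eij) (third _ ejk) = ⊥-elim (0<⇒≉0 (*-positive 0<2 0<P) (begin
      2# * (N i * N j * N k)                     ≈⟨ solve 1 (λ p → (con 1ℤ :+ con 1ℤ) :* p := con (+ 4) :* p :- (p :+ p)) refl (N i * N j * N k) ⟩
      ι (+ 4) * (N i * N j * N k) + - (N i * N j * N k + N i * N j * N k)
                                                 ≈⟨ +-congʳ (*-congˡ balance) ⟨
      ι (+ 4) * (N i * y + N k * x) + - (N i * N j * N k + N i * N j * N k)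
        ≈⟨ solve 5 (λ n m l x y → con (+ 4) :* (n :* y :+ l :* x) :- (n :* m :* l :+ n :* m :* l)
             := n :* (con (+ 4) :* y :- m :* l) :+ l :* (con (+ 4) :* x :- n :* m)) refl (N i) (N j) (N k) x y ⟩
      N i * (ι (+ 4) * y + - (N j * N k)) + N k * (ι (+ 4) * x + - (N i * N j))
        ≈⟨ +-cong (*-congˡ (trans (+-congʳ ejk) (-‿inverseʳ _))) (*-congˡ (trans (+-congʳ eij) (-‿inverseʳ _))) ⟩
      N i * 0# + N k * 0#                        ≈⟨ trans (+-cong (zeroʳ _) (zeroʳ _)) (+-identityˡ 0#) ⟩
      0#                                         ∎))
    -- With 4 bᵢⱼ² = Nᵢ Nⱼ the balance leaves 4 bⱼₖ² = 3 Nⱼ Nₖ, the value for m = 6.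
    cases (third nij eij) (large njk _) = _ , Chain.g-frame 𝓞 nij njk bik≈0 eij
      (*-cancelˡ (0<⇒≉0 (0<N i)) (begin
        N i * (ι (+ 4) * y)                                            ≈⟨ solve 4 (λ n l x y → n :* (con (+ 4) :* y) := con (+ 4) :* (n :* y :+ l :* x) :- l :* (con (+ 4) :* x)) refl (N i) (N k) x y ⟩
        ι (+ 4) * (N i * y + N k * x) + - (N k * (ι (+ 4) * x))        ≈⟨ +-cong (*-congˡ balance) (-‿cong (*-congˡ eij)) ⟩
        ι (+ 4) * (N i * N j * N k) + - (N k * (N i * N j))            ≈⟨ solve 3 (λ n m l → con (+ 4) :* (n :* m :* l) :- l :* (n :* m) := n :* (con (+ 3) :* (m :* l))) refl (N i) (N j) (N k) ⟩
        N i * (ι (+ 3) * (N j * N k))                                  ∎))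
    cases (large nij _) (third njk ejk) = _ , Chain.g-frame (reversed 𝓞)
      (0<-resp (-‿cong (b-sym j k)) njk) (0<-resp (-‿cong (b-sym i j)) nij) (trans (b-sym k i) bik≈0)
      (trans (*-congˡ (*-cong (b-sym k j) (b-sym k j))) (trans ejk (*-comm (N j) (N k))))
      (trans (*-congˡ (*-cong (b-sym j i) (b-sym j i))) (*-cancelˡ (0<⇒≉0 (0<N k)) (begin
        N k * (ι (+ 4) * x)                                            ≈⟨ solve 4 (λ n l x y → l :* (con (+ 4) :* x) := con (+ 4) :* (n :* y :+ l :* x) :- n :* (con (+ 4) :* y)) refl (N i) (N k) x y ⟩
        ι (+ 4) * (N i * y + N k * x) + - (N i * (ι (+ 4) * y))        ≈⟨ +-cong (*-congˡ balance) (-‿cong (*-congˡ ejk)) ⟩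
        ι (+ 4) * (N i * N j * N k) + - (N i * (N j * N k))            ≈⟨ solve 3 (λ n m l → con (+ 4) :* (n :* m :* l) :- n :* (m :* l) := l :* (con (+ 3) :* (m :* n))) refl (N i) (N j) (N k) ⟩
        N k * (ι (+ 3) * (N j * N i))                                  ∎)))
    -- Both bounds 2 b² ≥ N N have nonnegative slack, and the balance makes a sum of positive
    -- multiples of the slacks vanish. Equality is the value for m = 4.
    cases (large nij lij) (large njk ljk) = _ , Chain.c-frame 𝓞 nij njk bik≈0
      (minus≈0 (*-cancelˡ-0 (0<⇒≉0 (0<N k)) (proj₂ slack))) (minus≈0 (*-cancelˡ-0 (0<⇒≉0 (0<N i)) (proj₁ slack)))
      where
      slack : N i * (2# * y + - (N j * N k)) ≈ 0# × N k * (2# * x + - (N i * N j)) ≈ 0#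
      slack = both-zero (*-nonNeg (proj₁ (0<N i)) (≤⇒0≤- ljk)) (*-nonNeg (proj₁ (0<N k)) (≤⇒0≤- lij)) (begin
        N i * (2# * y + - (N j * N k)) + N k * (2# * x + - (N i * N j))
          ≈⟨ solve 5 (λ n m l x y → n :* ((con 1ℤ :+ con 1ℤ) :* y :- m :* l) :+ l :* ((con 1ℤ :+ con 1ℤ) :* x :- n :* m)
               := (con 1ℤ :+ con 1ℤ) :* ((n :* y :+ l :* x) :- n :* m :* l)) refl (N i) (N j) (N k) x y ⟩
        2# * ((N i * y + N k * x) + - (N i * N j * N k))  ≈⟨ *-congˡ (trans (+-congʳ balance) (-‿inverseʳ _)) ⟩
        2# * 0#                                           ≈⟨ zeroʳ 2# ⟩
        0#                                                ∎)

  private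
    Excess : Fin 3 → Fin 3 → Carrier
    Excess i j = ι (+ 4) * (b i j * b i j) + - (N i * N j)

    0≤excess : ∀ {i j} → Oblique Φ i j → 0# ≤ Excess i j
    0≤excess (third _ e) = ≤-reflexive (sym (trans (+-congʳ e) (-‿inverseʳ _)))
    0≤excess {i} {j} (large _ l) = 0≤-resp
      (solve 2 (λ x n → ((con 1ℤ :+ con 1ℤ) :* (x :* x) :- n) :+ con (+ 2) :* (x :* x) := con (+ 4) :* (x :* x) :- n) refl (b i j) (N i * N j))
      (0≤-+ (≤⇒0≤- l) (*-nonNeg (0≤ι {+ 2} (Int.+≤+ ℕ.z≤n)) (0≤-square (b i j))))

  -- If no two simple roots are orthogonal, then 4 bᵢⱼ² ≥ Nᵢ Nⱼ for all i ≠ j, and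
  -- the vanishing of the determinant forces equality.
  triangle : Oblique Φ (# 0) (# 1) → Oblique Φ (# 0) (# 2) → Oblique Φ (# 1) (# 2) → Result
  triangle o₀₁ o₀₂ o₁₂ = Ã₂.affineType , frame identity q 0<q n₀ Ã₂.affineType
      (+ 2) (-[1+ 0 ]) (-[1+ 0 ]) (+ 2) (-[1+ 0 ]) (+ 2)
      (solve 1 (λ n → (con 1ℤ :+ con 1ℤ) :* (con 1ℤ :* con 1ℤ :* n) := con (+ 2) :* n) refl n₀)
      (trans (solve 2 (λ p b → (con 1ℤ :+ con 1ℤ) :* (con 1ℤ :* p :* b) := con (-[1+ 0 ]) :* (p :* (con (+ 2) :* :- b))) refl q₁ b₀₁) (*-congˡ q₁b))
      (trans (solve 2 (λ p b → (con 1ℤ :+ con 1ℤ) :* (con 1ℤ :* p :* b) := con (-[1+ 0 ]) :* (p :* (con (+ 2) :* :- b))) refl q₂ b₀₂) (*-congˡ q₂b))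
      (*-congˡ {2#} norm₁)
      (trans (solve 3 (λ p q b → (con 1ℤ :+ con 1ℤ) :* (p :* q :* b) := con (-[1+ 0 ]) :* (con (+ 2) :* (p :* q :* :- b))) refl q₁ q₂ b₁₂)
        -- The scales q₁ and q₂ normalise only the pairings with e₀. The remaining pairing has the
        -- right square by `e₁₂` and the two norms, and its sign is known.
        (*-congˡ (square-injective (*-nonNeg (0≤ι {+ 2} (Int.+≤+ ℕ.z≤n)) (*-nonNeg (proj₁ (*-positive (0<q (# 1)) (0<q (# 2)))) (proj₁ (oblique-neg o₁₂)))) (proj₁ (0<N (# 0)))
          (begin
            ι (+ 2) * (q₁ * q₂ * - b₁₂) * (ι (+ 2) * (q₁ * q₂ * - b₁₂))  ≈⟨ solve 3 (λ p q b → con (+ 2) :* (p :* q :* :- b) :* (con (+ 2) :* (p :* q :* :- b)) := p :* p :* (q :* q) :* (con (+ 4) :* (b :* b))) refl q₁ q₂ b₁₂ ⟩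
            q₁ * q₁ * (q₂ * q₂) * (ι (+ 4) * (b₁₂ * b₁₂))                ≈⟨ *-congˡ e₁₂ ⟩
            q₁ * q₁ * (q₂ * q₂) * (n₁ * n₂)                              ≈⟨ solve 4 (λ p q n m → p :* p :* (q :* q) :* (n :* m) := (p :* p :* n) :* (q :* q :* m)) refl q₁ q₂ n₁ n₂ ⟩
            (q₁ * q₁ * n₁) * (q₂ * q₂ * n₂)                              ≈⟨ *-cong norm₁ norm₂ ⟩
            n₀ * n₀                                                      ∎))))
      (*-congˡ {2#} norm₂)
    where
    n₀ = N (# 0)
    n₁ = N (# 1)
    n₂ = N (# 2)
    b₀₁ = b (# 0) (# 1)
    b₀₂ = b (# 0) (# 2)
    b₁₂ = b (# 1) (# 2)
    P = n₀ * n₁ * n₂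
    u = Excess (# 0) (# 1)
    v = Excess (# 0) (# 2)
    w = Excess (# 1) (# 2)
    y = - b₀₁ * - b₁₂ * - b₀₂

    0≤u : 0# ≤ u
    0≤u = 0≤excess o₀₁
    0≤v : 0# ≤ v
    0≤v = 0≤excess o₀₂
    0≤w : 0# ≤ w
    0≤w = 0≤excess o₁₂

    0≤n : ∀ i → 0# ≤ N i
    0≤n i = proj₁ (0<N i)

    -- 4 det = 4 P - 8 y - Σ Nᵢ (excess + Nⱼ Nₖ) = P - 8 y - Σ Nᵢ excess.
    balance : n₀ * w + n₁ * v + n₂ * u ≈ P + - (ι (+ 8) * y)
    balance = sym (minus≈0 (trans (solve 6 (λ n m l p q r →
        (n :* m :* l :- con (+ 8) :* ((:- p) :* (:- q) :* (:- r)))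
          :- (n :* (con (+ 4) :* (q :* q) :- m :* l) :+ m :* (con (+ 4) :* (r :* r) :- n :* l) :+ l :* (con (+ 4) :* (p :* p) :- n :* m)) :=
        con (+ 4) :* (n :* m :* l :+ (con 1ℤ :+ con 1ℤ) :* (p :* q :* r) :+ :- (n :* (q :* q)) :+ :- (m :* (r :* r)) :+ :- (l :* (p :* p))))
        refl n₀ n₁ n₂ b₀₁ b₁₂ b₀₂)
      (trans (*-congˡ det≈0) (zeroʳ _))))

    -- (8 y)² = Π (Nᵢ Nⱼ + excess) ≥ P².
    P≤8y : P ≤ ι (+ 8) * y
    P≤8y = square-reflects-≤ (*-nonNeg (0≤ι {+ 8} (Int.+≤+ ℕ.z≤n))
        (*-nonNeg (*-nonNeg (proj₁ (oblique-neg o₀₁)) (proj₁ (oblique-neg o₁₂))) (proj₁ (oblique-neg o₀₂))))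
      (0≤-⇒≤ (0≤-resp (solve 6 (λ n m l p q r →
          (con (+ 4) :* (p :* p) :- n :* m) :* ((con (+ 4) :* (q :* q)) :* (con (+ 4) :* (r :* r)))
            :+ (n :* m) :* ((con (+ 4) :* (q :* q) :- m :* l) :* (con (+ 4) :* (r :* r)) :+ (m :* l) :* (con (+ 4) :* (r :* r) :- n :* l)) :=
          con (+ 8) :* ((:- p) :* (:- q) :* (:- r)) :* (con (+ 8) :* ((:- p) :* (:- q) :* (:- r))) :- n :* m :* l :* (n :* m :* l))
          refl n₀ n₁ n₂ b₀₁ b₁₂ b₀₂)
        (0≤-+ (*-nonNeg 0≤u (*-nonNeg (4sq b₁₂) (4sq b₀₂)))
          (*-nonNeg (*-nonNeg (0≤n (# 0)) (0≤n (# 1))) (0≤-+ (*-nonNeg 0≤w (4sq b₀₂))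
            (*-nonNeg (*-nonNeg (0≤n (# 1)) (0≤n (# 2))) 0≤v))))))
      where
      4sq : ∀ x → 0# ≤ ι (+ 4) * (x * x)
      4sq x = *-nonNeg (0≤ι {+ 4} (Int.+≤+ ℕ.z≤n)) (0≤-square x)

    zeros : (n₀ * w ≈ 0# × n₁ * v ≈ 0#) × n₂ * u ≈ 0#
    zeros = both-zero (proj₁ nonneg) (proj₁ (proj₂ nonneg)) (proj₁ sum≈0) , proj₂ sum≈0
      where
      nonneg : 0# ≤ n₀ * w × 0# ≤ n₁ * v × 0# ≤ n₂ * u
      nonneg = *-nonNeg (0≤n (# 0)) 0≤w , *-nonNeg (0≤n (# 1)) 0≤v , *-nonNeg (0≤n (# 2)) 0≤u
      total≈0 : n₀ * w + n₁ * v + n₂ * u ≈ 0#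
      total≈0 = antisym
        (≤0-neg (0≤-resp (trans (solve 2 (λ p y → y :- p := :- (p :- y)) refl P (ι (+ 8) * y)) (-‿cong (sym balance))) (≤⇒0≤- P≤8y)))
        (0≤-+ (0≤-+ (proj₁ nonneg) (proj₁ (proj₂ nonneg))) (proj₂ (proj₂ nonneg)))
      sum≈0 : n₀ * w + n₁ * v ≈ 0# × n₂ * u ≈ 0#
      sum≈0 = both-zero (0≤-+ (proj₁ nonneg) (proj₁ (proj₂ nonneg))) (proj₂ (proj₂ nonneg)) total≈0

    e₀₁ : ι (+ 4) * (b₀₁ * b₀₁) ≈ n₀ * n₁
    e₀₁ = minus≈0 (*-cancelˡ-0 (0<⇒≉0 (0<N (# 2))) (proj₂ zeros))
    e₀₂ : ι (+ 4) * (b₀₂ * b₀₂) ≈ n₀ * n₂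
    e₀₂ = minus≈0 (*-cancelˡ-0 (0<⇒≉0 (0<N (# 1))) (proj₂ (proj₁ zeros)))
    e₁₂ : ι (+ 4) * (b₁₂ * b₁₂) ≈ n₁ * n₂
    e₁₂ = minus≈0 (*-cancelˡ-0 (0<⇒≉0 (0<N (# 0))) (proj₁ (proj₁ zeros)))

    scale₁ = quotient (*-positive (0<ι {+ 2} (Int.+<+ (ℕ.s≤s ℕ.z≤n))) (oblique-neg o₀₁)) (0<N (# 0))
    scale₂ = quotient (*-positive (0<ι {+ 2} (Int.+<+ (ℕ.s≤s ℕ.z≤n))) (oblique-neg o₀₂)) (0<N (# 0))
    q₁ = proj₁ scale₁
    q₂ = proj₁ scale₂

    q₁b : q₁ * (ι (+ 2) * - b₀₁) ≈ n₀
    q₁b = proj₂ (proj₂ scale₁)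
    q₂b : q₂ * (ι (+ 2) * - b₀₂) ≈ n₀
    q₂b = proj₂ (proj₂ scale₂)

    q : Fin 3 → Carrier
    q zero             = 1#
    q (suc zero)       = q₁
    q (suc (suc zero)) = q₂

    0<q : ∀ l → 0# < q l
    0<q zero             = 0<1
    0<q (suc zero)       = proj₁ (proj₂ scale₁)
    0<q (suc (suc zero)) = proj₁ (proj₂ scale₂)

    norm′ : ∀ {p b m} → p * (ι (+ 2) * - b) ≈ n₀ → ι (+ 4) * (b * b) ≈ n₀ * m → p * p * m ≈ n₀
    norm′ {p} {b} {m} pb e = trans (sym (*-identityˡ _)) (trans (norm (+ 2) 1ℤ 1ℤ (0<N (# 0)) pb
      (trans (solve 1 (λ b → con 1ℤ :* (con (+ 2) :* con (+ 2) :* (b :* b)) := con (+ 4) :* (b :* b)) refl b)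
        (trans e (sym (*-identityˡ _))))) (*-identityˡ n₀))

    norm₁ : q₁ * q₁ * n₁ ≈ n₀
    norm₁ = norm′ q₁b e₀₁
    norm₂ : q₂ * q₂ * n₂ ≈ n₀
    norm₂ = norm′ q₂b e₀₂

  -- The cases count orthogonal pairs. None gives a cycle; one gives a path, numbered so that the
  -- orthogonal pair sits at its ends; two or more would isolate a node.
  classification : Result
  classification = cases (angle Φ (# 0) (# 1) λ ()) (angle Φ (# 0) (# 2) λ ()) (angle Φ (# 1) (# 2) λ ())
    where
    cases : b (# 0) (# 1) ≈ 0# ⊎ Oblique Φ (# 0) (# 1) → b (# 0) (# 2) ≈ 0# ⊎ Oblique Φ (# 0) (# 2) →
            b (# 1) (# 2) ≈ 0# ⊎ Oblique Φ (# 1) (# 2) → Result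
    cases (inj₂ o₀₁) (inj₂ o₀₂) (inj₂ o₁₂) = triangle o₀₁ o₀₂ o₁₂
    cases (inj₂ o₀₁) (inj₁ e₀₂) (inj₂ o₁₂) = chain identity det≈0 e₀₂ o₀₁ o₁₂
    cases (inj₁ e₀₁) (inj₂ o₀₂) (inj₂ o₁₂) =
      chain swapped₁₂ (trans (det-swap₂₃ (# 0) (# 2) (# 1)) det≈0) e₀₁ o₀₂ (oblique-sym o₁₂)
    cases (inj₂ o₀₁) (inj₂ o₀₂) (inj₁ e₁₂) =
      chain swapped₀₁ (trans (det-swap₁₂ (# 1) (# 0) (# 2)) det≈0) e₁₂ (oblique-sym o₀₁) o₀₂
    cases (inj₁ e₀₁) (inj₁ e₀₂) _ = ⊥-elim (connected (# 0) (# 1) (λ ())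
      (λ { zero 0≢0 → ⊥-elim (0≢0 ≡.refl) ; (suc zero) _ → e₀₁ ; (suc (suc zero)) _ → e₀₂ }))
    cases (inj₁ e₀₁) (inj₂ _) (inj₁ e₁₂) = ⊥-elim (connected (# 1) (# 0) (λ ())
      (λ { zero _ → trans (b-sym (# 1) (# 0)) e₀₁ ; (suc zero) 1≢1 → ⊥-elim (1≢1 ≡.refl) ; (suc (suc zero)) _ → e₁₂ }))
    cases (inj₂ _) (inj₁ e₀₂) (inj₁ e₁₂) = ⊥-elim (connected (# 2) (# 0) (λ ())
      (λ { zero _ → trans (b-sym (# 2) (# 0)) e₀₂ ; (suc zero) _ → trans (b-sym (# 2) (# 1)) e₁₂
         ; (suc (suc zero)) 2≢2 → ⊥-elim (2≢2 ≡.refl) }))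

mainTheorem3 : ExcludedMiddle 0ℓ →
    (ℝ : CompleteOrderedField) (T : Trigonometry ℝ)
    (V : Module (CompleteOrderedField.commutativeRing ℝ) 0ℓ 0ℓ)
    (Φ : RootSystem T V 3) →
    Affine Φ →
    ∃! (Subsets._≗_ (Φ̄ Φ)) (IsOMRS Φ)
mainTheorem3 em ℝ T V Φ affine = coneΦ Φ , coneΦ-isOMRS , λ {d} → unique {d}
  where
  open Roots em Φ using (coneΦ-isOMRS)

  unique : ∀ {d} → IsOMRS Φ d → Subsets._≗_ (Φ̄ Φ) (coneΦ Φ) d
  unique {d} = let 𝓐 , frame = Frames.classification em Φ affine in
    Uniqueness.InCoordinates.coneΦ≗ em Φ (Framed.coordinates em Φ 𝓐 frame) {d}
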